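{- Let $p>3$ be a prime. Then $$\sum_{j=1}^{(p-1)/2}\frac{\binom{2j}{j}}{j^3}\left(\frac{1}{j^2}+H_j^{(2)}\right)\equiv-2\sum_{j=1}^{(p-1)/2}\frac{p}{j^4\binom{2p-2j}{p-j}}\left(\frac{1}{j^2}+H_j^{(2)}\right)\equiv\frac{8}{9}B_{p-5}\pmod p.$$
   Context: For $n\ge 0$, $H_n^{(2)}=\sum_{k=1}^n \frac1{k^2}$. The Bernoulli numbers $B_n$ are defined by $\frac{x}{e^x-1}=\sum_{n=0}^{\infty}B_n\frac{x^n}{n!}$. For rational numbers $a,b$, $a\equiv b\pmod{p}$ means that the $p$-adic valuation of $a-b$ is at least $1$ (i.e. $(a-b)/p$ has denominator prime to $p$). -}

module Defs where

open import Data.Fin.Base using (Fin; zero; suc; toℕ)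
open import Data.Integer.Base as ℤ using (+_)
import Data.Integer.Properties as ℤ
open import Data.Nat.Base as ℕ using (ℕ; zero; suc; NonZero; _!; _∸_; _≤_)
import Data.Nat.Properties as ℕ
import Data.Nat.DivMod as ℕ
import Data.Rational.Unnormalised.Base as ℚᵘ
import Data.Rational.Unnormalised.Properties as ℚᵘ
open import Data.Nat.Divisibility using (∣⇒≤)
open import Data.Nat.Combinatorics using (_C_; nCk≡n!/k![n-k]!; k![n∸k]!∣n!)
open import Data.Nat.Coprimality using (Coprime)
open import Data.Product using (∃-syntax; _×_)
open import Data.Rational using (ℚ; 0ℚ; 1ℚ; _/_; _+_; _-_; _*_; ↧ₙ_; toℚᵘ)
open import Data.Rational.Properties
open import Data.Rational.Solver using (module +-*-Solver)
open import Algebra.Properties.CommutativeMonoid.Sum +-0-commutativeMonoid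
  using (sum-cong-≗; sum-syntax; sum⁺-syntax)
open import Function.Base using (_⟨_⟩_)
open import Relation.Binary.PropositionalEquality

C-nonZero : ∀ {n k} → k ≤ n → NonZero (n C k)
C-nonZero {n} {k} k≤n = subst NonZero (sym (nCk≡n!/k![n-k]! k≤n))
  (ℕ.>-nonZero (ℕ.m≥n⇒m/n>0 {{k ℕ.!* (n ∸ k) !≢0}} (∣⇒≤ {{n ℕ.!≢0}} (k![n∸k]!∣n! k≤n))))

central-nonZero : ∀ p j → NonZero ((2 ℕ.* p ∸ 2 ℕ.* j) C (p ∸ j))
central-nonZero p j = C-nonZero
  (subst (p ∸ j ≤_) (ℕ.*-distribˡ-∸ 2 p j) (ℕ.m≤n*m (p ∸ j) 2))

-- ∑₁ n f = f 1 + ⋯ + f n; the summand may divide by its index.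
∑₁ : ℕ → ((j : ℕ) → .{{NonZero j}} → ℚ) → ℚ
∑₁ n f = ∑[ i < n ] f (suc (toℕ i))

infix 8 H⁽²⁾_

H⁽²⁾_ : ℕ → ℚ
H⁽²⁾ n = ∑₁ n (λ k → (+ 1 / (k ℕ.^ 2)) {{ℕ.m^n≢0 k 2}})

-- Here c is (a − b)/p, so the definition needs no proof that p ≠ 0.
infix 4 _≡_[mod_]

_≡_[mod_] : ℚ → ℚ → ℕ → Set
a ≡ b [mod p ] = ∃[ c ] a - b ≡ (+ p / 1) * c × Coprime (↧ₙ c) p

-- A formal power series is its sequence of coefficients.
Series : Set
Series = ℕ → ℚ

infixl 7 _⊛_

_⊛_ : Series → Series → Series
(f ⊛ g) n = ∑[ k ≤ n ] (f (toℕ k) * g (n ∸ toℕ k))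

var : Series
var 1 = 1ℚ
var _ = 0ℚ

1/! : ℕ → ℚ
1/! n = (+ 1 / (n !)) {{n ℕ.!≢0}}

e^x-1 : Series
e^x-1 zero    = 0ℚ
e^x-1 (suc n) = 1/! (suc n)

-- Long division: a ⊘ h is the quotient when h has constant term 1.
_⊘_ : Series → Series → Series
(a ⊘ h) zero    = a 0
(a ⊘ h) (suc n) = ((λ k → a (suc k) - a 0 * h (suc k)) ⊘ h) n

-- The power series of x/(eˣ − 1): cancel x, then divide.
x/[e^x-1] : Series
x/[e^x-1] = (λ n → var (suc n)) ⊘ (λ n → e^x-1 (suc n))

bernoulli : ℕ → ℚ
bernoulli n = (+ (n !) / 1) * x/[e^x-1] n

private
  shift-⊘ : ∀ a n → ((a ⊘ (λ k → e^x-1 (suc k))) ⊛ e^x-1) (suc n) ≡ a n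
  shift-⊘ a zero = solve 2 (λ x y → x :* con 1ℚ :+ (y :* con 0ℚ :+ con 0ℚ) := x)
    refl (a 0) (a 1 - a 0 * e^x-1 2)
    where open +-*-Solver
  shift-⊘ a (suc n) = trans (cong (_+_ (a 0 * h)) (shift-⊘ (λ k → a (suc k) - a 0 * e^x-1 (2 ℕ.+ k)) n))
    (solve 2 (λ x y → x :+ (y :- x) := y) refl (a 0 * h) (a (suc n)))
    where
    open +-*-Solver
    h = e^x-1 (2 ℕ.+ n)

  *-recip : ∀ m .{{_ : NonZero m}} → (+ m / 1) * (+ 1 / m) ≡ 1ℚ
  *-recip m@(suc _) = toℚᵘ-injective (begin
    toℚᵘ ((+ m / 1) * (+ 1 / m))
      ≈⟨ toℚᵘ-homo-* (+ m / 1) (+ 1 / m) ⟩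
    toℚᵘ (+ m / 1) ℚᵘ.* toℚᵘ (+ 1 / m)
      ≈⟨ ℚᵘ.*-cong (toℚᵘ-fromℚᵘ (+ m ℚᵘ./ 1)) (toℚᵘ-fromℚᵘ (+ 1 ℚᵘ./ m)) ⟩
    (+ m ℚᵘ./ 1) ℚᵘ.* (+ 1 ℚᵘ./ m)
      ≈⟨ ℚᵘ.*≡* (ℤ.*-comm (+ m ℤ.* + 1) (+ 1) ⟨ trans ⟩ cong (+ 1 ℤ.*_) (ℤ.*-comm (+ m) (+ 1))) ⟩
    ℚᵘ.1ℚᵘ ∎)
    where open ℚᵘ.≃-Reasoning

  cancel-! : ∀ n x → (+ (n !) / 1) * x * 1/! n ≡ x
  cancel-! n x = trans
    (solve 3 (λ a y b → a :* y :* b := a :* b :* y) refl (+ (n !) / 1) x (1/! n))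
    (trans (cong (_* x) (*-recip (n !) {{n ℕ.!≢0}})) (*-identityˡ x))
    where open +-*-Solver

-- (∑ Bₙ xⁿ/n!) (eˣ − 1) = x
bernoulli-egf : ((λ n → bernoulli n * 1/! n) ⊛ e^x-1) ≗ var
bernoulli-egf n = trans (sum-cong-≗ {suc n} (λ k → cong (_* e^x-1 (n ∸ toℕ k))
    (cancel-! (toℕ k) (x/[e^x-1] (toℕ k))))) (x/[e^x-1]-⊛ n)
  where
  x/[e^x-1]-⊛ : (x/[e^x-1] ⊛ e^x-1) ≗ var
  x/[e^x-1]-⊛ zero    = refl
  x/[e^x-1]-⊛ (suc n) = shift-⊘ (λ k → var (suc k)) n

{-# OPTIONS --safe #-}
-- Work modulo p with N = (p − 1)/2 and B = B_{p−5}. Let h₁, h₂ be the complete symmetric sums of the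
-- 1/m² (m ≤ j), c_j = C(2j, j), T the first sum of the theorem, and, over j ≤ N, E = Σ c_j h₂(j)/j,
-- w = Σ h₂(j)/j and A = Σ (−1)^j/j⁵.
-- A telescoping sum of Leshchiner type, whose boundary terms contain C(2N, N)/C(2N, N + m) ≡ (−1)^m,
-- gives 4(T + E) ≡ 4A + E − 2w. Expanding c_j times an iterated sum in the C(2j, j + a) shows
-- 2A ≡ Z = Σ 1/(a b² c²) (a ≤ b ≤ c ≤ N); reflecting a ↦ p − a turns Z − w into the sum of
-- 1/(a b² c²) over c < b < a < p, which is (3/2)B by Faulhaber's formula.
-- The same expansion turns E into Σ χ(a)/a⁵ over a < p: the sums Σ_j (a/j) C(2j, j + a) obey
-- D(a+1) + D(a) + D(a−1) ≡ 0 by Pascal's rule, so that χ has period 6. Voronoi's congruence for the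
-- multipliers 2, 3 and 6 gives 27E ≡ −5B, and 36T ≡ −27E + 27B ≡ 32B.
-- Finally C(2p − 2j, p − j) = p u with u j c_j ≡ −2, so the second sum is −T/2.
module Submission where

-- The sum T does not telescope alone. With ρ(j, m) = C(2j, j)/C(2j, j + m), what telescopes is a
-- coefficient of the product of ∏ 1/(1 - x²/m²), m ≤ j, and Σ m ρ(j, m)/(m² - x²); its x⁴ term
-- carries the weight h₂ + h₁/j² + 1/j⁴. The last two summands give T, and the first brings in E,
-- which needs an evaluation of its own. The period 6 comes from the characteristic polynomial t² +
-- t + 1 of the recursion for D, which the sign (-1)^a turns into t² - t + 1. One period of χ, read
-- at f = ⌊6c/p⌋, is -1 - f + 2⌊f/2⌋ + 3⌊f/3⌋: hence the multipliers 6, 3 and 2. For k = p - 5 they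
-- combine to kE ≡ (2^k - 1)(3^k - 1)B, so that E ≡ (2^(-4) - 1)(3^(-4) - 1)B/(-5) = -5B/27.
-- Voronoi's congruence divides a power sum by p, so it alone uses congruences modulo p². Elsewhere
-- fractions are replaced by integers through a^(p - 2); rationals enter only with the Bernoulli
-- numbers and the two sums of the theorem.

open import Data.Integer.Base as ℤ using (ℤ; +_; -[1+_]; 0ℤ; 1ℤ)
import Data.Integer.Properties as ℤ
open import Data.Integer.Tactic.RingSolver using (solve-∀)
open import Data.Nat.Base as ℕ using (ℕ; zero; suc; z≤n; s≤s; pred; NonZero; _!)
open import Data.Nat.Combinatorics using (_C_; nCn≡1; nCk+nC[k+1]≡[n+1]C[k+1])
open import Data.Nat.Combinatorics.Specification using (k>n⇒nCk≡0)
open import Data.Nat.DivMod using (m%n<n; m≡m%n+[m/n]*n; m/n/o≡m/[n*o]; m*n/o*n≡m/o; m*n/n≡m; m<n*o⇒m/o<n)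
open import Data.Nat.Primality using (Prime; prime⇒irreducible; euclidsLemma)
import Data.Nat.Properties as ℕ
open import Data.Nat.Tactic.RingSolver using () renaming (solve-∀ to ℕ-solve-∀)
open import Data.Product using (_,_; ∃-syntax; _×_)
import Data.Rational as ℚ
import Data.Rational.Properties as ℚ
open import Data.Rational.Solver using (module +-*-Solver)
open import Data.Sum.Base using (inj₁; inj₂; [_,_]′)
open import Function.Base using (_∘_)
open import Relation.Binary.PropositionalEquality hiding (J)
open import Relation.Nullary using (¬_; contradiction)
open import Relation.Nullary.Decidable using (toWitness)

-- Finite sums of integers, indexed from 1.

module IntegerSums where

  open import Data.Integer.Base using (_+_; _-_; _*_; -_)
  open import Data.Integer.Properties hiding (module ≤-Reasoning; ≤-refl)

  -- Sum n f = f 1 + ⋯ + f n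
  Sum : ℕ → (ℕ → ℤ) → ℤ
  Sum zero    f = 0ℤ
  Sum (suc n) f = Sum n f + f (suc n)

  Sum-cong : ∀ n {f g : ℕ → ℤ} → (∀ i → i ℕ.< n → f (suc i) ≡ g (suc i)) → Sum n f ≡ Sum n g
  Sum-cong zero    eq = refl
  Sum-cong (suc n) eq = cong₂ _+_ (Sum-cong n (λ i i<n → eq i (ℕ.m<n⇒m<1+n i<n))) (eq n (ℕ.n<1+n n))

  Sum-zero : ∀ n → Sum n (λ _ → 0ℤ) ≡ 0ℤ
  Sum-zero zero    = refl
  Sum-zero (suc n) = trans (+-identityʳ _) (Sum-zero n)

  private
    interchange : ∀ a b c d → (a + b) + (c + d) ≡ (a + c) + (b + d)
    interchange = solve-∀

  Sum-+ : ∀ n f g → Sum n (λ i → f i + g i) ≡ Sum n f + Sum n g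
  Sum-+ zero    f g = refl
  Sum-+ (suc n) f g = trans (cong (_+ (f (suc n) + g (suc n))) (Sum-+ n f g))
    (interchange (Sum n f) (Sum n g) (f (suc n)) (g (suc n)))

  Sum-*ˡ : ∀ n c f → Sum n (λ i → c * f i) ≡ c * Sum n f
  Sum-*ˡ zero    c f = sym (*-zeroʳ c)
  Sum-*ˡ (suc n) c f = trans (cong (_+ c * f (suc n)) (Sum-*ˡ n c f)) (sym (*-distribˡ-+ c (Sum n f) (f (suc n))))

  Sum-*ʳ : ∀ n f c → Sum n (λ i → f i * c) ≡ Sum n f * c
  Sum-*ʳ n f c = trans (Sum-cong n (λ i _ → *-comm (f (suc i)) c)) (trans (Sum-*ˡ n c f) (*-comm c (Sum n f)))

  Sum-neg : ∀ n f → Sum n (λ i → - f i) ≡ - Sum n f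
  Sum-neg zero    f = refl
  Sum-neg (suc n) f = trans (cong (_+ - f (suc n)) (Sum-neg n f)) (sym (neg-distrib-+ (Sum n f) (f (suc n))))

  Sum-sub : ∀ n f g → Sum n (λ i → f i - g i) ≡ Sum n f - Sum n g
  Sum-sub n f g = trans (Sum-+ n f (λ i → - g i)) (cong (_+_ (Sum n f)) (Sum-neg n g))

  Sum-swap : ∀ m n (f : ℕ → ℕ → ℤ) → Sum m (λ i → Sum n (f i)) ≡ Sum n (λ j → Sum m (λ i → f i j))
  Sum-swap zero    n f = sym (Sum-zero n)
  Sum-swap (suc m) n f = trans (cong (_+ Sum n (f (suc m))) (Sum-swap m n f))
    (sym (Sum-+ n (λ j → Sum m (λ i → f i j)) (f (suc m))))

  Sum-head : ∀ n f → Sum (suc n) f ≡ f 1 + Sum n (f ∘ suc)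
  Sum-head zero    f = +-comm 0ℤ (f 1)
  Sum-head (suc n) f = trans (cong (_+ f (suc (suc n))) (Sum-head n f)) (+-assoc (f 1) _ _)

  Sum-++ : ∀ m n f → Sum (m ℕ.+ n) f ≡ Sum m f + Sum n (λ i → f (m ℕ.+ i))
  Sum-++ m zero    f = trans (cong (λ k → Sum k f) (ℕ.+-identityʳ m)) (sym (+-identityʳ _))
  Sum-++ m (suc n) f = trans (cong (λ k → Sum k f) (ℕ.+-suc m n))
    (trans (cong₂ _+_ (Sum-++ m n f) (cong f (sym (ℕ.+-suc m n)))) (+-assoc (Sum m f) _ _))

  Sum-reverse : ∀ n f → Sum n f ≡ Sum n (λ i → f (suc n ℕ.∸ i))
  Sum-reverse zero    f = refl
  Sum-reverse (suc n) f = trans (cong (_+ f (suc n)) (Sum-reverse n f))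
    (trans (+-comm (Sum n (λ i → f (suc n ℕ.∸ i))) (f (suc n)))
    (sym (Sum-head n (λ i → f (suc (suc n) ℕ.∸ i)))))

  Sum-telescope : ∀ n (f : ℕ → ℤ) → Sum n (λ i → f (ℕ.pred i) - f i) ≡ f 0 - f n
  Sum-telescope zero    f = sym (+-inverseʳ (f 0))
  Sum-telescope (suc n) f = trans (cong (_+ (f n - f (suc n))) (Sum-telescope n f)) (lemma (f 0) (f n) (f (suc n)))
    where
    lemma : ∀ a b c → (a - b) + (b - c) ≡ a - c
    lemma = solve-∀

-- Congruences modulo an arbitrary integer, used for p and for p².

module Congruence (m : ℤ) where

  open import Relation.Binary.Bundles using (Setoid)
  open import Data.Integer.Base using (_+_; _-_; _*_; -_; _^_)
  open import Data.Integer.Properties hiding (module ≤-Reasoning; ≤-refl)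
  open IntegerSums

  infix 4 _≈_

  record _≈_ (a b : ℤ) : Set where
    constructor congruent
    field
      quotient : ℤ
      equality : a ≡ b + m * quotient

  ≡⇒≈ : ∀ {a b} → a ≡ b → a ≈ b
  ≡⇒≈ {a} {b} eq = congruent 0ℤ (trans eq (lemma b m))
    where
    lemma : ∀ b m → b ≡ b + m * 0ℤ
    lemma = solve-∀

  ≈-refl : ∀ {a} → a ≈ a
  ≈-refl = ≡⇒≈ refl

  ≈-sym : ∀ {a b} → a ≈ b → b ≈ a
  ≈-sym {a} {b} (congruent q eq) = congruent (- q) (trans (lemma b m q) (cong (_+ m * - q) (sym eq)))
    where
    lemma : ∀ b m q → b ≡ (b + m * q) + m * - q
    lemma = solve-∀

  ≈-trans : ∀ {a b c} → a ≈ b → b ≈ c → a ≈ c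
  ≈-trans {c = c} (congruent q eq) (congruent r eq′) =
    congruent (r + q) (trans eq (trans (cong (_+ m * q) eq′) (lemma c m r q)))
    where
    lemma : ∀ c m r q → (c + m * r) + m * q ≡ c + m * (r + q)
    lemma = solve-∀

  +-cong : ∀ {a b c d} → a ≈ b → c ≈ d → a + c ≈ b + d
  +-cong {b = b} {d = d} (congruent q eq) (congruent r eq′) =
    congruent (q + r) (trans (cong₂ _+_ eq eq′) (lemma b m q d r))
    where
    lemma : ∀ b m q d r → (b + m * q) + (d + m * r) ≡ (b + d) + m * (q + r)
    lemma = solve-∀

  *-cong : ∀ {a b c d} → a ≈ b → c ≈ d → a * c ≈ b * d
  *-cong {b = b} {d = d} (congruent q eq) (congruent r eq′) =
    congruent (q * d + b * r + m * q * r) (trans (cong₂ _*_ eq eq′) (lemma b m q d r))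
    where
    lemma : ∀ b m q d r → (b + m * q) * (d + m * r) ≡ b * d + m * (q * d + b * r + m * q * r)
    lemma = solve-∀

  +ˡ : ∀ c {a b} → a ≈ b → c + a ≈ c + b
  +ˡ c = +-cong (≈-refl {c})

  +ʳ : ∀ c {a b} → a ≈ b → a + c ≈ b + c
  +ʳ c eq = +-cong eq (≈-refl {c})

  *ˡ : ∀ c {a b} → a ≈ b → c * a ≈ c * b
  *ˡ c = *-cong (≈-refl {c})

  *ʳ : ∀ c {a b} → a ≈ b → a * c ≈ b * c
  *ʳ c eq = *-cong eq (≈-refl {c})

  neg-cong : ∀ {a b} → a ≈ b → - a ≈ - b
  neg-cong {b = b} (congruent q eq) = congruent (- q) (trans (cong -_ eq) (lemma b m q))
    where
    lemma : ∀ b m q → - (b + m * q) ≡ - b + m * - q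
    lemma = solve-∀

  sub-cong : ∀ {a b c d} → a ≈ b → c ≈ d → a - c ≈ b - d
  sub-cong eq eq′ = +-cong eq (neg-cong eq′)

  ^-cong : ∀ {a b} n → a ≈ b → a ^ n ≈ b ^ n
  ^-cong zero    eq = ≈-refl
  ^-cong (suc n) eq = *-cong eq (^-cong n eq)

  multiple : ∀ q → m * q ≈ 0ℤ
  multiple q = congruent q (sym (+-identityˡ (m * q)))

  move : ∀ {a b} → a - b ≈ 0ℤ → a ≈ b
  move {a} {b} eq = ≈-trans (≡⇒≈ (lemma a b)) (≈-trans (+-cong eq (≈-refl {b})) (≡⇒≈ (+-identityˡ b)))
    where
    lemma : ∀ a b → a ≡ (a - b) + b
    lemma = solve-∀

  ≈-setoid : Setoid _ _
  ≈-setoid = record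
    { Carrier = ℤ
    ; _≈_ = _≈_
    ; isEquivalence = record { refl = ≈-refl ; sym = ≈-sym ; trans = ≈-trans }
    }

  Sum-≈ : ∀ n {f g : ℕ → ℤ} → (∀ i → i ℕ.< n → f (suc i) ≈ g (suc i)) → Sum n f ≈ Sum n g
  Sum-≈ zero    eq = ≈-refl
  Sum-≈ (suc n) eq = +-cong (Sum-≈ n (λ i i<n → eq i (ℕ.m<n⇒m<1+n i<n))) (eq n (ℕ.n<1+n n))

  Sum-≈0 : ∀ n {f : ℕ → ℤ} → (∀ i → i ℕ.< n → f (suc i) ≈ 0ℤ) → Sum n f ≈ 0ℤ
  Sum-≈0 n eq = ≈-trans (Sum-≈ n eq) (≡⇒≈ (Sum-zero n))

-- Binomial coefficients as integers, and the C(2j, j + a).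

module Binomials where

  open import Data.Integer.Base using (_+_; _-_; _*_; -_)
  open import Data.Integer.Properties hiding (module ≤-Reasoning; ≤-refl)

  binom : ℕ → ℕ → ℤ
  binom n k = + (n C k)

  binom-pascal : ∀ n k → binom (suc n) (suc k) ≡ binom n k + binom n (suc k)
  binom-pascal n k = trans (cong +_ (sym (nCk+nC[k+1]≡[n+1]C[k+1] n k))) (pos-+ (n C k) (n C suc k))

  binom-zero : ∀ {n k} → n ℕ.< k → binom n k ≡ 0ℤ
  binom-zero n<k = cong +_ (k>n⇒nCk≡0 n<k)

  binom-n-0 : ∀ n → binom n 0 ≡ 1ℤ
  binom-n-0 zero    = refl
  binom-n-0 (suc n) = refl

  pos-suc : ∀ n → + suc n ≡ + n + 1ℤ
  pos-suc n = trans (cong +_ (ℕ.+-comm 1 n)) (pos-+ n 1)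

  binom-absorb : ∀ n k → + suc k * binom (suc n) (suc k) ≡ + suc n * binom n k
  binom-absorb zero    zero    = refl
  binom-absorb zero    (suc k) = trans (cong (+ suc (suc k) *_) (binom-zero {1} {suc (suc k)} (s≤s (s≤s z≤n)))) (*-zeroʳ (+ suc (suc k)))
  binom-absorb (suc n) zero    = trans (cong (1ℤ *_) (trans (binom-pascal (suc n) 0) (cong (_+_ 1ℤ) eq)))
      (trans (lemma (+ suc n)) (cong (_* 1ℤ) (sym (pos-+ 1 (suc n)))))
    where
    eq : binom (suc n) 1 ≡ + suc n
    eq = trans (sym (*-identityˡ _)) (trans (binom-absorb n 0) (trans (cong (+ suc n *_) (binom-n-0 n)) (*-identityʳ (+ suc n))))
    lemma : ∀ x → 1ℤ * (1ℤ + x) ≡ (1ℤ + x) * 1ℤ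
    lemma = solve-∀
  binom-absorb (suc n) (suc k) = begin
    + suc (suc k) * binom (suc (suc n)) (suc (suc k)) ≡⟨ cong₂ _*_ (pos-suc (suc k)) (binom-pascal (suc n) (suc k)) ⟩
    (+ suc k + 1ℤ) * (binom (suc n) (suc k) + y) ≡⟨ lemma₁ (+ suc k) (binom (suc n) (suc k)) y ⟩
    + suc k * binom (suc n) (suc k) + binom (suc n) (suc k) + (+ suc k + 1ℤ) * y
      ≡⟨ cong₂ (λ u v → u + binom (suc n) (suc k) + v) (binom-absorb n k)
           (trans (cong (_* y) (sym (pos-suc (suc k)))) (binom-absorb n (suc k))) ⟩
    + suc n * binom n k + binom (suc n) (suc k) + + suc n * binom n (suc k)
      ≡⟨ cong (λ u → + suc n * binom n k + u + + suc n * binom n (suc k)) (binom-pascal n k) ⟩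
    + suc n * binom n k + (binom n k + binom n (suc k)) + + suc n * binom n (suc k)
      ≡⟨ lemma₂ (+ suc n) (binom n k) (binom n (suc k)) ⟩
    (+ suc n + 1ℤ) * (binom n k + binom n (suc k)) ≡⟨ cong₂ _*_ (pos-suc (suc n)) (binom-pascal n k) ⟨
    + suc (suc n) * binom (suc n) (suc k)                  ∎
    where
    open ≡-Reasoning
    y = binom (suc n) (suc (suc k))
    lemma₁ : ∀ s b y → (s + 1ℤ) * (b + y) ≡ s * b + b + (s + 1ℤ) * y
    lemma₁ = solve-∀
    lemma₂ : ∀ s a b → s * a + (a + b) + s * b ≡ (s + 1ℤ) * (a + b)
    lemma₂ = solve-∀

  binom-next : ∀ n k → + suc k * binom n (suc k) ≡ (+ n - + k) * binom n k
  binom-next n k = trans (lemma₁ (+ suc k) (binom n k) (binom n (suc k)))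
    (trans (cong₂ _-_ eq (cong (_* binom n k) (pos-suc k)))
           (trans (cong (λ s → s * binom n k - (+ k + 1ℤ) * binom n k) (pos-suc n)) (lemma₂ (+ n) (+ k) (binom n k))))
    where
    lemma₁ : ∀ s x y → s * y ≡ s * (x + y) - s * x
    lemma₁ = solve-∀
    lemma₂ : ∀ n k x → (n + 1ℤ) * x - (k + 1ℤ) * x ≡ (n - k) * x
    lemma₂ = solve-∀
    eq : + suc k * (binom n k + binom n (suc k)) ≡ + suc n * binom n k
    eq = trans (cong (+ suc k *_) (sym (binom-pascal n k))) (binom-absorb n k)

  binom-upper : ∀ n k → (+ suc n - + k) * binom (suc n) k ≡ + suc n * binom n k
  binom-upper n k = trans (sym (binom-next (suc n) k)) (binom-absorb n k)

  -- central j a = C(2j, j + a), which vanishes for a > j.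
  central : ℕ → ℕ → ℤ
  central j a = binom (j ℕ.+ j) (j ℕ.+ a)

  double-suc : ∀ i → suc i ℕ.+ suc i ≡ suc (suc (i ℕ.+ i))
  double-suc i = cong suc (ℕ.+-suc i i)

  central-zero : ∀ {j a} → j ℕ.< a → central j a ≡ 0ℤ
  central-zero {j} j<a = binom-zero (ℕ.+-monoʳ-< j j<a)

  -- With j = i + 1, the two factors of j² - a² are absorbed in turn: j + a by `binom-absorb`, j - a
  -- by `binom-upper`. The recursions in j of the weighted sums, of the quotients ρ and of C(2p -
  -- 2j, p - j) all come from this identity.
  central-step : ∀ i a → (+ suc i * + suc i - + a * + a) * central (suc i) a
                       ≡ + suc (suc (i ℕ.+ i)) * + suc (i ℕ.+ i) * central i a
  central-step i a = begin
    (+ suc i * + suc i - + a * + a) * central (suc i) a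
      ≡⟨ cong (λ n → (+ suc i * + suc i - + a * + a) * binom n (suc (i ℕ.+ a))) (double-suc i) ⟩
    (+ suc i * + suc i - + a * + a) * binom (suc (suc (i ℕ.+ i))) (suc (i ℕ.+ a))
      ≡⟨ lemma₁ (+ suc i) (+ a) _ ⟩
    (+ suc i - + a) * ((+ suc i + + a) * binom (suc (suc (i ℕ.+ i))) (suc (i ℕ.+ a)))
      ≡⟨ cong (λ s → (+ suc i - + a) * (s * binom (suc (suc (i ℕ.+ i))) (suc (i ℕ.+ a)))) (pos-+ (suc i) a) ⟨
    (+ suc i - + a) * (+ suc (i ℕ.+ a) * binom (suc (suc (i ℕ.+ i))) (suc (i ℕ.+ a)))
      ≡⟨ cong ((+ suc i - + a) *_) (binom-absorb (suc (i ℕ.+ i)) (i ℕ.+ a)) ⟩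
    (+ suc i - + a) * (+ suc (suc (i ℕ.+ i)) * binom (suc (i ℕ.+ i)) (i ℕ.+ a))
      ≡⟨ lemma₂ (+ suc i - + a) (+ suc (suc (i ℕ.+ i))) _ ⟩
    + suc (suc (i ℕ.+ i)) * ((+ suc i - + a) * binom (suc (i ℕ.+ i)) (i ℕ.+ a))
      ≡⟨ cong (λ s → + suc (suc (i ℕ.+ i)) * (s * binom (suc (i ℕ.+ i)) (i ℕ.+ a))) eq ⟩
    + suc (suc (i ℕ.+ i)) * ((+ suc (i ℕ.+ i) - + (i ℕ.+ a)) * binom (suc (i ℕ.+ i)) (i ℕ.+ a))
      ≡⟨ cong (+ suc (suc (i ℕ.+ i)) *_) (binom-upper (i ℕ.+ i) (i ℕ.+ a)) ⟩
    + suc (suc (i ℕ.+ i)) * (+ suc (i ℕ.+ i) * central i a)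
      ≡⟨ *-assoc (+ suc (suc (i ℕ.+ i))) (+ suc (i ℕ.+ i)) (central i a) ⟨
    + suc (suc (i ℕ.+ i)) * + suc (i ℕ.+ i) * central i a ∎
    where
    open ≡-Reasoning
    lemma₁ : ∀ j a x → (j * j - a * a) * x ≡ (j - a) * ((j + a) * x)
    lemma₁ = solve-∀
    lemma₂ : ∀ a b x → a * (b * x) ≡ b * (a * x)
    lemma₂ = solve-∀
    lemma₃ : ∀ s i a → s - a ≡ (s + i) - (i + a)
    lemma₃ = solve-∀
    eq : + suc i - + a ≡ + suc (i ℕ.+ i) - + (i ℕ.+ a)
    eq = trans (lemma₃ (+ suc i) (+ i) (+ a)) (sym (cong₂ _-_ (pos-+ (suc i) i) (pos-+ i a)))

  -- odd-difference i a = (a / j) C(2j, j + a) for j = i + 1.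
  odd-difference : ℕ → ℕ → ℤ
  odd-difference i a = binom (suc (i ℕ.+ i)) (i ℕ.+ a) - binom (suc (i ℕ.+ i)) (suc (i ℕ.+ a))

  central-pascal : ∀ i a → central (suc i) a ≡ binom (suc (i ℕ.+ i)) (i ℕ.+ a) + binom (suc (i ℕ.+ i)) (suc (i ℕ.+ a))
  central-pascal i a = trans (cong (λ n → binom n (suc (i ℕ.+ a))) (double-suc i)) (binom-pascal (suc (i ℕ.+ i)) (i ℕ.+ a))

  -- C(2j, j + a) is the sum of two neighbours x and y in row 2j - 1 with (j + a) y = (j - a) x, and
  -- this relation is a (x + y) = j (x - y) rearranged.
  central-odd-difference : ∀ i a → + a * central (suc i) a ≡ + suc i * odd-difference i a
  central-odd-difference i a = begin
    + a * central (suc i) a ≡⟨ cong (+ a *_) (central-pascal i a) ⟩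
    + a * (x + y) ≡⟨ lemma₁ (+ suc i) (+ a) x y ⟩
    (+ suc i + + a) * y + + suc i * (x - y) - (+ suc i - + a) * x ≡⟨ cong (λ u → u + + suc i * (x - y) - (+ suc i - + a) * x) eq ⟩
    (+ suc i - + a) * x + + suc i * (x - y) - (+ suc i - + a) * x ≡⟨ lemma₂ ((+ suc i - + a) * x) (+ suc i * (x - y)) ⟩
    + suc i * odd-difference i a ∎
    where
    open ≡-Reasoning
    x = binom (suc (i ℕ.+ i)) (i ℕ.+ a)
    y = binom (suc (i ℕ.+ i)) (suc (i ℕ.+ a))
    lemma₁ : ∀ j a x y → a * (x + y) ≡ (j + a) * y + j * (x - y) - (j - a) * x
    lemma₁ = solve-∀
    lemma₂ : ∀ u v → u + v - u ≡ v
    lemma₂ = solve-∀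
    lemma₃ : ∀ s i a → (s + i) - (i + a) ≡ s - a
    lemma₃ = solve-∀
    eq : (+ suc i + + a) * y ≡ (+ suc i - + a) * x
    eq = trans (cong (_* y) (sym (pos-+ (suc i) a)))
      (trans (binom-next (suc (i ℕ.+ i)) (i ℕ.+ a))
      (cong (_* x) (trans (cong₂ _-_ (pos-+ (suc i) i) (pos-+ i a)) (lemma₃ (+ suc i) (+ i) (+ a)))))

-- Arithmetic modulo p = 2n + 5: units, Fermat's theorem, inverses.

module PrimeField (n : ℕ) (prime : Prime (5 ℕ.+ (n ℕ.+ n))) where

  open import Data.Integer.Base using (_+_; _-_; _*_; -_; _^_; ∣_∣)
  open import Data.Integer.Properties hiding (module ≤-Reasoning; ≤-refl)
  open import Data.Integer.Divisibility.Signed using (divides; _∣_; ∣ᵤ⇒∣; ∣⇒∣ᵤ)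
  open import Data.Empty using (⊥)
  open import Data.Nat.Divisibility as ℕ using (>⇒∤)
  open IntegerSums
  open Binomials

  -- `k` is p - 5, the index of the Bernoulli number. Modulo p it is -5, and a^k is a^(-4) for a
  -- unit a.
  p k : ℕ
  p = 5 ℕ.+ (n ℕ.+ n)
  k = n ℕ.+ n

  open Congruence (+ p) public
  open import Relation.Binary.Reasoning.Setoid ≈-setoid

  record Unit (c : ℤ) : Set where
    constructor unit
    field p∤ : ¬ (p ℕ.∣ ∣ c ∣)
  open Unit

  unit-< : ∀ {i} → suc i ℕ.< p → Unit (+ suc i)
  unit-< i<p = unit (>⇒∤ i<p)

  unit-* : ∀ {c d} → Unit c → Unit d → Unit (c * d)
  unit-* {c} {d} (unit p∤c) (unit p∤d) = unit λ p∣cd → [ p∤c , p∤d ]′ (euclidsLemma ∣ c ∣ ∣ d ∣ prime (subst (p ℕ.∣_) (abs-* c d) p∣cd))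

  unit-≈ : ∀ {c d} → c ≈ d → Unit c → Unit d
  unit-≈ {c} {d} (congruent q eq) (unit p∤c) = unit λ p∣d → from (∣ᵤ⇒∣ {+ p} {d} p∣d)
    where
    from : + p ∣ d → ⊥
    from (divides r eq′) = p∤c (∣⇒∣ᵤ (divides (r + q) (trans eq (trans (cong (_+ + p * q) eq′) (lemma r (+ p) q)))))
      where
      lemma : ∀ r p q → r * p + p * q ≡ (r + q) * p
      lemma = solve-∀

  unit-neg : ∀ {c} → Unit c → Unit (- c)
  unit-neg {c} (unit p∤c) = unit λ p∣-c → p∤c (subst (p ℕ.∣_) (∣-i∣≡∣i∣ c) p∣-c)

  cancel : ∀ {c a b} → Unit c → c * a ≈ c * b → a ≈ b
  cancel {c} {a} {b} (unit p∤c) (congruent q eq) with euclidsLemma ∣ c ∣ ∣ a - b ∣ prime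
      (subst (p ℕ.∣_) (abs-* c (a - b)) (∣⇒∣ᵤ (divides q (trans (lemma₁ c a b) (trans (cong (_- c * b) eq) (lemma₂ (c * b) (+ p) q))))))
    where
    lemma₁ : ∀ c a b → c * (a - b) ≡ c * a - c * b
    lemma₁ = solve-∀
    lemma₂ : ∀ x p q → (x + p * q) - x ≡ q * p
    lemma₂ = solve-∀
  ... | inj₁ p∣c = contradiction p∣c p∤c
  ... | inj₂ p∣a-b with ∣ᵤ⇒∣ {+ p} {a - b} p∣a-b
  ...   | divides r eq′ = congruent r (trans (lemma a b) (trans (cong (_+_ b) eq′) (cong (_+_ b) (*-comm r (+ p)))))
    where
    lemma : ∀ a b → a ≡ b + (a - b)
    lemma = solve-∀

  unit-factorʳ : ∀ {c d} → Unit (c * d) → Unit d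
  unit-factorʳ {c} {d} (unit p∤cd) = unit λ p∣d → p∤cd (subst (p ℕ.∣_) (sym (abs-* c d)) (ℕ.∣n⇒∣m*n ∣ c ∣ p∣d))

  unit-1 : Unit 1ℤ
  unit-1 = unit-< (s≤s (s≤s z≤n))

  unit-factor : ∀ {c d} → Unit (c * d) → Unit c
  unit-factor {c} {d} (unit p∤cd) = unit λ p∣c → p∤cd (subst (p ℕ.∣_) (sym (abs-* c d)) (ℕ.∣m⇒∣m*n ∣ d ∣ p∣c))

  -- The terms beyond m vanish, so one range up to M serves all m ≤ M and the induction on m never
  -- has to change it.
  binomial-theorem : ∀ M m a → m ℕ.≤ M → (1ℤ + a) ^ m ≡ 1ℤ + Sum M (λ i → binom m i * a ^ i)
  binomial-theorem M zero a _ = sym (trans (cong (_+_ 1ℤ) (trans (Sum-cong M {g = λ _ → 0ℤ} (λ i _ →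
    cong (_* a ^ suc i) (binom-zero {0} {suc i} (s≤s z≤n)))) (Sum-zero M))) (+-identityʳ 1ℤ))
  binomial-theorem M (suc m) a m<M = trans (cong ((1ℤ + a) *_) (binomial-theorem M m a (ℕ.<⇒≤ m<M)))
    (trans (lemma₁ a (Sum M g)) (cong (_+_ 1ℤ) (sym expand)))
    where
    g : ℕ → ℤ
    g i = binom m i * a ^ i
    lemma₁ : ∀ a s → (1ℤ + a) * (1ℤ + s) ≡ 1ℤ + (a * (1ℤ + s) + s)
    lemma₁ = solve-∀
    lemma₂ : ∀ b c a x → (b + c) * (a * x) ≡ a * (b * x) + c * (a * x)
    lemma₂ = solve-∀
    lemma₃ : ∀ x y → x ≡ (x - y) + y
    lemma₃ = solve-∀
    shift : Sum M (λ i → g (ℕ.pred i)) ≡ 1ℤ + Sum M g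
    shift = trans (lemma₃ _ (Sum M g)) (cong (_+ Sum M g)
      (trans (sym (Sum-sub M (λ i → g (ℕ.pred i)) g)) (trans (Sum-telescope M g)
      (cong₂ _-_ (cong (_* 1ℤ) (binom-n-0 m)) (cong (_* a ^ M) (binom-zero m<M))))))
    expand : Sum M (λ i → binom (suc m) i * a ^ i) ≡ a * (1ℤ + Sum M g) + Sum M g
    expand = trans (Sum-cong M (λ i _ → trans (cong (_* a ^ suc i) (binom-pascal m i)) (lemma₂ (binom m i) (binom m (suc i)) a (a ^ i))))
      (trans (Sum-+ M (λ i → a * g (ℕ.pred i)) g) (cong (_+ Sum M g)
      (trans (Sum-*ˡ M a (λ i → g (ℕ.pred i))) (cong (a *_) shift))))

  -- For 0 < i < p the factor i is a unit and i C(p, i) = p C(p - 1, i - 1), so only the two end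
  -- terms of the expansion survive.
  frobenius-suc : ∀ a → (1ℤ + a) ^ p ≈ 1ℤ + a ^ p
  frobenius-suc a = begin
    (1ℤ + a) ^ p ≡⟨ binomial-theorem p p a ℕ.≤-refl ⟩
    1ℤ + (Sum (4 ℕ.+ k) (λ i → binom p i * a ^ i) + binom p p * a ^ p)
      ≈⟨ +ˡ 1ℤ (+-cong (Sum-≈0 (4 ℕ.+ k) middle) (≡⇒≈ {binom p p * a ^ p} {1ℤ * a ^ p} (cong (λ c → + c * a ^ p) (nCn≡1 p)))) ⟩
    1ℤ + (0ℤ + 1ℤ * a ^ p) ≡⟨ cong (_+_ 1ℤ) (trans (+-identityˡ _) (*-identityˡ (a ^ p))) ⟩
    1ℤ + a ^ p                                                 ∎
    where
    middle : ∀ i → i ℕ.< 4 ℕ.+ k → binom p (suc i) * a ^ suc i ≈ 0ℤ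
    middle i i<p-1 = *ʳ (a ^ suc i) {binom p (suc i)} {0ℤ} (cancel (unit-< (s≤s i<p-1)) (begin
      + suc i * binom p (suc i) ≡⟨ binom-absorb (4 ℕ.+ k) i ⟩
      + p * binom (4 ℕ.+ k) i ≈⟨ multiple (binom (4 ℕ.+ k) i) ⟩
      0ℤ ≡⟨ *-zeroʳ (+ suc i) ⟨
      + suc i * 0ℤ                ∎))

  fermat : ∀ a → (+ a) ^ p ≈ + a
  fermat zero    = ≈-refl
  fermat (suc a) = begin
    (+ suc a) ^ p ≡⟨ cong (_^ p) (pos-+ 1 a) ⟩
    (1ℤ + + a) ^ p ≈⟨ frobenius-suc (+ a) ⟩
    1ℤ + (+ a) ^ p ≈⟨ +ˡ 1ℤ (fermat a) ⟩
    1ℤ + + a ≡⟨ pos-+ 1 a ⟨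
    + suc a            ∎

  little-fermat : ∀ {a} → Unit (+ a) → (+ a) ^ (4 ℕ.+ k) ≈ 1ℤ
  little-fermat {a} p∤a = cancel p∤a (≈-trans (fermat a) (≡⇒≈ (sym (*-identityʳ (+ a)))))

  abstract
    -- a^(p−2): the inverse of a modulo p, and 0 for a divisible by p.
    ι : ℕ → ℤ
    ι a = (+ a) ^ (3 ℕ.+ k)

    ι-power : ∀ a → ι a ≡ (+ a) ^ (3 ℕ.+ k)
    ι-power a = refl

    *-ι : ∀ {a} → Unit (+ a) → + a * ι a ≈ 1ℤ
    *-ι = little-fermat

  ι-unique : ∀ {a x} → Unit (+ a) → + a * x ≈ 1ℤ → x ≈ ι a
  ι-unique p∤a ax≈1 = cancel p∤a (≈-trans ax≈1 (≈-sym (*-ι p∤a)))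

  ι² : ∀ {a} → Unit (+ a) → + a * (ι a * ι a) ≈ ι a
  ι² {a} p∤a = ≈-trans (≡⇒≈ (sym (*-assoc (+ a) (ι a) (ι a)))) (≈-trans (*ʳ (ι a) (*-ι p∤a)) (≡⇒≈ (*-identityˡ (ι a))))

  abstract
    N : ℕ
    N = 2 ℕ.+ n

    N≡2+n : N ≡ 2 ℕ.+ n
    N≡2+n = refl

    p≡1+2N : p ≡ suc (N ℕ.+ N)
    p≡1+2N = cong (λ m → 3 ℕ.+ m) (sym (trans (ℕ.+-suc n (suc n)) (cong suc (ℕ.+-suc n n))))

  abstract
    P : ℕ
    P = 4 ℕ.+ k

    P≡4+k : P ≡ 4 ℕ.+ k
    P≡4+k = refl

  suc-P : suc P ≡ p
  suc-P = cong suc P≡4+k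

  P≡2N : P ≡ N ℕ.+ N
  P≡2N = ℕ.suc-injective (trans suc-P p≡1+2N)

  1+2N≈0 : 1ℤ + (+ N + + N) ≈ 0ℤ
  1+2N≈0 = ≈-trans (≡⇒≈ (trans (cong (_+_ 1ℤ) (sym (pos-+ N N))) (trans (sym (pos-+ 1 (N ℕ.+ N)))
    (trans (cong +_ (sym p≡1+2N)) (sym (*-identityʳ (+ p))))))) (multiple 1ℤ)

  N<p : N ℕ.< p
  N<p = subst (N ℕ.<_) (sym p≡1+2N) (s≤s (ℕ.m≤m+n N N))

  unit-≤N : ∀ {i} → i ℕ.< N → Unit (+ suc i)
  unit-≤N i<N = unit-< (ℕ.≤-<-trans i<N N<p)

  unit-odd : ∀ {i} → i ℕ.< N → Unit (+ suc (i ℕ.+ i))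
  unit-odd {i} i<N = unit-< (subst (suc (i ℕ.+ i) ℕ.<_) (sym p≡1+2N) (s≤s (ℕ.+-mono-<  i<N i<N)))

  unit-≤P : ∀ {i} → i ℕ.< P → Unit (+ suc i)
  unit-≤P {i} i<P = unit-< (subst (suc i ℕ.<_) suc-P (s≤s i<P))

  p≈0 : + p ≈ 0ℤ
  p≈0 = ≈-trans (≡⇒≈ (sym (*-identityʳ (+ p)))) (multiple 1ℤ)

  P≈-1 : + P ≈ - 1ℤ
  P≈-1 = ≈-trans (≡⇒≈ (lemma (+ P))) (+ʳ (- 1ℤ) (≈-trans (≡⇒≈ (trans (sym (pos-+ 1 P)) (cong +_ suc-P))) p≈0))
    where
    lemma : ∀ x → x ≡ (1ℤ + x) + - 1ℤ
    lemma = solve-∀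

  !-unit : ∀ m → m ℕ.< p → Unit (+ (m !))
  !-unit zero    _   = unit-1
  !-unit (suc m) m<p = subst Unit (sym (pos-* (suc m) (m !))) (unit-* (unit-< m<p) (!-unit m (ℕ.<⇒≤ m<p)))

  ι-+ : ∀ {a b} → a ℕ.+ b ≡ p → Unit (+ a) → Unit (+ b) → ι a ≈ - ι b
  ι-+ {a} {b} a+b≡p ua ub = ≈-sym (ι-unique ua (begin
    + a * - ι b ≡⟨ lemma (+ a) (+ b) (ι b) ⟩
    + b * ι b - (+ a + + b) * ι b ≈⟨ sub-cong (*-ι ub) (*ʳ (ι b) (≈-trans (≡⇒≈ (trans (sym (pos-+ a b)) (cong +_ a+b≡p))) p≈0)) ⟩
    1ℤ - 0ℤ * ι b ≡⟨ cong (_-_ 1ℤ) (*-zeroˡ (ι b)) ⟩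
    1ℤ                                 ∎))
    where
    lemma : ∀ a b v → a * - v ≡ b * v - (a + b) * v
    lemma = solve-∀

  pos-^ : ∀ a m → + (a ℕ.^ m) ≡ (+ a) ^ m
  pos-^ a zero    = refl
  pos-^ a (suc m) = trans (pos-* a (a ℕ.^ m)) (cong (+ a *_) (pos-^ a m))

  unit-^ : ∀ {a} m → Unit (+ a) → Unit (+ (a ℕ.^ m))
  unit-^ zero        u = unit-1
  unit-^ {a} (suc m) u = subst Unit (sym (pos-* a (a ℕ.^ m))) (unit-* u (unit-^ m u))

-- Expanding C(2j, j) times nested sums in the C(2j, j + a).

module CentralSums (n : ℕ) (prime : Prime (5 ℕ.+ (n ℕ.+ n))) where

  open import Data.Integer.Base using (_+_; _-_; _*_; -_)
  open import Data.Integer.Properties hiding (module ≤-Reasoning; ≤-refl)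
  open IntegerSums
  open Binomials
  open PrimeField n prime
  open import Relation.Binary.Reasoning.Setoid ≈-setoid

  q : ℕ → ℤ
  q a = ι a * ι a

  square-q : ∀ {a} → Unit (+ a) → + a * + a * q a ≈ 1ℤ
  square-q {a} u = begin
    + a * + a * q a ≡⟨ lemma (+ a) (ι a) ⟩
    (+ a * ι a) * (+ a * ι a) ≈⟨ *-cong (*-ι u) (*-ι u) ⟩
    1ℤ                         ∎
    where
    lemma : ∀ a v → a * a * (v * v) ≡ (a * v) * (a * v)
    lemma = solve-∀

  -- Iterated, this gives sums over weakly ordered indices, hence complete symmetric sums when
  -- started from the constant 1.
  star : (ℕ → ℤ) → ℕ → ℤ
  star g j = Sum j (λ m → g m * q m)

  h₁ h₂ : ℕ → ℤ
  h₁ = star (λ _ → 1ℤ)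
  h₂ = star h₁

  -- The upper limit N serves every j ≤ N, because C(2j, j + a) = 0 for a > j; a range independent
  -- of j lets the sums over j and a be interchanged.
  weighted : (ℕ → ℤ) → ℕ → ℤ
  weighted w j = Sum N (λ a → w a * central j a)

  _·q : (ℕ → ℤ) → ℕ → ℤ
  (w ·q) a = w a * q a

  -- j² C(2j, j+a) = a² C(2j, j+a) + 2j (2j−1) C(2j−2, j−1+a): each factor 1/a² in the weight
  -- becomes a partial sum with weight 1/j².
  weighted-star : ∀ w g → (∀ i → i ℕ.< N → weighted w (suc i) ≈ central (suc i) 0 * g (suc i)) →
                  ∀ j → j ℕ.≤ N → weighted (w ·q) j ≈ central j 0 * star g j
  weighted-star w g hyp zero _ = Sum-≈0 N λ a _ → ≡⇒≈ (trans
    (cong ((w ·q) (suc a) *_) (central-zero {0} {suc a} (s≤s z≤n))) (*-zeroʳ ((w ·q) (suc a))))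
  weighted-star w g hyp (suc i) i<N = cancel (unit-* J-unit J-unit) (begin
    J * J * weighted (w ·q) (suc i)
      ≡⟨ Sum-*ˡ N (J * J) _ ⟨
    Sum N (λ a → J * J * (w a * q a * central (suc i) a))
      ≈⟨ Sum-≈ N term ⟩
    Sum N (λ a → w a * central (suc i) a + K * ((w ·q) a * central i a))
      ≡⟨ trans (Sum-+ N _ _) (cong (_+_ (weighted w (suc i))) (Sum-*ˡ N K _)) ⟩
    weighted w (suc i) + K * weighted (w ·q) i
      ≈⟨ +-cong (hyp i i<N) (*ˡ K (weighted-star w g hyp i (ℕ.<⇒≤ i<N))) ⟩
    c * g (suc i) + K * (central i 0 * star g i)
      ≡⟨ cong (_+_ (c * g (suc i))) (trans (sym (*-assoc K (central i 0) (star g i)))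
           (cong (_* star g i) (trans (sym (central-step i 0)) (cong (_* c) (lemma₀ J))))) ⟩
    c * g (suc i) + J * J * c * star g i
      ≈⟨ +ʳ (J * J * c * star g i) (*ˡ c (≈-trans (≡⇒≈ (sym (*-identityʳ (g (suc i))))) (*ˡ (g (suc i)) (≈-sym (square-q J-unit))))) ⟩
    c * (g (suc i) * (J * J * q (suc i))) + J * J * c * star g i
      ≡⟨ lemma₁ J c (g (suc i)) (q (suc i)) (star g i) ⟩
    J * J * (c * star g (suc i)) ∎)
    where
    J = + suc i
    K = + suc (suc (i ℕ.+ i)) * + suc (i ℕ.+ i)
    c = central (suc i) 0
    J-unit = unit-≤N i<N
    lemma₀ : ∀ j → j * j - 0ℤ ≡ j * j
    lemma₀ = solve-∀
    lemma₁ : ∀ j c g q s → c * (g * (j * j * q)) + j * j * c * s ≡ j * j * (c * (s + g * q))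
    lemma₁ = solve-∀
    lemma₂ : ∀ j a w q c → j * j * (w * q * c) ≡ w * (a * a * q) * c + w * q * ((j * j - a * a) * c)
    lemma₂ = solve-∀
    lemma₃ : ∀ w q k c c′ → w * 1ℤ * c + w * q * (k * c′) ≡ w * c + k * (w * q * c′)
    lemma₃ = solve-∀
    term : ∀ b → b ℕ.< N → J * J * (w (suc b) * q (suc b) * central (suc i) (suc b))
           ≈ w (suc b) * central (suc i) (suc b) + K * ((w ·q) (suc b) * central i (suc b))
    term b b<N = begin
      J * J * (w a * q a * central (suc i) a)
        ≡⟨ lemma₂ J (+ a) (w a) (q a) (central (suc i) a) ⟩
      w a * (+ a * + a * q a) * central (suc i) a + w a * q a * ((J * J - + a * + a) * central (suc i) a)
        ≈⟨ +-cong (*ʳ (central (suc i) a) (*ˡ (w a) (square-q (unit-≤N b<N))))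
                  (≡⇒≈ (cong (w a * q a *_) (central-step i a))) ⟩
      w a * 1ℤ * central (suc i) a + w a * q a * (K * central i a)
        ≡⟨ lemma₃ (w a) (q a) K (central (suc i) a) (central i a) ⟩
      w a * central (suc i) a + K * ((w ·q) a * central i a) ∎
      where a = suc b

  alt : ℕ → ℤ
  alt zero    = 1ℤ
  alt (suc a) = - alt a

  half : ℕ → ℕ → ℤ
  half i a = binom (suc (i ℕ.+ i)) (i ℕ.+ a)

  half-suc : ∀ i a → binom (suc (i ℕ.+ i)) (suc (i ℕ.+ a)) ≡ half i (suc a)
  half-suc i a = cong (binom (suc (i ℕ.+ i))) (sym (ℕ.+-suc i a))

  half-zero : ∀ {i} → i ℕ.< N → half i (suc N) ≡ 0ℤ
  half-zero {i} i<N = binom-zero (subst (suc (i ℕ.+ i) ℕ.<_) (sym (ℕ.+-suc i N)) (s≤s (ℕ.+-monoʳ-< i i<N)))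

  half-double : ∀ i → + 2 * half i 1 ≡ central (suc i) 0
  half-double i = sym (trans (trans (central-pascal i 0) (cong₂ _+_ eq (half-suc i 0))) (lemma (half i 1)))
    where
    lemma : ∀ x → x + x ≡ + 2 * x
    lemma = solve-∀
    lemma₂ : ∀ s i → (s + i) - i ≡ s
    lemma₂ = solve-∀
    eq : half i 0 ≡ half i 1
    eq = sym (*-cancelˡ-≡ (+ suc i) (half i 1) (half i 0) (trans (cong (λ k → + suc i * binom (suc (i ℕ.+ i)) k) (ℕ.+-comm i 1))
      (trans (binom-next (suc (i ℕ.+ i)) i) (cong₂ (λ s k → s * binom (suc (i ℕ.+ i)) k)
        (trans (cong (_- + i) (pos-+ (suc i) i)) (lemma₂ (+ suc i) (+ i))) (sym (ℕ.+-identityʳ i))))))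

  Sum-odd-difference : ∀ {i} → i ℕ.< N → Sum N (odd-difference i) ≡ half i 1
  Sum-odd-difference {i} i<N = trans
    (Sum-cong N {g = λ a → half i (suc (ℕ.pred a)) - half i (suc a)} (λ a _ → cong (_-_ (half i (suc a))) (half-suc i (suc a))))
    (trans (Sum-telescope N (λ a → half i (suc a)))
    (trans (cong (_-_ (half i 1)) (half-zero i<N)) (+-identityʳ (half i 1))))

  -- a C(2j, j + a) is j times an odd difference, so the sum telescopes to 2j C(2j - 1, j) = j C(2j,
  -- j). This starts the expansion of `Z₂`.
  weighted-linear : ∀ i → i ℕ.< N → weighted (λ a → + 2 * + a) (suc i) ≡ central (suc i) 0 * + suc i
  weighted-linear i i<N = trans
    (Sum-cong N (λ b _ → trans (*-assoc (+ 2) (+ suc b) _)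
      (trans (cong (+ 2 *_) (central-odd-difference i (suc b))) (lemma (+ suc i) (odd-difference i (suc b))))))
    (trans (Sum-*ˡ N (+ suc i * + 2) (odd-difference i))
    (trans (cong (+ suc i * + 2 *_) (Sum-odd-difference i<N))
    (trans (*-assoc (+ suc i) (+ 2) (half i 1)) (trans (cong (+ suc i *_) (half-double i)) (*-comm (+ suc i) _)))))
    where
    lemma : ∀ j d → + 2 * (j * d) ≡ j * + 2 * d
    lemma = solve-∀

  -- By Pascal's rule the signs make this sum telescope too, to 2 C(2j - 1, j). This starts the
  -- expansion of `h₂`.
  weighted-alternating : ∀ i → i ℕ.< N → weighted (λ a → + 2 * - alt a) (suc i) ≡ central (suc i) 0
  weighted-alternating i i<N = trans
    (Sum-cong N {g = λ a → + 2 * (F (ℕ.pred a) - F a)} (λ b _ →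
      trans (cong (+ 2 * - alt (suc b) *_) (trans (central-pascal i (suc b)) (cong (_+_ (half i (suc b))) (half-suc i (suc b)))))
      (lemma (alt b) (half i (suc b)) (half i (suc (suc b))))))
    (trans (Sum-*ˡ N (+ 2) _) (trans (cong (+ 2 *_) (trans (Sum-telescope N F)
      (trans (cong₂ _-_ (*-identityˡ (half i 1)) (trans (cong (alt N *_) (half-zero i<N)) (*-zeroʳ (alt N)))) (+-identityʳ (half i 1)))))
    (half-double i)))
    where
    F : ℕ → ℤ
    F a = alt a * half i (suc a)
    lemma : ∀ s x y → + 2 * - - s * (x + y) ≡ + 2 * (s * x - - s * y)
    lemma = solve-∀

  -- `weighted-star` is applied twice: the weight becomes 2(-1)^(a - 1)/a⁴, while the constant 1
  -- becomes `h₁` and then `h₂`.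
  central-h₂ : ∀ j → j ℕ.≤ N → weighted ((λ a → + 2 * - alt a) ·q ·q) j ≈ central j 0 * h₂ j
  central-h₂ = weighted-star (w ·q) h₁ λ i → weighted-star w (λ _ → 1ℤ) (λ i i<N →
    ≡⇒≈ (trans (weighted-alternating i i<N) (sym (*-identityʳ (central (suc i) 0))))) (suc i)
    where
    w : ℕ → ℤ
    w a = + 2 * - alt a

  pos : ℕ → ℤ
  pos j = + j

  -- As m/m² = 1/m, the value at N is Z of the overview modulo p. Starting from m rather than from
  -- 1/m lets all three levels be instances of `star`.
  Z₂ : ℕ → ℤ
  Z₂ = star (star (star pos))

  central-Z₂ : ∀ j → j ℕ.≤ N → weighted ((λ a → + 2 * + a) ·q ·q ·q) j ≈ central j 0 * Z₂ j
  central-Z₂ = weighted-star (w ·q ·q) (star (star pos)) λ i →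
    weighted-star (w ·q) (star pos) (λ i → weighted-star w pos (λ i i<N → ≡⇒≈ (weighted-linear i i<N)) (suc i)) (suc i)
    where
    w : ℕ → ℤ
    w a = + 2 * + a

  central-next : ∀ j a → (+ j + + a + 1ℤ) * central j (suc a) ≡ (+ j - + a) * central j a
  central-next j a = trans (cong₂ _*_ (trans (cong (_+ 1ℤ) (sym (pos-+ j a))) (sym (pos-suc (j ℕ.+ a))))
      (cong (binom (j ℕ.+ j)) (ℕ.+-suc j a)))
    (trans (binom-next (j ℕ.+ j) (j ℕ.+ a)) (cong (_* central j a)
    (trans (cong₂ _-_ (pos-+ j j) (pos-+ j a)) (lemma (+ j) (+ a)))))
    where
    lemma : ∀ j a → (j + j) - (j + a) ≡ j - a
    lemma = solve-∀

  -- Since 2N ≡ -1, 2(N - a) ≡ -(2a + 1) and 2(N + a + 1) ≡ 2a + 1, so neighbouring coefficients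
  -- have ratio -1. Doubling makes 2N + 1 appear, and 2a + 1 < p is a unit.
  central-N : ∀ a → a ℕ.≤ N → central N a ≈ alt a * central N 0
  central-N zero    _   = ≡⇒≈ (sym (*-identityˡ (central N 0)))
  central-N (suc a) a<N = ≈-trans
    (cancel (unit-odd a<N) (begin
      + suc (a ℕ.+ a) * central N (suc a)
        ≡⟨ cong (_* central N (suc a)) (trans (pos-suc (a ℕ.+ a)) (cong (_+ 1ℤ) (pos-+ a a))) ⟩
      (+ a + + a + 1ℤ) * central N (suc a)
        ≡⟨ lemma₁ (+ N) (+ a) (central N (suc a)) ⟩
      + 2 * ((+ N + + a + 1ℤ) * central N (suc a)) - (1ℤ + (+ N + + N)) * central N (suc a)
        ≈⟨ sub-cong (≡⇒≈ (cong (+ 2 *_) (central-next N a))) (*ʳ (central N (suc a)) 1+2N≈0) ⟩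
      + 2 * ((+ N - + a) * central N a) - 0ℤ
        ≡⟨ lemma₂ (+ N) (+ a) (central N a) ⟩
      (1ℤ + (+ N + + N)) * central N a + (+ a + + a + 1ℤ) * - central N a
        ≈⟨ +ʳ ((+ a + + a + 1ℤ) * - central N a) (*ʳ (central N a) 1+2N≈0) ⟩
      0ℤ + (+ a + + a + 1ℤ) * - central N a
        ≡⟨ trans (+-identityˡ _) (cong (_* - central N a) (sym (trans (pos-suc (a ℕ.+ a)) (cong (_+ 1ℤ) (pos-+ a a))))) ⟩
      + suc (a ℕ.+ a) * - central N a ∎))
    (≈-trans (neg-cong (central-N a (ℕ.<⇒≤ a<N))) (≡⇒≈ (neg-distribˡ-* (alt a) (central N 0))))
    where
    lemma₁ : ∀ n a x → (a + a + 1ℤ) * x ≡ + 2 * ((n + a + 1ℤ) * x) - (1ℤ + (n + n)) * x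
    lemma₁ = solve-∀
    lemma₂ : ∀ n a x → + 2 * ((n - a) * x) - 0ℤ ≡ (1ℤ + (n + n)) * x + (a + a + 1ℤ) * - x
    lemma₂ = solve-∀

  central-self : ∀ j → central j j ≡ 1ℤ
  central-self j = cong +_ (nCn≡1 (j ℕ.+ j))

  -- Descent from C(2j, 2j) = 1 on d = j - a: by `central-next`, (j - a) C(2j, j + a) equals j + a +
  -- 1 ≤ 2N times the next coefficient, a product of units, and a factor of a unit is a unit.
  central-unit : ∀ {j} → j ℕ.≤ N → ∀ d a → a ℕ.+ d ≡ j → Unit (central j a)
  central-unit {j} j≤N zero a eq = subst (λ b → Unit (central j b)) (trans (sym eq) (ℕ.+-identityʳ a))
    (subst Unit (sym (central-self j)) unit-1)
  central-unit {j} j≤N (suc d) a eq = unit-factorʳ {+ j - + a} (subst Unit (central-next j a)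
    (unit-* (subst Unit (trans (pos-suc (j ℕ.+ a)) (cong (_+ 1ℤ) (pos-+ j a))) (unit-< j+a<p))
            (central-unit j≤N d (suc a) (trans (sym (ℕ.+-suc a d)) eq))))
    where
    a<j : a ℕ.< j
    a<j = subst (suc a ℕ.≤_) (trans (sym (ℕ.+-suc a d)) eq) (s≤s (ℕ.m≤m+n a d))
    j+a<p : suc (j ℕ.+ a) ℕ.< p
    j+a<p = subst (suc (j ℕ.+ a) ℕ.<_) (sym p≡1+2N) (s≤s (ℕ.+-mono-≤-< j≤N (ℕ.<-≤-trans a<j j≤N)))

  central-N-unit : Unit (central N 0)
  central-N-unit = central-unit ℕ.≤-refl N 0 refl

  -- A of the overview, since m (1/m²)³ = 1/m⁵.
  alternating-fifth : ℤ
  alternating-fifth = Sum N (λ a → (((λ m → + m) ·q ·q ·q) a) * alt a)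

  -- At j = N every coefficient C(2N, N + a) of the expansion is ±C(2N, N), and this common unit
  -- cancels.
  Z₂-N : Z₂ N ≈ + 2 * alternating-fifth
  Z₂-N = cancel central-N-unit (begin
    central N 0 * Z₂ N
      ≈⟨ central-Z₂ N ℕ.≤-refl ⟨
    weighted ((λ a → + 2 * + a) ·q ·q ·q) N
      ≈⟨ Sum-≈ N (λ a a<N → *ˡ (((λ a → + 2 * + a) ·q ·q ·q) (suc a)) (central-N (suc a) a<N)) ⟩
    Sum N (λ a → ((λ a → + 2 * + a) ·q ·q ·q) a * (alt a * central N 0))
      ≡⟨ Sum-cong N (λ a _ → lemma (+ suc a) (q (suc a)) (alt (suc a)) (central N 0)) ⟩
    Sum N (λ a → central N 0 * + 2 * (((λ m → + m) ·q ·q ·q) a * alt a))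
      ≡⟨ Sum-*ˡ N (central N 0 * + 2) _ ⟩
    central N 0 * + 2 * alternating-fifth
      ≡⟨ *-assoc (central N 0) (+ 2) alternating-fifth ⟩
    central N 0 * (+ 2 * alternating-fifth) ∎)
    where
    lemma : ∀ a q s c → + 2 * a * q * q * q * (s * c) ≡ c * + 2 * (a * q * q * q * s)
    lemma = solve-∀

-- The telescoping sum and its boundary terms.

module Boundary (n : ℕ) (prime : Prime (5 ℕ.+ (n ℕ.+ n))) where

  open import Data.Integer.Base using (_+_; _-_; _*_; -_)
  open import Data.Integer.Properties hiding (module ≤-Reasoning; ≤-refl)
  open IntegerSums
  open Binomials
  open PrimeField n prime
  open CentralSums n prime
  open import Relation.Binary.Reasoning.Setoid ≈-setoid

  -- The quotient C(2j, j)/C(2j, j + m), whose denominator is a unit for m ≤ j ≤ N. From j - 1 to j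
  -- it is multiplied by 1 - m²/j² when m < j.
  ρ : ℕ → ℕ → ℤ
  ρ j m = central j 0 * ι ((j ℕ.+ j) C (j ℕ.+ m))

  unit-≤ : ∀ {j m} → j ℕ.≤ N → m ℕ.≤ j → Unit (central j m)
  unit-≤ {j} {m} j≤N m≤j = central-unit j≤N (j ℕ.∸ m) m (ℕ.m+[n∸m]≡n m≤j)

  central-ρ : ∀ {j m} → j ℕ.≤ N → m ℕ.≤ j → central j m * ρ j m ≈ central j 0
  central-ρ {j} {m} j≤N m≤j = begin
    central j m * ρ j m ≡⟨ lemma (central j m) (central j 0) (ι ((j ℕ.+ j) C (j ℕ.+ m))) ⟩
    central j 0 * (central j m * ι ((j ℕ.+ j) C (j ℕ.+ m))) ≈⟨ *ˡ (central j 0) (*-ι (unit-≤ j≤N m≤j)) ⟩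
    central j 0 * 1ℤ ≡⟨ *-identityʳ (central j 0) ⟩
    central j 0                                             ∎
    where
    lemma : ∀ c d v → c * (d * v) ≡ d * (c * v)
    lemma = solve-∀

  ρ-self : ∀ {j} → j ℕ.≤ N → ρ j j ≈ central j 0
  ρ-self {j} j≤N = ≈-trans (≡⇒≈ (trans (sym (*-identityˡ (ρ j j))) (cong (_* ρ j j) (sym (central-self j)))))
    (central-ρ j≤N ℕ.≤-refl)

  ρ-zero : ∀ {j} → j ℕ.≤ N → ρ j 0 ≈ 1ℤ
  ρ-zero {j} j≤N = cancel (unit-≤ j≤N z≤n) (≈-trans (central-ρ j≤N z≤n) (≡⇒≈ (sym (*-identityʳ (central j 0)))))

  alt-square : ∀ m → alt m * alt m ≡ 1ℤ
  alt-square zero    = refl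
  alt-square (suc m) = trans (lemma (alt m)) (alt-square m)
    where
    lemma : ∀ s → - s * - s ≡ s * s
    lemma = solve-∀

  ρ-N : ∀ {m} → m ℕ.≤ N → ρ N m ≈ alt m
  ρ-N {m} m≤N = cancel (unit-≤ ℕ.≤-refl m≤N) (begin
    central N m * ρ N m ≈⟨ central-ρ ℕ.≤-refl m≤N ⟩
    central N 0 ≡⟨ trans (sym (*-identityˡ _)) (cong (_* central N 0) (sym (alt-square m))) ⟩
    alt m * alt m * central N 0 ≡⟨ lemma (alt m) (central N 0) ⟩
    alt m * central N 0 * alt m ≈⟨ *ʳ (alt m) (central-N m m≤N) ⟨
    central N m * alt m            ∎)
    where
    lemma : ∀ s c → s * s * c ≡ s * c * s
    lemma = solve-∀

  -- `central-step` is applied to the numerator with a = 0 and to the denominator with a = m; the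
  -- common factor 2j(2j - 1) drops out and leaves j² against j² - m².
  ρ-step : ∀ {i m} → i ℕ.< N → m ℕ.≤ i → + suc i * + suc i * ρ (suc i) m ≈ (+ suc i * + suc i - + m * + m) * ρ i m
  ρ-step {i} {m} i<N m≤i = cancel (unit-* c′-unit c-unit) (begin
    c′ * c * (j * j * ρ (suc i) m) ≡⟨ lemma₁ c′ c j (ρ (suc i) m) ⟩
    c′ * (j * j * (c * ρ (suc i) m)) ≈⟨ *ˡ c′ (*ˡ (j * j) (central-ρ i<N (ℕ.m≤n⇒m≤1+n m≤i))) ⟩
    c′ * (j * j * central (suc i) 0) ≡⟨ cong (c′ *_) (trans (lemma₂ j (central (suc i) 0)) (central-step i 0)) ⟩
    c′ * (K * central i 0) ≈⟨ *ˡ c′ (*ˡ K (≈-sym (central-ρ (ℕ.<⇒≤ i<N) m≤i))) ⟩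
    c′ * (K * (c′ * ρ i m)) ≡⟨ lemma₃ c′ K (ρ i m) ⟩
    c′ * ((K * c′) * ρ i m) ≡⟨ cong (λ x → c′ * (x * ρ i m)) (central-step i m) ⟨
    c′ * ((j * j - + m * + m) * c * ρ i m) ≡⟨ lemma₄ c′ c (j * j - + m * + m) (ρ i m) ⟩
    c′ * c * ((j * j - + m * + m) * ρ i m) ∎)
    where
    j = + suc i
    K = + suc (suc (i ℕ.+ i)) * + suc (i ℕ.+ i)
    c = central (suc i) m
    c′ = central i m
    c-unit = unit-≤ i<N (ℕ.m≤n⇒m≤1+n m≤i)
    c′-unit = unit-≤ (ℕ.<⇒≤ i<N) m≤i
    lemma₁ : ∀ a c j r → a * c * (j * j * r) ≡ a * (j * j * (c * r))
    lemma₁ = solve-∀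
    lemma₂ : ∀ j c → j * j * c ≡ (j * j - 0ℤ) * c
    lemma₂ = solve-∀
    lemma₃ : ∀ a k r → a * (k * (a * r)) ≡ a * (k * a * r)
    lemma₃ = solve-∀
    lemma₄ : ∀ a c d r → a * (d * c * r) ≡ a * c * (d * r)
    lemma₄ = solve-∀

  ρ-next : ∀ {j m} → j ℕ.≤ N → m ℕ.< j → (+ j + + m + 1ℤ) * ρ j m ≈ (+ j - + m) * ρ j (suc m)
  ρ-next {j} {m} j≤N m<j = cancel (unit-* c-unit c′-unit) (begin
    c * c′ * (u * ρ j m) ≡⟨ lemma₁ c c′ u (ρ j m) ⟩
    u * c′ * (c * ρ j m) ≈⟨ *ˡ (u * c′) (central-ρ j≤N (ℕ.<⇒≤ m<j)) ⟩
    u * c′ * central j 0 ≡⟨ cong (_* central j 0) (central-next j m) ⟩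
    d * c * central j 0 ≈⟨ *ˡ (d * c) (central-ρ j≤N m<j) ⟨
    d * c * (c′ * ρ j (suc m)) ≡⟨ lemma₂ c c′ d (ρ j (suc m)) ⟩
    c * c′ * (d * ρ j (suc m))   ∎)
    where
    u = + j + + m + 1ℤ
    d = + j - + m
    c = central j m
    c′ = central j (suc m)
    c-unit = unit-≤ j≤N (ℕ.<⇒≤ m<j)
    c′-unit = unit-≤ j≤N m<j
    lemma₁ : ∀ c c′ u r → c * c′ * (u * r) ≡ u * c′ * (c * r)
    lemma₁ = solve-∀
    lemma₂ : ∀ c c′ d r → d * c * (c′ * r) ≡ c * c′ * (d * r)
    lemma₂ = solve-∀

  boundary : (ℕ → ℤ) → ℕ → ℤ
  boundary w j = Sum j (λ m → w m * ρ j m)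

  -- 2 m ρ(j, m) = F m − F (m − 1) for F m = (j + m + 1) ρ(j, m).
  boundary-linear : ∀ {i} → i ℕ.< N → + 4 * boundary pos i ≈ + suc i * central (suc i) 0 - + 2 * + suc i
  boundary-linear {i} i<N = begin
    + 4 * boundary pos i
      ≡⟨ trans (lemma₁ (boundary pos i)) (cong (λ x → - + 2 * x) (sym (Sum-*ˡ i (- + 2) (λ m → + m * ρ i m)))) ⟩
    - + 2 * Sum i (λ m → - + 2 * (+ m * ρ i m))
      ≈⟨ *ˡ (- + 2) (Sum-≈ i term) ⟩
    - + 2 * Sum i (λ m → F (ℕ.pred m) - F m)
      ≡⟨ cong (- + 2 *_) (Sum-telescope i F) ⟩
    - + 2 * (F 0 - F i)
      ≈⟨ *ˡ (- + 2) (sub-cong (*ˡ (+ i + 0ℤ + 1ℤ) (ρ-zero i≤N)) (*ˡ (+ i + + i + 1ℤ) (ρ-self i≤N))) ⟩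
    - + 2 * ((+ i + 0ℤ + 1ℤ) * 1ℤ - (+ i + + i + 1ℤ) * central i 0)
      ≡⟨ lemma₃ (+ i) (central i 0) ⟩
    + 2 * (+ i + + i + 1ℤ) * central i 0 - + 2 * (+ i + 1ℤ)
      ≡⟨ cong₂ (λ x y → x - + 2 * y) eq (sym (pos-suc i)) ⟩
    + suc i * central (suc i) 0 - + 2 * + suc i ∎
    where
    i≤N = ℕ.<⇒≤ i<N
    F : ℕ → ℤ
    F m = (+ i + + m + 1ℤ) * ρ i m
    lemma₁ : ∀ b → + 4 * b ≡ - + 2 * (- + 2 * b)
    lemma₁ = solve-∀
    lemma₂ : ∀ i m r → - + 2 * ((m + 1ℤ) * r) ≡ (i - m) * r - (i + (m + 1ℤ) + 1ℤ) * r
    lemma₂ = solve-∀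
    lemma₃ : ∀ i c → - + 2 * ((i + 0ℤ + 1ℤ) * 1ℤ - (i + i + 1ℤ) * c) ≡ + 2 * (i + i + 1ℤ) * c - + 2 * (i + 1ℤ)
    lemma₃ = solve-∀
    lemma₄ : ∀ j d c → j * (+ 2 * d * c) ≡ (+ 2 * j) * d * c
    lemma₄ = solve-∀
    lemma₅ : ∀ j c → (j * j - 0ℤ) * c ≡ j * (j * c)
    lemma₅ = solve-∀
    lemma₆ : ∀ i → + 2 * (i + 1ℤ) ≡ (i + i + 1ℤ) + 1ℤ
    lemma₆ = solve-∀
    odd-eq : + i + + i + 1ℤ ≡ + suc (i ℕ.+ i)
    odd-eq = trans (cong (_+ 1ℤ) (sym (pos-+ i i))) (sym (pos-suc (i ℕ.+ i)))
    eq : + 2 * (+ i + + i + 1ℤ) * central i 0 ≡ + suc i * central (suc i) 0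
    eq = *-cancelˡ-≡ (+ suc i) _ _ (trans (lemma₄ (+ suc i) (+ i + + i + 1ℤ) (central i 0))
      (trans (cong₂ (λ x y → x * y * central i 0)
        (trans (cong (+ 2 *_) (pos-suc i)) (trans (lemma₆ (+ i)) (trans (cong (_+ 1ℤ) odd-eq) (sym (pos-suc (suc (i ℕ.+ i)))))))
        odd-eq)
      (trans (sym (central-step i 0)) (lemma₅ (+ suc i) (central (suc i) 0)))))
    term : ∀ m → m ℕ.< i → - + 2 * (+ suc m * ρ i (suc m)) ≈ F m - F (suc m)
    term m m<i = begin
      - + 2 * (+ suc m * ρ i (suc m))
        ≡⟨ cong (λ s → - + 2 * (s * ρ i (suc m))) (pos-suc m) ⟩
      - + 2 * ((+ m + 1ℤ) * ρ i (suc m))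
        ≡⟨ lemma₂ (+ i) (+ m) (ρ i (suc m)) ⟩
      (+ i - + m) * ρ i (suc m) - (+ i + (+ m + 1ℤ) + 1ℤ) * ρ i (suc m)
        ≈⟨ sub-cong (≈-sym (ρ-next i≤N m<i)) (≡⇒≈ (cong (λ s → (+ i + s + 1ℤ) * ρ i (suc m)) (sym (pos-suc m)))) ⟩
      F m - F (suc m) ∎

  -- With j = i + 1, dividing `ρ-step` by j² m² gives ρ(j, m)/m² ≡ ρ(i, m)/m² - ρ(i, m)/j² for m ≤
  -- i, and the new term m = j has ρ(j, j) ≡ C(2j, j).
  boundary-step : ∀ w {i} → i ℕ.< N →
    boundary (w ·q) (suc i) ≈ boundary (w ·q) i - q (suc i) * boundary w i + w (suc i) * q (suc i) * central (suc i) 0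
  boundary-step w {i} i<N = +-cong (begin
    Sum i (λ m → w m * q m * ρ (suc i) m)
      ≈⟨ Sum-≈ i term ⟩
    Sum i (λ m → w m * q m * ρ i m - q (suc i) * (w m * ρ i m))
      ≡⟨ trans (Sum-sub i _ _) (cong (_-_ (boundary (w ·q) i)) (Sum-*ˡ i (q (suc i)) _)) ⟩
    boundary (w ·q) i - q (suc i) * boundary w i ∎)
    (*ˡ (w (suc i) * q (suc i)) (ρ-self i<N))
    where
    j = + suc i
    lemma₁ : ∀ j w q r → j * j * (w * q * r) ≡ w * q * (j * j * r)
    lemma₁ = solve-∀
    lemma₂ : ∀ j m w q r → w * q * ((j * j - m * m) * r) ≡ j * j * (w * q * r) - 1ℤ * (m * m * q) * (w * r)
    lemma₂ = solve-∀
    lemma₃ : ∀ j w q q′ r → j * j * (w * q * r) - j * j * q′ * 1ℤ * (w * r) ≡ j * j * (w * q * r - q′ * (w * r))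
    lemma₃ = solve-∀
    term : ∀ m′ → m′ ℕ.< i → w (suc m′) * q (suc m′) * ρ (suc i) (suc m′)
           ≈ w (suc m′) * q (suc m′) * ρ i (suc m′) - q (suc i) * (w (suc m′) * ρ i (suc m′))
    term m′ m<i = cancel (unit-* (unit-≤N i<N) (unit-≤N i<N)) (begin
      j * j * (w m * q m * ρ (suc i) m)
        ≡⟨ lemma₁ j (w m) (q m) (ρ (suc i) m) ⟩
      w m * q m * (j * j * ρ (suc i) m)
        ≈⟨ *ˡ (w m * q m) (ρ-step i<N m<i) ⟩
      w m * q m * ((j * j - + m * + m) * ρ i m)
        ≡⟨ lemma₂ j (+ m) (w m) (q m) (ρ i m) ⟩
      j * j * (w m * q m * ρ i m) - 1ℤ * (+ m * + m * q m) * (w m * ρ i m)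
        ≈⟨ sub-cong (≈-refl {j * j * (w m * q m * ρ i m)}) (*ʳ (w m * ρ i m) (*-cong (≈-sym (square-q (unit-≤N i<N))) (square-q (unit-≤N (ℕ.<-trans m<i i<N))))) ⟩
      j * j * (w m * q m * ρ i m) - j * j * q (suc i) * 1ℤ * (w m * ρ i m)
        ≡⟨ lemma₃ j (w m) (q m) (q (suc i)) (ρ i m) ⟩
      j * j * (w m * q m * ρ i m - q (suc i) * (w m * ρ i m)) ∎)
      where m = suc m′

  -- The complete symmetric sum of degree two of the 1/m², m ≤ l, with 1/l² taken twice. Multiplied
  -- by C(2l, l)/l and summed over l it gives T + E.
  full : ℕ → ℤ
  full l = h₂ l + h₁ l * q l + q l * q l

  -- Let H_j be the product of 1/(1 - x²/m²) over m ≤ j, and B_j = b₁ + b₂ x² + b₃ x⁴ + ⋯ with the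
  -- boundary sums for the weights 1/m, 1/m³, 1/m⁵. For i = j - 1 and b₀ = Σ m ρ(i, m),
  -- `boundary-step` reads B_j = (1 - x²/j²) B_i - b₀/j² + (C(2j, j)/j)/(1 - x²/j²). Hence H_j B_j -
  -- H_i B_i = -H_j b₀/j² + (C(2j, j)/j) H_j/(1 - x²/j²). The last term has `full j` in its
  -- coefficient of x⁴, and `boundary-linear` evaluates 4b₀/j² as (C(2j, j) - 2)/j.
  telescoped : ∀ j → j ℕ.≤ N →
    Sum j (λ l → + 4 * (central l 0 * ι l) * full l)
    ≈ + 4 * (h₂ j * boundary (pos ·q) j + h₁ j * boundary (pos ·q ·q) j + boundary (pos ·q ·q ·q) j)
      + Sum j (λ l → h₂ l * (central l 0 * ι l - + 2 * ι l))
  telescoped zero    _   = ≈-refl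
  telescoped (suc i) i<N = begin
    Sum i (λ l → + 4 * (central l 0 * ι l) * full l) + + 4 * (c * v) * full (suc i)
      ≈⟨ +ʳ (+ 4 * (c * v) * full (suc i)) (telescoped i (ℕ.<⇒≤ i<N)) ⟩
    + 4 * (h₂ i * b₁ + h₁ i * b₂ + b₃) + S + + 4 * (c * v) * full (suc i)
      ≡⟨ lemma₁ (h₁ i) (h₂ i) b₁ b₂ b₃ S c v Q ⟩
    + 4 * (h₂ i * b₁ + h₁ i * b₂ + b₃) + + 4 * (v * c) * G + S
      ≈⟨ +ʳ S (+ˡ (+ 4 * (h₂ i * b₁ + h₁ i * b₂ + b₃)) (*ʳ G (*ˡ (+ 4) (*ʳ c (≈-sym (ι² J-unit)))))) ⟩
    + 4 * (h₂ i * b₁ + h₁ i * b₂ + b₃) + + 4 * (j * Q * c) * G + S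
      ≡⟨ lemma₂ (h₁ i) (h₂ i) b₀ b₁ b₂ b₃ S (j * Q * c) Q ⟩
    + 4 * ((h₂ i + (h₁ i + 1ℤ * Q) * Q) * (b₁ - Q * b₀ + j * Q * c) + (h₁ i + 1ℤ * Q) * (b₂ - Q * b₁ + j * Q * c * Q)
       + (b₃ - Q * b₂ + j * Q * c * Q * Q)) + (S + (h₂ i + (h₁ i + 1ℤ * Q) * Q) * (Q * (+ 4 * b₀)))
      ≈⟨ +-cong (*ˡ (+ 4) (+-cong (+-cong
           (*ˡ (h₂ (suc i)) (≈-sym (boundary-step pos i<N)))
           (*ˡ (h₁ (suc i)) (≈-trans (≡⇒≈ (cong (_+_ (b₂ - Q * b₁)) (lemma₃ j Q c))) (≈-sym (boundary-step (pos ·q) i<N)))))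
           (≈-trans (≡⇒≈ (cong (_+_ (b₃ - Q * b₂)) (lemma₄ j Q c))) (≈-sym (boundary-step (pos ·q ·q) i<N)))))
         (+ˡ S (*ˡ (h₂ (suc i)) last)) ⟩
    + 4 * (h₂ (suc i) * boundary (pos ·q) (suc i) + h₁ (suc i) * boundary (pos ·q ·q) (suc i) + boundary (pos ·q ·q ·q) (suc i))
      + (S + h₂ (suc i) * (c * v - + 2 * v)) ∎
    where
    j = + suc i
    v = ι (suc i)
    Q = q (suc i)
    c = central (suc i) 0
    J-unit = unit-≤N i<N
    b₀ = boundary pos i
    b₁ = boundary (pos ·q) i
    b₂ = boundary (pos ·q ·q) i
    b₃ = boundary (pos ·q ·q ·q) i
    S = Sum i (λ l → h₂ l * (central l 0 * ι l - + 2 * ι l))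
    -- `full (suc i)` with `h₁ (suc i)` and `h₂ (suc i)` unfolded once, so that both sides of the
    -- ring identities are polynomials in the values at i.
    G = h₂ i + (h₁ i + 1ℤ * Q) * Q + (h₁ i + 1ℤ * Q) * Q + Q * Q
    lemma₁ : ∀ h₁ h₂ b₁ b₂ b₃ S c v Q →
      + 4 * (h₂ * b₁ + h₁ * b₂ + b₃) + S + + 4 * (c * v) * (h₂ + (h₁ + 1ℤ * Q) * Q + (h₁ + 1ℤ * Q) * Q + Q * Q)
      ≡ + 4 * (h₂ * b₁ + h₁ * b₂ + b₃) + + 4 * (v * c) * (h₂ + (h₁ + 1ℤ * Q) * Q + (h₁ + 1ℤ * Q) * Q + Q * Q) + S
    lemma₁ = solve-∀
    lemma₂ : ∀ h₁ h₂ b₀ b₁ b₂ b₃ S x Q →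
      + 4 * (h₂ * b₁ + h₁ * b₂ + b₃) + + 4 * x * (h₂ + (h₁ + 1ℤ * Q) * Q + (h₁ + 1ℤ * Q) * Q + Q * Q) + S
      ≡ + 4 * ((h₂ + (h₁ + 1ℤ * Q) * Q) * (b₁ - Q * b₀ + x) + (h₁ + 1ℤ * Q) * (b₂ - Q * b₁ + x * Q)
       + (b₃ - Q * b₂ + x * Q * Q)) + (S + (h₂ + (h₁ + 1ℤ * Q) * Q) * (Q * (+ 4 * b₀)))
    lemma₂ = solve-∀
    lemma₃ : ∀ j q c → j * q * c * q ≡ j * q * q * c
    lemma₃ = solve-∀
    lemma₄ : ∀ j q c → j * q * c * q * q ≡ j * q * q * q * c
    lemma₄ = solve-∀
    lemma₅ : ∀ j q c → q * (j * c - + 2 * j) ≡ j * q * (c - + 2)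
    lemma₅ = solve-∀
    lemma₆ : ∀ v c → v * (c - + 2) ≡ c * v - + 2 * v
    lemma₆ = solve-∀
    last : Q * (+ 4 * b₀) ≈ c * v - + 2 * v
    last = begin
      Q * (+ 4 * b₀) ≈⟨ *ˡ Q (boundary-linear i<N) ⟩
      Q * (j * c - + 2 * j) ≡⟨ lemma₅ j Q c ⟩
      j * Q * (c - + 2) ≈⟨ *ʳ (c - + 2) (ι² J-unit) ⟩
      v * (c - + 2) ≡⟨ lemma₆ v c ⟩
      c * v - + 2 * v         ∎

  boundary-N : ∀ w → boundary w N ≈ Sum N (λ m → w m * alt m)
  boundary-N w = Sum-≈ N (λ m m<N → *ˡ (w (suc m)) (ρ-N m<N))

-- The p-integral rationals and their residues.

module Residues (n : ℕ) (prime : Prime (5 ℕ.+ (n ℕ.+ n))) where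

  open import Data.Fin.Base using (Fin; zero; suc; toℕ)
  open import Data.Integer.Divisibility.Signed using (divides; ∣⇒∣ᵤ)
  open import Data.Nat.Coprimality using (Coprime)
  open import Data.Nat.Divisibility using (_∣_; ∣-trans; ∣-refl)
  open import Data.Rational using (ℚ; 0ℚ; 1ℚ; _/_; _+_; _-_; _*_; -_; ↥_; ↧_; ↧ₙ_; toℚᵘ)
  open import Data.Rational.Properties
  import Data.Rational.Unnormalised.Base as ℚᵘ
  import Data.Rational.Unnormalised.Properties as ℚᵘ
  open import Defs
  open IntegerSums
  open PrimeField n prime
  open import Algebra.Properties.CommutativeMonoid.Sum +-0-commutativeMonoid using (sum)

  abstract
    ⟦_⟧ : ℤ → ℚ
    ⟦ z ⟧ = z / 1

    ⟦⟧-def : ∀ z → ⟦ z ⟧ ≡ z / 1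
    ⟦⟧-def z = refl

  private
    toℚᵘ-/ : ∀ i m .{{_ : NonZero m}} → toℚᵘ (i / m) ℚᵘ.≃ (i ℚᵘ./ m)
    toℚᵘ-/ i (suc m) = toℚᵘ-fromℚᵘ (i ℚᵘ./ suc m)

    toℚᵘ-⟦⟧ : ∀ z → toℚᵘ ⟦ z ⟧ ℚᵘ.≃ (z ℚᵘ./ 1)
    toℚᵘ-⟦⟧ z = subst (λ x → toℚᵘ x ℚᵘ.≃ (z ℚᵘ./ 1)) (sym (⟦⟧-def z)) (toℚᵘ-/ z 1)

  ⟦⟧-+ : ∀ a b → ⟦ a ℤ.+ b ⟧ ≡ ⟦ a ⟧ + ⟦ b ⟧
  ⟦⟧-+ a b = toℚᵘ-injective (begin
    toℚᵘ ⟦ a ℤ.+ b ⟧ ≈⟨ toℚᵘ-⟦⟧ (a ℤ.+ b) ⟩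
    (a ℤ.+ b) ℚᵘ./ 1 ≈⟨ ℚᵘ.*≡* (cong (ℤ._* 1ℤ) (sym (cong₂ ℤ._+_ (ℤ.*-identityʳ a) (ℤ.*-identityʳ b)))) ⟩
    (a ℚᵘ./ 1) ℚᵘ.+ (b ℚᵘ./ 1) ≈⟨ ℚᵘ.+-cong (toℚᵘ-⟦⟧ a) (toℚᵘ-⟦⟧ b) ⟨
    toℚᵘ ⟦ a ⟧ ℚᵘ.+ toℚᵘ ⟦ b ⟧ ≈⟨ toℚᵘ-homo-+ ⟦ a ⟧ ⟦ b ⟧ ⟨
    toℚᵘ (⟦ a ⟧ + ⟦ b ⟧)          ∎)
    where open ℚᵘ.≃-Reasoning

  ⟦⟧-* : ∀ a b → ⟦ a ℤ.* b ⟧ ≡ ⟦ a ⟧ * ⟦ b ⟧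
  ⟦⟧-* a b = toℚᵘ-injective (begin
    toℚᵘ ⟦ a ℤ.* b ⟧ ≈⟨ toℚᵘ-⟦⟧ (a ℤ.* b) ⟩
    (a ℚᵘ./ 1) ℚᵘ.* (b ℚᵘ./ 1) ≈⟨ ℚᵘ.*-cong (toℚᵘ-⟦⟧ a) (toℚᵘ-⟦⟧ b) ⟨
    toℚᵘ ⟦ a ⟧ ℚᵘ.* toℚᵘ ⟦ b ⟧ ≈⟨ toℚᵘ-homo-* ⟦ a ⟧ ⟦ b ⟧ ⟨
    toℚᵘ (⟦ a ⟧ * ⟦ b ⟧)          ∎)
    where open ℚᵘ.≃-Reasoning

  ⟦⟧-neg : ∀ a → ⟦ ℤ.- a ⟧ ≡ - ⟦ a ⟧
  ⟦⟧-neg a = sym (neg-unique (trans (sym (⟦⟧-+ a (ℤ.- a))) (trans (cong ⟦_⟧ (ℤ.+-inverseʳ a)) (⟦⟧-def 0ℤ))))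
    where
    neg-unique : ∀ {x y} → x + y ≡ 0ℚ → - x ≡ y
    neg-unique {x} {y} eq = trans (sym (+-identityʳ (- x))) (trans (cong (_+_ (- x)) (sym eq))
      (trans (sym (+-assoc (- x) x y)) (trans (cong (_+ y) (+-inverseˡ x)) (+-identityˡ y))))

  /-* : ∀ i m .{{_ : NonZero m}} → ⟦ + m ⟧ * (i / m) ≡ ⟦ i ⟧
  /-* i m@(suc _) = toℚᵘ-injective (begin
    toℚᵘ (⟦ + m ⟧ * (i / m)) ≈⟨ toℚᵘ-homo-* ⟦ + m ⟧ (i / m) ⟩
    toℚᵘ ⟦ + m ⟧ ℚᵘ.* toℚᵘ (i / m) ≈⟨ ℚᵘ.*-cong (toℚᵘ-⟦⟧ (+ m)) (toℚᵘ-/ i m) ⟩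
    (+ m ℚᵘ./ 1) ℚᵘ.* (i ℚᵘ./ m) ≈⟨ ℚᵘ.*≡* (trans (cong (ℤ._* 1ℤ) (ℤ.*-comm (+ m) i))
                                               (trans (ℤ.*-assoc i (+ m) 1ℤ) (cong (i ℤ.*_) (ℤ.*-comm (+ m) 1ℤ)))) ⟩
    i ℚᵘ./ 1 ≈⟨ toℚᵘ-⟦⟧ i ⟨
    toℚᵘ ⟦ i ⟧                            ∎)
    where open ℚᵘ.≃-Reasoning

  ⟦⟧-injective : ∀ {a b} → ⟦ a ⟧ ≡ ⟦ b ⟧ → a ≡ b
  ⟦⟧-injective {a} {b} eq with ℚᵘ.≃-trans (ℚᵘ.≃-sym (toℚᵘ-⟦⟧ a)) (ℚᵘ.≃-trans (ℚᵘ.≃-reflexive (cong toℚᵘ eq)) (toℚᵘ-⟦⟧ b))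
  ... | ℚᵘ.*≡* eq′ = trans (sym (ℤ.*-identityʳ a)) (trans eq′ (ℤ.*-identityʳ b))

  *-cancelˡ : ∀ m .{{_ : NonZero m}} {x y} → ⟦ + m ⟧ * x ≡ ⟦ + m ⟧ * y → x ≡ y
  *-cancelˡ m {x} {y} eq = trans (sym (undo x)) (trans (cong ((+ 1 / m) *_) eq) (undo y))
    where
    undo : ∀ x → (+ 1 / m) * (⟦ + m ⟧ * x) ≡ x
    undo x = trans (sym (*-assoc (+ 1 / m) ⟦ + m ⟧ x)) (trans (cong (_* x) (trans (*-comm (+ 1 / m) ⟦ + m ⟧) (trans (/-* (+ 1) m) (⟦⟧-def 1ℤ)))) (*-identityˡ x))

  record Integral (c : ℚ) : Set where
    constructor integral
    field coprime : Coprime (↧ₙ c) p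

  ∤⇒coprime : ∀ {m} → ¬ (p ∣ m) → Coprime m p
  ∤⇒coprime p∤m (d∣m , d∣p) with prime⇒irreducible prime d∣p
  ... | inj₁ d≡1 = d≡1
  ... | inj₂ refl = contradiction d∣m p∤m

  coprime⇒∤ : ∀ {m} → Coprime m p → ¬ (p ∣ m)
  coprime⇒∤ coprime p∣m with coprime (p∣m , ∣-refl)
  ... | ()

  integral-∣ : ∀ {c m} → ↧ₙ c ∣ m → Coprime m p → Integral c
  integral-∣ ↧c∣m coprime = integral λ (d∣↧c , d∣p) → coprime (∣-trans d∣↧c ↧c∣m , d∣p)

  private
    ↧-factor : ∀ c d {m} → ↧ c ℤ.* d ≡ + m → ↧ₙ c ∣ m
    ↧-factor c d {m} eq = ∣⇒∣ᵤ {↧ c} {+ m} (divides d (trans (sym eq) (ℤ.*-comm (↧ c) d)))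

    coprime-* : ∀ {a b} → Coprime a p → Coprime b p → Coprime (a ℕ.* b) p
    coprime-* {a} {b} ca cb = ∤⇒coprime λ p∣ab → [ coprime⇒∤ ca , coprime⇒∤ cb ]′ (euclidsLemma a b prime p∣ab)

  integral-+ : ∀ {a b} → Integral a → Integral b → Integral (a + b)
  integral-+ {a@record{}} {b@record{}} (integral ia) (integral ib) = integral-∣ {a + b} (↧-factor (a + b) _ (↧-+ a b)) (coprime-* ia ib)

  integral-* : ∀ {a b} → Integral a → Integral b → Integral (a * b)
  integral-* {a@record{}} {b@record{}} (integral ia) (integral ib) =
    integral-∣ {a * b} (↧-factor (a * b) _ (trans (↧-* a b) (sym (ℤ.pos-* (↧ₙ a) (↧ₙ b))))) (coprime-* ia ib)

  integral-neg : ∀ {a} → Integral a → Integral (- a)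
  integral-neg {a} (integral ia) = integral (subst (λ d → Coprime d p) (ℤ.+-injective (sym (↧-neg a))) ia)

  integral-/ : ∀ i m .{{_ : NonZero m}} → Unit (+ m) → Integral (i / m)
  integral-/ i m (unit p∤m) = integral-∣ {i / m} (↧-factor (i / m) _ (↧-/ i m)) (∤⇒coprime p∤m)

  integral-⟦⟧ : ∀ z → Integral ⟦ z ⟧
  integral-⟦⟧ z = subst Integral (sym (⟦⟧-def z)) (integral-/ z 1 unit-1)

  infix 4 _∼_

  -- Reduction modulo p as a relation, with z any integer representing x. It respects sums and
  -- products, so rational sums become integer congruences in which division is multiplication by
  -- `ι`.
  record _∼_ (x : ℚ) (z : ℤ) : Set where
    constructor residue
    field
      {quotient} : ℚ
      equality   : x ≡ ⟦ z ⟧ + ⟦ + p ⟧ * quotient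
      isIntegral : Integral quotient

  open +-*-Solver using (solve; con; _:+_; _:*_; _:-_; :-_; _:=_)

  ∼-+ : ∀ {x y a b} → x ∼ a → y ∼ b → x + y ∼ a ℤ.+ b
  ∼-+ {a = a} {b} (residue {c} eq i) (residue {d} eq′ i′) = residue (trans (cong₂ _+_ eq eq′)
    (trans (solve 5 (λ a b p c d → (a :+ p :* c) :+ (b :+ p :* d) := (a :+ b) :+ p :* (c :+ d)) refl ⟦ a ⟧ ⟦ b ⟧ ⟦ + p ⟧ c d)
    (cong (_+ ⟦ + p ⟧ * (c + d)) (sym (⟦⟧-+ a b))))) (integral-+ i i′)

  ∼-* : ∀ {x y a b} → x ∼ a → y ∼ b → x * y ∼ a ℤ.* b
  ∼-* {a = a} {b} (residue {c} eq i) (residue {d} eq′ i′) = residue (trans (cong₂ _*_ eq eq′)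
    (trans (solve 5 (λ a b p c d → (a :+ p :* c) :* (b :+ p :* d) := a :* b :+ p :* (a :* d :+ c :* (b :+ p :* d))) refl ⟦ a ⟧ ⟦ b ⟧ ⟦ + p ⟧ c d)
    (cong (_+ ⟦ + p ⟧ * e) (sym (⟦⟧-* a b)))))
    (integral-+ (integral-* (integral-⟦⟧ a) i′) (integral-* i (integral-+ (integral-⟦⟧ b) (integral-* (integral-⟦⟧ (+ p)) i′))))
    where e = ⟦ a ⟧ * d + c * (⟦ b ⟧ + ⟦ + p ⟧ * d)

  ∼-neg : ∀ {x a} → x ∼ a → - x ∼ ℤ.- a
  ∼-neg {a = a} (residue {c} eq i) = residue (trans (cong -_ eq)
    (trans (solve 3 (λ a p c → :- (a :+ p :* c) := :- a :+ p :* (:- c)) refl ⟦ a ⟧ ⟦ + p ⟧ c)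
    (cong (_+ ⟦ + p ⟧ * - c) (sym (⟦⟧-neg a))))) (integral-neg {c} i)

  ∼-≈ : ∀ {x a b} → x ∼ a → a ≈ b → x ∼ b
  ∼-≈ {b = b} (residue {c} eq i) (congruent t eq′) = residue (trans eq
    (trans (cong (λ a → ⟦ a ⟧ + ⟦ + p ⟧ * c) eq′)
    (trans (cong (_+ ⟦ + p ⟧ * c) (trans (⟦⟧-+ b (+ p ℤ.* t)) (cong (_+_ ⟦ b ⟧) (⟦⟧-* (+ p) t))))
    (solve 4 (λ b p c t → (b :+ p :* t) :+ p :* c := b :+ p :* (t :+ c)) refl ⟦ b ⟧ ⟦ + p ⟧ c ⟦ t ⟧))))
    (integral-+ (integral-⟦⟧ t) i)

  ⟦0⟧ : ⟦ 0ℤ ⟧ ≡ 0ℚ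
  ⟦0⟧ = ⟦⟧-def 0ℤ

  ∼-⟦⟧ : ∀ z → ⟦ z ⟧ ∼ z
  ∼-⟦⟧ z = residue (solve 2 (λ z p → z := z :+ p :* con 0ℚ) refl ⟦ z ⟧ ⟦ + p ⟧) (subst Integral ⟦0⟧ (integral-⟦⟧ 0ℤ))

  ∼⇒integral : ∀ {x z} → x ∼ z → Integral x
  ∼⇒integral {z = z} (residue {c} eq i) = subst Integral (sym eq) (integral-+ (integral-⟦⟧ z) (integral-* (integral-⟦⟧ (+ p)) i))

  -- The two expressions for x give a - b = p e with e integral. Multiplying by the denominator of e
  -- yields an integer congruence, from which this denominator cancels because it is prime to p.
  ∼-unique : ∀ {x a b} → x ∼ a → x ∼ b → a ≈ b
  ∼-unique {a = a} {b} (residue {c} eq i) (residue {d} eq′ i′) = cancel {+ ↧ₙ e} (unit (coprime⇒∤ (Integral.coprime e-integral)))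
      (move (congruent (↥ e) (trans (⟦⟧-injective integer-eq) (sym (ℤ.+-identityˡ _)))))
    where
    e = d + - c
    e-integral = integral-+ i′ (integral-neg {c} i)
    m = + ↧ₙ e
    m*e : ⟦ m ⟧ * e ≡ ⟦ ↥ e ⟧
    m*e = trans (cong (⟦ m ⟧ *_) (sym (↥p/↧p≡p e))) (/-* (↥ e) (↧ₙ e))
    difference : ⟦ a ⟧ + - ⟦ b ⟧ ≡ ⟦ + p ⟧ * e
    difference = trans (solve 5 (λ a b p c d → a :+ :- b := (a :+ p :* c) :+ :- b :+ :- (p :* c)) refl ⟦ a ⟧ ⟦ b ⟧ ⟦ + p ⟧ c d)
      (trans (cong (λ x → x + - ⟦ b ⟧ + - (⟦ + p ⟧ * c)) (trans (sym eq) eq′))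
      (solve 4 (λ b p c d → (b :+ p :* d) :+ :- b :+ :- (p :* c) := p :* (d :+ :- c)) refl ⟦ b ⟧ ⟦ + p ⟧ c d))
    integer-eq : ⟦ m ℤ.* a ℤ.- m ℤ.* b ⟧ ≡ ⟦ + p ℤ.* ↥ e ⟧
    integer-eq = trans (⟦⟧-+ (m ℤ.* a) (ℤ.- (m ℤ.* b)))
      (trans (cong₂ _+_ (⟦⟧-* m a) (trans (⟦⟧-neg (m ℤ.* b)) (cong -_ (⟦⟧-* m b))))
      (trans (solve 3 (λ m a b → m :* a :+ :- (m :* b) := m :* (a :+ :- b)) refl ⟦ m ⟧ ⟦ a ⟧ ⟦ b ⟧)
      (trans (cong (⟦ m ⟧ *_) difference)
      (trans (solve 3 (λ m p e → m :* (p :* e) := p :* (m :* e)) refl ⟦ m ⟧ ⟦ + p ⟧ e)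
      (trans (cong (⟦ + p ⟧ *_) m*e) (sym (⟦⟧-* (+ p) (↥ e))))))))

  -- If m ι(m) = 1 + p t, the quotient is -i t/m. The hypothesis is an equation m x = i rather than
  -- a fraction, so x may be given with p in numerator and denominator, as in the second sum.
  ∼-inverse : ∀ m .{{_ : NonZero m}} → Unit (+ m) → ∀ i {x} → ⟦ + m ⟧ * x ≡ ⟦ i ⟧ → x ∼ i ℤ.* ι m
  ∼-inverse m u i {x} eq = from (*-ι u)
    where
    r : ℚ
    r = + 1 / m
    m*r : ⟦ + m ⟧ * r ≡ 1ℚ
    m*r = trans (/-* (+ 1) m) (⟦⟧-def 1ℤ)
    lemma₁ : ∀ m i v → m ℤ.* (i ℤ.* v) ≡ i ℤ.* (m ℤ.* v)
    lemma₁ = solve-∀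
    lemma₂ : ∀ i p t → i ℤ.* (1ℤ ℤ.+ p ℤ.* t) ≡ i ℤ.+ p ℤ.* (i ℤ.* t)
    lemma₂ = solve-∀
    lemma₃ : ∀ m z p y r → m * (z + p * - (y * r)) ≡ m * z + p * - (y * (m * r))
    lemma₃ = solve 5 (λ m z p y r → m :* (z :+ p :* (:- (y :* r))) := m :* z :+ p :* (:- (y :* (m :* r)))) refl
    lemma₄ : ∀ i p y → (i + p * y) + p * - (y * 1ℚ) ≡ i
    lemma₄ = solve 3 (λ i p y → (i :+ p :* y) :+ p :* (:- (y :* con 1ℚ)) := i) refl
    from : + m ℤ.* ι m ≈ 1ℤ → x ∼ i ℤ.* ι m
    from (congruent t mι≡1+pt) = residue (*-cancelˡ m (trans eq (sym
      (trans (lemma₃ ⟦ + m ⟧ ⟦ i ℤ.* ι m ⟧ ⟦ + p ⟧ ⟦ i ℤ.* t ⟧ r)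
      (trans (cong₂ (λ u v → u + ⟦ + p ⟧ * - (⟦ i ℤ.* t ⟧ * v)) product m*r)
      (lemma₄ ⟦ i ⟧ ⟦ + p ⟧ ⟦ i ℤ.* t ⟧))))))
      (integral-neg (integral-* (integral-⟦⟧ (i ℤ.* t)) (integral-/ (+ 1) m u)))
      where
      product : ⟦ + m ⟧ * ⟦ i ℤ.* ι m ⟧ ≡ ⟦ i ⟧ + ⟦ + p ⟧ * ⟦ i ℤ.* t ⟧
      product = trans (sym (⟦⟧-* (+ m) (i ℤ.* ι m))) (trans (cong ⟦_⟧ (trans (lemma₁ (+ m) i (ι m))
        (trans (cong (i ℤ.*_) mι≡1+pt) (lemma₂ i (+ p) t))))
        (trans (⟦⟧-+ i _) (cong (_+_ ⟦ i ⟧) (⟦⟧-* (+ p) (i ℤ.* t)))))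

  ∼-/ : ∀ i m .{{_ : NonZero m}} → Unit (+ m) → i / m ∼ i ℤ.* ι m
  ∼-/ i m u = ∼-inverse m u i (/-* i m)

  res : ℚ → ℤ
  res x = ↥ x ℤ.* ι (↧ₙ x)

  ∼-res : ∀ {x} → Integral x → x ∼ res x
  ∼-res {x} (integral i) = subst (_∼ res x) (↥p/↧p≡p x) (∼-/ (↥ x) (↧ₙ x) (unit (coprime⇒∤ i)))

  ∼-sum : ∀ m {f : Fin m → ℚ} {g : ℕ → ℤ} → (∀ i → f i ∼ g (suc (toℕ i))) → sum f ∼ Sum m g
  ∼-sum zero    eq = subst (_∼ 0ℤ) ⟦0⟧ (∼-⟦⟧ 0ℤ)
  ∼-sum (suc m) {g = g} eq = subst (_ ∼_) (sym (Sum-head m g)) (∼-+ (eq zero) (∼-sum m (λ i → eq (suc i))))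

  private
    Coprime-denominator : ∀ {c} → Integral c → Coprime (↧ₙ c) p
    Coprime-denominator (integral coprime) = coprime

    difference : ∀ {x y b c d} → x ≡ ⟦ b ⟧ + ⟦ + p ⟧ * c → y ≡ ⟦ b ⟧ + ⟦ + p ⟧ * d → x - y ≡ (+ p / 1) * (c + - d)
    difference {x} {y} {b} {c} {d} eq eq′ = trans (cong₂ _-_ eq eq′)
      (trans (solve 4 (λ b p c d → (b :+ p :* c) :- (b :+ p :* d) := p :* (c :+ :- d)) refl ⟦ b ⟧ ⟦ + p ⟧ c d)
      (cong (λ u → u * (c + - d)) (⟦⟧-def (+ p))))

  ∼⇒mod : ∀ {x y a b} → x ∼ a → y ∼ b → a ≈ b → x ≡ y [mod p ]
  ∼⇒mod {x} {y} {a} {b} x∼a y∼b a≈b = from (∼-≈ x∼a a≈b) y∼b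
    where
    from : x ∼ b → y ∼ b → x ≡ y [mod p ]
    from (residue {c} eq i) (residue {d} eq′ i′) = e , difference {x} {y} {b} {c} {d} eq eq′ , Coprime-denominator {e} (integral-+ i (integral-neg i′))
      where
      e : ℚ
      e = c + - d

-- Formal power series over the rationals and Faulhaber's formula.

module PowerSeries (n : ℕ) (prime : Prime (5 ℕ.+ (n ℕ.+ n))) where

  open import Data.Rational using (ℚ; 0ℚ; 1ℚ; _/_; _+_; _-_; _*_; -_)
  open import Data.Rational.Properties
  open import Defs
  open IntegerSums
  open Binomials using (pos-suc)
  open PrimeField n prime
  open Residues n prime
  open +-*-Solver using (solve; con; _:+_; _:*_; _:-_; :-_; _:=_)
  open ≡-Reasoning

  tail : Series → Series
  tail f m = f (suc m)

  _⊕_ : Series → Series → Series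
  (f ⊕ g) m = f m + g m

  _·_ : ℚ → Series → Series
  (c · f) m = c * f m

  ⊛-congˡ : ∀ f {g g′} m → g ≗ g′ → (f ⊛ g) m ≡ (f ⊛ g′) m
  ⊛-congˡ f zero    g≗ = cong (λ x → f 0 * x + 0ℚ) (g≗ 0)
  ⊛-congˡ f (suc m) g≗ = cong₂ (λ x y → f 0 * x + y) (g≗ (suc m)) (⊛-congˡ (tail f) m g≗)

  ⊛-congʳ : ∀ {f f′} g m → f ≗ f′ → (f ⊛ g) m ≡ (f′ ⊛ g) m
  ⊛-congʳ g zero    f≗ = cong (λ x → x * g 0 + 0ℚ) (f≗ 0)
  ⊛-congʳ g (suc m) f≗ = cong₂ (λ x y → x * g (suc m) + y) (f≗ 0) (⊛-congʳ g m (f≗ ∘ suc))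

  ⊛-distribʳ : ∀ f g h m → ((f ⊕ g) ⊛ h) m ≡ (f ⊛ h) m + (g ⊛ h) m
  ⊛-distribʳ f g h zero = solve 3 (λ a b c → (a :+ b) :* c :+ con 0ℚ := (a :* c :+ con 0ℚ) :+ (b :* c :+ con 0ℚ)) refl (f 0) (g 0) (h 0)
  ⊛-distribʳ f g h (suc m) = trans (cong (_+_ ((f 0 + g 0) * h (suc m))) (⊛-distribʳ (tail f) (tail g) h m))
    (solve 5 (λ a b c x y → (a :+ b) :* c :+ (x :+ y) := (a :* c :+ x) :+ (b :* c :+ y)) refl
      (f 0) (g 0) (h (suc m)) ((tail f ⊛ h) m) ((tail g ⊛ h) m))

  ⊛-scale : ∀ c f g m → ((c · f) ⊛ g) m ≡ c * (f ⊛ g) m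
  ⊛-scale c f g zero = solve 3 (λ c a b → c :* a :* b :+ con 0ℚ := c :* (a :* b :+ con 0ℚ)) refl c (f 0) (g 0)
  ⊛-scale c f g (suc m) = trans (cong (_+_ (c * f 0 * g (suc m))) (⊛-scale c (tail f) g m))
    (solve 4 (λ c a b x → c :* a :* b :+ c :* x := c :* (a :* b :+ x)) refl c (f 0) (g (suc m)) ((tail f ⊛ g) m))

  -- The convolution peels off f 0 by definition; peeling off g 0 at the other end is what
  -- commutativity and the products with `var` require.
  ⊛-last : ∀ f g m → (f ⊛ g) (suc m) ≡ (f ⊛ tail g) m + f (suc m) * g 0
  ⊛-last f g zero = solve 4 (λ a b c d → a :* b :+ (c :* d :+ con 0ℚ) := (a :* b :+ con 0ℚ) :+ c :* d) refl (f 0) (g 1) (f 1) (g 0)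
  ⊛-last f g (suc m) = trans (cong (_+_ (f 0 * g (suc (suc m)))) (⊛-last (tail f) g m))
    (sym (+-assoc (f 0 * g (suc (suc m))) _ _))

  ⊛-comm : ∀ f g m → (f ⊛ g) m ≡ (g ⊛ f) m
  ⊛-comm f g zero    = cong (_+ 0ℚ) (*-comm (f 0) (g 0))
  ⊛-comm f g (suc m) = trans (cong₂ _+_ (*-comm (f 0) (g (suc m))) (⊛-comm (tail f) g m))
    (trans (+-comm (g (suc m) * f 0) _) (sym (⊛-last g f m)))

  ⊛-assoc : ∀ f g h m → ((f ⊛ g) ⊛ h) m ≡ (f ⊛ (g ⊛ h)) m
  ⊛-assoc f g h zero = solve 3 (λ a b c → (a :* b :+ con 0ℚ) :* c :+ con 0ℚ := a :* (b :* c :+ con 0ℚ) :+ con 0ℚ) refl (f 0) (g 0) (h 0)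
  ⊛-assoc f g h (suc m) = begin
    (f 0 * g 0 + 0ℚ) * h (suc m) + (((f 0 · tail g) ⊕ (tail f ⊛ g)) ⊛ h) m
      ≡⟨ cong (_+_ ((f 0 * g 0 + 0ℚ) * h (suc m))) (trans (⊛-distribʳ (f 0 · tail g) (tail f ⊛ g) h m)
           (cong₂ _+_ (⊛-scale (f 0) (tail g) h m) (⊛-assoc (tail f) g h m))) ⟩
    (f 0 * g 0 + 0ℚ) * h (suc m) + (f 0 * (tail g ⊛ h) m + (tail f ⊛ (g ⊛ h)) m)
      ≡⟨ solve 5 (λ a b c x y → (a :* b :+ con 0ℚ) :* c :+ (a :* x :+ y) := a :* (b :* c :+ x) :+ y) refl
           (f 0) (g 0) (h (suc m)) ((tail g ⊛ h) m) ((tail f ⊛ (g ⊛ h)) m) ⟩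
    f 0 * (g 0 * h (suc m) + (tail g ⊛ h) m) + (tail f ⊛ (g ⊛ h)) m ∎

  ⊛-zeroʳ : ∀ f m → (f ⊛ (λ _ → 0ℚ)) m ≡ 0ℚ
  ⊛-zeroʳ f zero    = solve 1 (λ a → a :* con 0ℚ :+ con 0ℚ := con 0ℚ) refl (f 0)
  ⊛-zeroʳ f (suc m) = trans (cong (_+_ (f 0 * 0ℚ)) (⊛-zeroʳ (tail f) m)) (solve 1 (λ a → a :* con 0ℚ :+ con 0ℚ := con 0ℚ) refl (f 0))

  ⊛-unit : ∀ f m → (f ⊛ tail var) m ≡ f m
  ⊛-unit f zero    = solve 1 (λ a → a :* con 1ℚ :+ con 0ℚ := a) refl (f 0)
  ⊛-unit f (suc m) = trans (⊛-last f (tail var) m) (trans (cong (_+ f (suc m) * 1ℚ) (⊛-zeroʳ f m))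
    (trans (+-identityˡ _) (*-identityʳ (f (suc m)))))

  ⊛-var : ∀ f m → (f ⊛ var) (suc m) ≡ f m
  ⊛-var f m = trans (⊛-last f var m) (trans (cong₂ _+_ (⊛-unit f m) (*-zeroʳ (f (suc m)))) (+-identityʳ (f m)))

  -- The Euler operator x d/dx. It multiplies the coefficient of x^m by m, so series with equal
  -- constant terms agree once their images agree.
  θ : Series → Series
  θ f m = ⟦ + m ⟧ * f m

  ⟦suc⟧ : ∀ m → ⟦ + suc m ⟧ ≡ ⟦ + m ⟧ + 1ℚ
  ⟦suc⟧ m = trans (cong ⟦_⟧ (pos-suc m)) (trans (⟦⟧-+ (+ m) 1ℤ) (cong (_+_ ⟦ + m ⟧) (⟦⟧-def 1ℤ)))

  θ-⊛ : ∀ f g m → ⟦ + m ⟧ * (f ⊛ g) m ≡ (θ f ⊛ g) m + (f ⊛ θ g) m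
  θ-⊛ f g zero = trans (cong (_* (f 0 * g 0 + 0ℚ)) ⟦0⟧) (trans
    (solve 2 (λ a b → con 0ℚ :* (a :* b :+ con 0ℚ) := (con 0ℚ :* a :* b :+ con 0ℚ) :+ (a :* (con 0ℚ :* b) :+ con 0ℚ)) refl (f 0) (g 0))
    (cong (λ z → (z * f 0 * g 0 + 0ℚ) + (f 0 * (z * g 0) + 0ℚ)) (sym ⟦0⟧)))
  θ-⊛ f g (suc m) = begin
    s * (f 0 * g (suc m) + (tail f ⊛ g) m)
      ≡⟨ trans (*-distribˡ-+ s (f 0 * g (suc m)) _) (cong (λ z → s * (f 0 * g (suc m)) + z * (tail f ⊛ g) m) (⟦suc⟧ m)) ⟩
    s * (f 0 * g (suc m)) + (⟦ + m ⟧ + 1ℚ) * (tail f ⊛ g) m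
      ≡⟨ solve 5 (λ s a b m x → s :* (a :* b) :+ (m :+ con 1ℚ) :* x := a :* (s :* b) :+ (m :* x :+ x)) refl
           s (f 0) (g (suc m)) ⟦ + m ⟧ ((tail f ⊛ g) m) ⟩
    f 0 * θ g (suc m) + (⟦ + m ⟧ * (tail f ⊛ g) m + (tail f ⊛ g) m)
      ≡⟨ cong (λ x → f 0 * θ g (suc m) + (x + (tail f ⊛ g) m)) (θ-⊛ (tail f) g m) ⟩
    f 0 * θ g (suc m) + ((θ (tail f) ⊛ g) m + (tail f ⊛ θ g) m + (tail f ⊛ g) m)
      ≡⟨ solve 4 (λ w x y z → w :+ (x :+ y :+ z) := (con 0ℚ :+ (x :+ z)) :+ (w :+ y)) refl
           (f 0 * θ g (suc m)) ((θ (tail f) ⊛ g) m) ((tail f ⊛ θ g) m) ((tail f ⊛ g) m) ⟩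
    (0ℚ + ((θ (tail f) ⊛ g) m + (tail f ⊛ g) m)) + (f ⊛ θ g) (suc m)
      ≡⟨ cong (_+ (f ⊛ θ g) (suc m)) (cong₂ _+_
           (sym (trans (cong (λ z → z * f 0 * g (suc m)) ⟦0⟧) (solve 2 (λ a b → con 0ℚ :* a :* b := con 0ℚ) refl (f 0) (g (suc m)))))
           (trans (sym (⊛-distribʳ (θ (tail f)) (tail f) g m)) (⊛-congʳ {θ (tail f) ⊕ tail f} {tail (θ f)} g m tail-θ))) ⟩
    (θ f ⊛ g) (suc m) + (f ⊛ θ g) (suc m) ∎
    where
    s = ⟦ + suc m ⟧
    tail-θ : (θ (tail f) ⊕ tail f) ≗ tail (θ f)
    tail-θ i = sym (trans (cong (_* f (suc i)) (⟦suc⟧ i)) (solve 2 (λ i x → (i :+ con 1ℚ) :* x := i :* x :+ x) refl ⟦ + i ⟧ (f (suc i))))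

  exp : ℕ → Series
  exp b m = ⟦ (+ b) ℤ.^ m ⟧ * 1/! m

  !-1/! : ∀ m → ⟦ + (m !) ⟧ * 1/! m ≡ 1ℚ
  !-1/! m = trans (/-* (+ 1) (m !) {{m ℕ.!≢0}}) (⟦⟧-def 1ℤ)

  suc-1/! : ∀ m → ⟦ + suc m ⟧ * 1/! (suc m) ≡ 1/! m
  suc-1/! m = *-cancelˡ (m !) {{m ℕ.!≢0}} (begin
    ⟦ + (m !) ⟧ * (⟦ + suc m ⟧ * 1/! (suc m))
      ≡⟨ solve 3 (λ a b c → a :* (b :* c) := (b :* a) :* c) refl ⟦ + (m !) ⟧ ⟦ + suc m ⟧ (1/! (suc m)) ⟩
    ⟦ + suc m ⟧ * ⟦ + (m !) ⟧ * 1/! (suc m)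
      ≡⟨ cong (_* 1/! (suc m)) (trans (sym (⟦⟧-* (+ suc m) (+ (m !)))) (cong ⟦_⟧ (sym (ℤ.pos-* (suc m) (m !))))) ⟩
    ⟦ + (suc m !) ⟧ * 1/! (suc m)
      ≡⟨ trans (!-1/! (suc m)) (sym (!-1/! m)) ⟩
    ⟦ + (m !) ⟧ * 1/! m ∎)

  θ-exp : ∀ b m → θ (exp b) (suc m) ≡ ⟦ + b ⟧ * exp b m
  θ-exp b m = trans (cong (λ z → ⟦ + suc m ⟧ * (z * 1/! (suc m))) (⟦⟧-* (+ b) ((+ b) ℤ.^ m)))
    (trans (solve 4 (λ s b x v → s :* (b :* x :* v) := b :* (x :* (s :* v))) refl ⟦ + suc m ⟧ ⟦ + b ⟧ ⟦ (+ b) ℤ.^ m ⟧ (1/! (suc m)))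
    (cong (λ v → ⟦ + b ⟧ * (⟦ (+ b) ℤ.^ m ⟧ * v)) (suc-1/! m)))

  -- Under θ both sides are multiplied by m + 1 in degree m + 1, and the product rule turns them
  -- into b + 1 times the coefficients in degree m, where induction applies.
  exp-suc : ∀ b m → (exp b ⊛ 1/!) m ≡ exp (suc b) m
  exp-suc b zero    = trans (cong (λ z → z * 1/! 0 * 1/! 0 + 0ℚ) (⟦⟧-def 1ℤ)) (cong (_* 1/! 0) (sym (⟦⟧-def 1ℤ)))
  exp-suc b (suc m) = *-cancelˡ (suc m) (begin
    ⟦ + suc m ⟧ * (exp b ⊛ 1/!) (suc m)
      ≡⟨ θ-⊛ (exp b) 1/! (suc m) ⟩
    (θ (exp b) ⊛ 1/!) (suc m) + (exp b ⊛ θ 1/!) (suc m)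
      ≡⟨ cong₂ _+_
           (trans (cong (_+ (tail (θ (exp b)) ⊛ 1/!) m) (trans (cong (λ z → z * exp b 0 * 1/! (suc m)) ⟦0⟧)
             (solve 2 (λ a b → con 0ℚ :* a :* b := con 0ℚ) refl (exp b 0) (1/! (suc m)))))
             (trans (+-identityˡ _) (trans (⊛-congʳ {tail (θ (exp b))} {⟦ + b ⟧ · exp b} 1/! m (θ-exp b)) (⊛-scale ⟦ + b ⟧ (exp b) 1/! m))))
           (trans (⊛-last (exp b) (θ 1/!) m) (trans (cong₂ _+_ (⊛-congˡ (exp b) {tail (θ 1/!)} {1/!} m suc-1/!)
             (trans (cong (λ z → exp b (suc m) * (z * 1/! 0)) ⟦0⟧) (solve 2 (λ a b → a :* (con 0ℚ :* b) := con 0ℚ) refl (exp b (suc m)) (1/! 0))))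
             (+-identityʳ _))) ⟩
    ⟦ + b ⟧ * (exp b ⊛ 1/!) m + (exp b ⊛ 1/!) m
      ≡⟨ solve 2 (λ b x → b :* x :+ x := (b :+ con 1ℚ) :* x) refl ⟦ + b ⟧ ((exp b ⊛ 1/!) m) ⟩
    (⟦ + b ⟧ + 1ℚ) * (exp b ⊛ 1/!) m
      ≡⟨ cong₂ _*_ (sym (⟦suc⟧ b)) (exp-suc b m) ⟩
    ⟦ + suc b ⟧ * exp (suc b) m
      ≡⟨ θ-exp (suc b) m ⟨
    ⟦ + suc m ⟧ * exp (suc b) (suc m) ∎)

  exp-1 : ℕ → Series
  exp-1 b zero    = 0ℚ
  exp-1 b (suc m) = exp b (suc m)

  exp-1-suc : ∀ b m → exp-1 (suc b) m ≡ (exp-1 b ⊕ (exp b ⊛ e^x-1)) m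
  exp-1-suc b zero    = solve 1 (λ a → con 0ℚ := con 0ℚ :+ (a :* con 0ℚ :+ con 0ℚ)) refl (exp b 0)
  exp-1-suc b (suc m) = begin
    exp (suc b) (suc m) ≡⟨ exp-suc b (suc m) ⟨
    (exp b ⊛ 1/!) (suc m) ≡⟨ ⊛-last (exp b) 1/! m ⟩
    (exp b ⊛ tail 1/!) m + exp b (suc m) * 1/! 0 ≡⟨ solve 2 (λ x y → x :+ y :* con 1ℚ := y :+ (x :+ y :* con 0ℚ)) refl ((exp b ⊛ tail 1/!) m) (exp b (suc m)) ⟩
    exp b (suc m) + ((exp b ⊛ tail 1/!) m + exp b (suc m) * 0ℚ) ≡⟨ cong (_+_ (exp b (suc m))) (⊛-last (exp b) e^x-1 m) ⟨
    exp b (suc m) + (exp b ⊛ e^x-1) (suc m)          ∎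

  -- The sum starts with 0^m, which is 1 for m = 0.
  powerSum : ℕ → ℕ → ℤ
  powerSum m zero    = 0ℤ
  powerSum m (suc b) = powerSum m b ℤ.+ (+ b) ℤ.^ m

  abstract
    β : Series
    β i = bernoulli i * 1/! i

    β-def : ∀ i → β i ≡ bernoulli i * 1/! i
    β-def i = refl

    β-egf : (β ⊛ e^x-1) ≗ var
    β-egf = bernoulli-egf

    β-0 : β 0 ≡ 1ℚ
    β-0 = refl

  -- As e^(bx) - 1 is e^x - 1 times the sum of the e^(cx) with c < b, its product with x/(e^x - 1)
  -- is x Σ e^(cx). Induction on b adds one exponential at a time.
  faulhaber : ∀ m b → (β ⊛ exp-1 b) (suc m) ≡ ⟦ powerSum m b ⟧ * 1/! m
  faulhaber m zero = trans (⊛-congˡ β {exp-1 0} {λ _ → 0ℚ} (suc m) exp-1-zero) (trans (⊛-zeroʳ β (suc m))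
    (sym (trans (cong (_* 1/! m) ⟦0⟧) (*-zeroˡ (1/! m)))))
    where
    exp-1-zero : exp-1 0 ≗ (λ _ → 0ℚ)
    exp-1-zero zero    = refl
    exp-1-zero (suc m) = trans (cong (λ z → ⟦ z ⟧ * 1/! (suc m)) (ℤ.*-zeroˡ ((+ 0) ℤ.^ m))) (trans (cong (_* 1/! (suc m)) ⟦0⟧) (*-zeroˡ (1/! (suc m))))
  faulhaber m (suc b) = begin
    (β ⊛ exp-1 (suc b)) (suc m)
      ≡⟨ ⊛-comm β (exp-1 (suc b)) (suc m) ⟩
    (exp-1 (suc b) ⊛ β) (suc m)
      ≡⟨ ⊛-congʳ {exp-1 (suc b)} {exp-1 b ⊕ (exp b ⊛ e^x-1)} β (suc m) (exp-1-suc b) ⟩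
    ((exp-1 b ⊕ (exp b ⊛ e^x-1)) ⊛ β) (suc m)
      ≡⟨ ⊛-distribʳ (exp-1 b) (exp b ⊛ e^x-1) β (suc m) ⟩
    (exp-1 b ⊛ β) (suc m) + ((exp b ⊛ e^x-1) ⊛ β) (suc m)
      ≡⟨ cong₂ _+_ (⊛-comm (exp-1 b) β (suc m)) (trans (⊛-assoc (exp b) e^x-1 β (suc m))
           (⊛-congˡ (exp b) {e^x-1 ⊛ β} {var} (suc m) (λ i → trans (⊛-comm e^x-1 β i) (β-egf i)))) ⟩
    (β ⊛ exp-1 b) (suc m) + (exp b ⊛ var) (suc m)
      ≡⟨ cong₂ _+_ (faulhaber m b) (⊛-var (exp b) m) ⟩
    ⟦ powerSum m b ⟧ * 1/! m + ⟦ (+ b) ℤ.^ m ⟧ * 1/! m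
      ≡⟨ trans (sym (*-distribʳ-+ (1/! m) ⟦ powerSum m b ⟧ _)) (cong (_* 1/! m) (sym (⟦⟧-+ (powerSum m b) _))) ⟩
    ⟦ powerSum m (suc b) ⟧ * 1/! m ∎

-- Bernoulli numbers and power sums modulo p.

module BernoulliMod (n : ℕ) (prime : Prime (5 ℕ.+ (n ℕ.+ n))) where

  open import Data.Integer.Base using (_+_; _-_; _*_; -_; _^_)
  open import Data.Integer.Properties hiding (module ≤-Reasoning; ≤-refl)
  open IntegerSums
  open Binomials
  open PrimeField n prime
  open import Defs
  open Residues n prime
  open PowerSeries n prime
  open import Relation.Binary.Reasoning.Setoid ≈-setoid

  1/!-∼ : ∀ m → m ℕ.< p → 1/! m ∼ ι (m !)
  1/!-∼ m m<p = subst (1/! m ∼_) (*-identityˡ (ι (m !))) (∼-/ 1ℤ (m !) {{m ℕ.!≢0}} (!-unit m m<p))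

  integral-⊛ : ∀ f g m → (∀ i → i ℕ.≤ m → Integral (f i)) → (∀ i → i ℕ.≤ m → Integral (g i)) → Integral ((f ⊛ g) m)
  integral-⊛ f g zero    hf hg = subst Integral (sym (ℚ.+-identityʳ (f 0 ℚ.* g 0))) (integral-* (hf 0 z≤n) (hg 0 z≤n))
  integral-⊛ f g (suc m) hf hg = integral-+ (integral-* (hf 0 z≤n) (hg (suc m) ℕ.≤-refl))
    (integral-⊛ (tail f) g m (λ i i≤m → hf (suc i) (s≤s i≤m)) (λ i i≤m → hg i (ℕ.m≤n⇒m≤1+n i≤m)))

  private
    -- In β (e^x - 1) = x the coefficient of x^(i + 2) is zero, and β(i + 1) enters it with the
    -- factor 1/1!.
    β-suc : ∀ i → β (suc i) ≡ ℚ.- (β ⊛ tail (tail e^x-1)) i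
    β-suc i = solve-for (β (suc i)) ((β ⊛ tail (tail e^x-1)) i) {β (suc (suc i))}
      (trans (sym (trans (⊛-last β e^x-1 (suc i)) (cong (ℚ._+ β (suc (suc i)) ℚ.* ℚ.0ℚ) (⊛-last β (tail e^x-1) i))))
        (β-egf (suc (suc i))))
      where
      open +-*-Solver using (solve; con; _:+_; _:*_; _:-_; :-_; _:=_)
      solve-for : ∀ x y {z} → (y ℚ.+ x ℚ.* ℚ.1ℚ) ℚ.+ z ℚ.* ℚ.0ℚ ≡ ℚ.0ℚ → x ≡ ℚ.- y
      solve-for x y {z} eq = trans (solve 3 (λ x y z → x := ((y :+ x :* con ℚ.1ℚ) :+ z :* con ℚ.0ℚ) :+ :- y) refl x y z)
        (trans (cong (ℚ._+ ℚ.- y) eq) (ℚ.+-identityˡ (ℚ.- y)))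

    -- The recursion for β(j + 1) divides only by factorials up to (j + 2)!, which are units as long
    -- as j + 2 < p. Treating all j ≤ i together makes this a strong induction.
    β-integral-≤ : ∀ i → suc i ℕ.< p → ∀ j → j ℕ.≤ i → Integral (β j)
    β-integral-≤ i i+1<p zero _ = subst Integral (trans (⟦⟧-def 1ℤ) (sym β-0)) (integral-⟦⟧ 1ℤ)
    β-integral-≤ (suc i) i+2<p (suc j) (s≤s j≤i) = subst Integral (sym (β-suc j)) (integral-neg
      (integral-⊛ β (tail (tail e^x-1)) j
        (λ l l≤j → β-integral-≤ i (ℕ.<-trans (ℕ.n<1+n (suc i)) i+2<p) l (ℕ.≤-trans l≤j j≤i))
        (λ l l≤j → ∼⇒integral (1/!-∼ (suc (suc l)) (ℕ.≤-<-trans (s≤s (s≤s (ℕ.≤-trans l≤j j≤i))) i+2<p)))))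

  β-integral : ∀ i → suc i ℕ.< p → Integral (β i)
  β-integral i i+1<p = β-integral-≤ i i+1<p i ℕ.≤-refl

  conv : (ℕ → ℤ) → (ℕ → ℤ) → ℕ → ℤ
  conv f g zero    = f 0 * g 0
  conv f g (suc m) = f 0 * g (suc m) + conv (λ i → f (suc i)) g m

  ⊛-∼ : ∀ {f g} {a b : ℕ → ℤ} m → (∀ i → i ℕ.≤ m → f i ∼ a i) → (∀ i → i ℕ.≤ m → g i ∼ b i) → (f ⊛ g) m ∼ conv a b m
  ⊛-∼ {f} {g} {a} {b} zero hf hg = subst (_∼ a 0 * b 0) (sym (ℚ.+-identityʳ (f 0 ℚ.* g 0))) (∼-* (hf 0 z≤n) (hg 0 z≤n))
  ⊛-∼ {f} {g} (suc m) hf hg = ∼-+ (∼-* (hf 0 z≤n) (hg (suc m) ℕ.≤-refl))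
    (⊛-∼ {tail f} {g} m (λ i i≤m → hf (suc i) (s≤s i≤m)) (λ i i≤m → hg i (ℕ.m≤n⇒m≤1+n i≤m)))

  conv-≈0 : ∀ f g m → (∀ j → j ℕ.≤ m → g j ≈ 0ℤ) → conv f g m ≈ 0ℤ
  conv-≈0 f g zero    h = ≈-trans (*ˡ (f 0) (h 0 z≤n)) (≡⇒≈ (*-zeroʳ (f 0)))
  conv-≈0 f g (suc m) h = +-cong (≈-trans (*ˡ (f 0) (h (suc m) ℕ.≤-refl)) (≡⇒≈ (*-zeroʳ (f 0))))
    (conv-≈0 (λ i → f (suc i)) g m (λ j j≤m → h j (ℕ.m≤n⇒m≤1+n j≤m)))

  -- Only index s of g contributes. The vanishing of power sums makes `moment` such a sequence
  -- modulo p, and this picks a single Bernoulli number out of Faulhaber's formula.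
  conv-spike : ∀ f g s m → (∀ j → j ℕ.< s → g j ≈ 0ℤ) → (∀ j → j ℕ.< m → g (suc (s ℕ.+ j)) ≈ 0ℤ) → conv f g (s ℕ.+ m) ≈ f m * g s
  conv-spike f g s       (suc m) h h′ = ≈-trans (≡⇒≈ (cong (conv f g) (ℕ.+-suc s m))) (begin
    f 0 * g (suc (s ℕ.+ m)) + conv (λ i → f (suc i)) g (s ℕ.+ m)
      ≈⟨ +-cong (*ˡ (f 0) (h′ m (ℕ.n<1+n m))) (conv-spike (λ i → f (suc i)) g s m h (λ j j<m → h′ j (ℕ.m<n⇒m<1+n j<m))) ⟩
    f 0 * 0ℤ + f (suc m) * g s
      ≡⟨ trans (cong (_+ f (suc m) * g s) (*-zeroʳ (f 0))) (+-identityˡ (f (suc m) * g s)) ⟩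
    f (suc m) * g s ∎)
  conv-spike f g zero    zero    h h′ = ≈-refl
  conv-spike f g (suc s) zero    h h′ = begin
    f 0 * g (suc (s ℕ.+ 0)) + conv (λ i → f (suc i)) g (s ℕ.+ 0)
      ≈⟨ +-cong (≡⇒≈ (cong (λ j → f 0 * g (suc j)) (ℕ.+-identityʳ s)))
           (conv-≈0 (λ i → f (suc i)) g (s ℕ.+ 0) (λ j j≤s → h j (s≤s (subst (j ℕ.≤_) (ℕ.+-identityʳ s) j≤s)))) ⟩
    f 0 * g (suc s) + 0ℤ ≡⟨ +-identityʳ (f 0 * g (suc s)) ⟩
    f 0 * g (suc s)       ∎

  conv-Sum : ∀ M f (c : ℕ → ℤ) (g : ℕ → ℕ → ℤ) m → Sum M (λ b → c b * conv f (g b) m) ≡ conv f (λ j → Sum M (λ b → c b * g b j)) m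
  conv-Sum M f c g zero = trans (Sum-cong M (λ b _ → lemma (c (suc b)) (f 0) (g (suc b) 0))) (Sum-*ˡ M (f 0) _)
    where
    lemma : ∀ c f g → c * (f * g) ≡ f * (c * g)
    lemma = solve-∀
  conv-Sum M f c g (suc m) = trans (Sum-cong M (λ b _ → lemma (c (suc b)) (f 0) (g (suc b) (suc m)) (conv (λ i → f (suc i)) (g (suc b)) m)))
    (trans (Sum-+ M _ _) (cong₂ _+_ (Sum-*ˡ M (f 0) _) (conv-Sum M (λ i → f (suc i)) c g m)))
    where
    lemma : ∀ c f g x → c * (f * g + x) ≡ f * (c * g) + c * x
    lemma = solve-∀

  βₚ : ℕ → ℤ
  βₚ i = res (β i)

  expₚ : ℕ → ℕ → ℤ
  expₚ b zero    = 0ℤ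
  expₚ b (suc j) = (+ b) ^ suc j * ι (suc j !)

  exp-1-∼ : ∀ b j → j ℕ.< p → exp-1 b j ∼ expₚ b j
  exp-1-∼ b zero    _   = subst (_∼ 0ℤ) ⟦0⟧ (∼-⟦⟧ 0ℤ)
  exp-1-∼ b (suc j) j<p = ∼-* (∼-⟦⟧ ((+ b) ^ suc j)) (1/!-∼ (suc j) j<p)

  -- Degree m + 1 involves β up to index m + 1 ≤ p - 2, where all coefficients are p-integral, so
  -- the rational formula may be reduced term by term.
  faulhaber-≈ : ∀ m b → suc (suc m) ℕ.< p → powerSum m b * ι (m !) ≈ conv βₚ (expₚ b) (suc m)
  faulhaber-≈ m b m+2<p = ∼-unique
    (subst (_∼ powerSum m b * ι (m !)) (sym (faulhaber m b))
      (∼-* (∼-⟦⟧ (powerSum m b)) (1/!-∼ m (ℕ.<-trans (ℕ.n<1+n m) (ℕ.<-trans (ℕ.n<1+n (suc m)) m+2<p)))))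
    (⊛-∼ {β} {exp-1 b} (suc m)
      (λ i i≤ → ∼-res (β-integral i (ℕ.≤-<-trans (s≤s i≤) m+2<p)))
      (λ i i≤ → exp-1-∼ b i (ℕ.≤-<-trans i≤ (ℕ.<-trans (ℕ.n<1+n (suc m)) m+2<p))))

  -- For b = p each coefficient p^j/j! of e^(bx) - 1 that occurs has 0 < j < p, hence is a multiple
  -- of p.
  powerSum-p : ∀ m → suc (suc m) ℕ.< p → powerSum m p ≈ 0ℤ
  powerSum-p m m+2<p = cancel {+ (m !)} (!-unit m m<p) (begin
    + (m !) * powerSum m p ≡⟨ *-comm (+ (m !)) (powerSum m p) ⟩
    powerSum m p * + (m !) ≡⟨ cong (_* + (m !)) (*-identityʳ (powerSum m p)) ⟨
    powerSum m p * 1ℤ * + (m !) ≈⟨ *ʳ (+ (m !)) (*ˡ (powerSum m p) (*-ι (!-unit m m<p))) ⟨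
    powerSum m p * (+ (m !) * ι (m !)) * + (m !) ≡⟨ lemma (powerSum m p) (+ (m !)) (ι (m !)) ⟩
    powerSum m p * ι (m !) * (+ (m !) * + (m !)) ≈⟨ *ʳ (+ (m !) * + (m !)) (≈-trans (faulhaber-≈ m p m+2<p) (conv-≈0 βₚ (expₚ p) (suc m) (λ j _ → expₚ-p j))) ⟩
    0ℤ * (+ (m !) * + (m !)) ≡⟨ trans (*-zeroˡ (+ (m !) * + (m !))) (sym (*-zeroʳ (+ (m !)))) ⟩
    + (m !) * 0ℤ                                    ∎)
    where
    m<p = ℕ.<-trans (ℕ.n<1+n m) (ℕ.<-trans (ℕ.n<1+n (suc m)) m+2<p)
    lemma : ∀ s f v → s * (f * v) * f ≡ s * v * (f * f)
    lemma = solve-∀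
    lemma₂ : ∀ p x v → p * x * v ≡ p * (x * v)
    lemma₂ = solve-∀
    expₚ-p : ∀ j → expₚ p j ≈ 0ℤ
    expₚ-p zero    = ≈-refl
    expₚ-p (suc j) = ≈-trans (≡⇒≈ (lemma₂ (+ p) ((+ p) ^ j) (ι (suc j !)))) (multiple ((+ p) ^ j * ι (suc j !)))

  powerSum-Sum : ∀ m b → powerSum (suc m) (suc b) ≡ Sum b (λ a → (+ a) ^ suc m)
  powerSum-Sum m zero    = trans (+-identityˡ _) (*-zeroˡ ((+ 0) ^ m))
  powerSum-Sum m (suc b) = cong (_+ (+ suc b) ^ suc m) (powerSum-Sum m b)

  Sum-power : ∀ m → suc (suc (suc m)) ℕ.< p → Sum P (λ a → (+ a) ^ suc m) ≈ 0ℤ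
  Sum-power m m+3<p = ≈-trans (≡⇒≈ (trans (sym (powerSum-Sum m P)) (cong (powerSum (suc m)) suc-P))) (powerSum-p (suc m) m+3<p)

  bernoulliₚ : ℤ
  bernoulliₚ = + (k !) * βₚ k

  k+1<p : suc k ℕ.< p
  k+1<p = s≤s (s≤s (ℕ.m≤n+m k 3))

  bernoulli-∼ : bernoulli k ∼ bernoulliₚ
  bernoulli-∼ = subst (_∼ bernoulliₚ) eq (∼-* (∼-⟦⟧ (+ (k !))) (∼-res (β-integral k k+1<p)))
    where
    open +-*-Solver using (solve; con; _:+_; _:*_; _:-_; :-_; _:=_)
    eq : ⟦ + (k !) ⟧ ℚ.* β k ≡ bernoulli k
    eq = trans (cong (⟦ + (k !) ⟧ ℚ.*_) (β-def k)) (trans (solve 3 (λ f b v → f :* (b :* v) := b :* (f :* v)) refl ⟦ + (k !) ⟧ (bernoulli k) (1/! k))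
      (trans (cong (bernoulli k ℚ.*_) (!-1/! k)) (ℚ.*-identityʳ (bernoulli k))))

  Sum-reflect : ∀ f → Sum P f ≡ Sum P (λ a → f (p ℕ.∸ a))
  Sum-reflect f = trans (Sum-reverse P f) (cong (λ s → Sum P (λ a → f (s ℕ.∸ a))) suc-P)

  ι-reflect : ∀ {a} → a ℕ.< P → ι (p ℕ.∸ suc a) ≈ - ι (suc a)
  ι-reflect {a} a<P = ι-+ (ℕ.m∸n+n≡m a<p) (subst (λ b → Unit (+ b)) (sym eq) (unit-≤P (ℕ.∸-monoʳ-< {P} (s≤s z≤n) a<P))) (unit-≤P a<P)
    where
    a<p : suc a ℕ.≤ p
    a<p = subst (suc a ℕ.≤_) suc-P (ℕ.m≤n⇒m≤1+n a<P)
    eq : p ℕ.∸ suc a ≡ suc (P ℕ.∸ suc a)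
    eq = trans (cong (ℕ._∸ suc a) (sym suc-P)) (ℕ.+-∸-assoc 1 a<P)

  odd⇒≈0 : ∀ {s} → s ≈ - s → s ≈ 0ℤ
  odd⇒≈0 {s} s≈-s = cancel (unit-< {1} (s≤s (s≤s (s≤s z≤n)))) (begin
    + 2 * s ≡⟨ lemma s ⟩
    s + s ≈⟨ +ʳ s s≈-s ⟩
    - s + s ≡⟨ +-inverseˡ s ⟩
    0ℤ ≡⟨⟩
    + 2 * 0ℤ    ∎)
    where
    lemma : ∀ s → + 2 * s ≡ s + s
    lemma = solve-∀

  Sum-odd : ∀ f → (∀ a → a ℕ.< P → f (p ℕ.∸ suc a) ≈ - f (suc a)) → Sum P f ≈ 0ℤ
  Sum-odd f odd = odd⇒≈0 (≈-trans (≡⇒≈ (Sum-reflect f)) (≈-trans (Sum-≈ P odd) (≡⇒≈ (Sum-neg P f))))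

  Sum-ι : Sum P ι ≈ 0ℤ
  Sum-ι = Sum-odd ι (λ a → ι-reflect)

  -- By Fermat's theorem a^(-s) is a^(p - 1 - s). This turns harmonic sums into power sums.
  ι-^ : ∀ {a} s m → Unit (+ a) → s ℕ.+ m ≡ 4 ℕ.+ k → ι a ^ s ≈ (+ a) ^ m
  ι-^ {a} zero    m u eq = ≈-sym (≈-trans (≡⇒≈ (cong ((+ a) ^_) eq)) (little-fermat u))
  ι-^ {a} (suc s) m u eq = cancel u (begin
    + a * (ι a * ι a ^ s) ≡⟨ *-assoc (+ a) (ι a) (ι a ^ s) ⟨
    + a * ι a * ι a ^ s ≈⟨ *-cong (*-ι u) (ι-^ s (suc m) u (trans (ℕ.+-suc s m) eq)) ⟩
    1ℤ * (+ a * (+ a) ^ m) ≡⟨ *-identityˡ (+ a * (+ a) ^ m) ⟩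
    + a * (+ a) ^ m          ∎)

-- Multiple harmonic sums and the Bernoulli number.

module HarmonicSums (n : ℕ) (prime : Prime (5 ℕ.+ (n ℕ.+ n))) (0<n : 0 ℕ.< n) where

  open import Data.Integer.Base using (_+_; _-_; _*_; -_; _^_)
  open import Data.Integer.Properties hiding (module ≤-Reasoning; ≤-refl)
  open IntegerSums
  open Binomials
  open PrimeField n prime
  open CentralSums n prime
  open BernoulliMod n prime
  open PowerSeries n prime using (powerSum)
  open import Relation.Binary.Reasoning.Setoid ≈-setoid

  private
    0<k : 0 ℕ.< k
    0<k = ℕ.≤-trans 0<n (ℕ.m≤m+n n n)

  powerSum-Sum′ : ∀ m b → 0 ℕ.< m → powerSum m (suc b) ≡ Sum b (λ a → (+ a) ^ m)
  powerSum-Sum′ (suc m) b _ = powerSum-Sum m b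

  Sum-power′ : ∀ m → 0 ℕ.< m → suc (suc m) ℕ.< p → Sum P (λ a → (+ a) ^ m) ≈ 0ℤ
  Sum-power′ (suc m) _ = Sum-power m

  Sum-const : ∀ m c → Sum m (λ _ → c) ≡ + m * c
  Sum-const zero    c = sym (*-zeroˡ c)
  Sum-const (suc m) c = trans (cong (_+ c) (Sum-const m c)) (trans (lemma (+ m) c) (cong (_* c) (sym (pos-suc m))))
    where
    lemma : ∀ m c → m * c + c ≡ (m + 1ℤ) * c
    lemma = solve-∀

  ι^-cancel : ∀ {a} s m → Unit (+ a) → ι a ^ s * (+ a) ^ (s ℕ.+ m) ≈ (+ a) ^ m
  ι^-cancel {a} zero    m u = ≡⇒≈ (*-identityˡ ((+ a) ^ m))
  ι^-cancel {a} (suc s) m u = begin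
    ι a * ι a ^ s * (+ a * (+ a) ^ (s ℕ.+ m)) ≡⟨ lemma (ι a) (ι a ^ s) (+ a) ((+ a) ^ (s ℕ.+ m)) ⟩
    + a * ι a * (ι a ^ s * (+ a) ^ (s ℕ.+ m)) ≈⟨ *-cong (*-ι u) (ι^-cancel s m u) ⟩
    1ℤ * (+ a) ^ m ≡⟨ *-identityˡ ((+ a) ^ m) ⟩
    (+ a) ^ m                                      ∎
    where
    lemma : ∀ v x a y → v * x * (a * y) ≡ a * v * (x * y)
    lemma = solve-∀

  -- The coefficient of x^j in Σ b^(-s) (e^(bx) - 1) over b < p. For j > 0 it is 1/j! times the
  -- power sum of exponent j - s, and so vanishes modulo p unless p - 1 divides j - s.
  moment : ℕ → ℕ → ℤ
  moment s j = Sum P (λ b → ι b ^ s * expₚ b j)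

  moment-factor : ∀ s j → moment s (suc j) ≡ Sum P (λ b → ι b ^ s * (+ b) ^ suc j) * ι (suc j !)
  moment-factor s j = trans (Sum-cong P (λ b _ → sym (*-assoc (ι (suc b) ^ s) ((+ suc b) ^ suc j) (ι (suc j !)))))
    (Sum-*ʳ P (λ b → ι b ^ s * (+ b) ^ suc j) (ι (suc j !)))

  moment-0 : ∀ s → moment s 0 ≈ 0ℤ
  moment-0 s = Sum-≈0 P (λ b _ → ≡⇒≈ (*-zeroʳ (ι (suc b) ^ s)))

  moment-self : ∀ s → moment (suc s) (suc s) ≈ - ι (suc s !)
  moment-self s = begin
    moment (suc s) (suc s)
      ≡⟨ moment-factor (suc s) s ⟩
    Sum P (λ b → ι b ^ suc s * (+ b) ^ suc s) * ι (suc s !)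
      ≈⟨ *ʳ (ι (suc s !)) (Sum-≈ P (λ b b<P → ≈-trans (≡⇒≈ (cong (λ e → ι (suc b) ^ suc s * (+ suc b) ^ e) (sym (ℕ.+-identityʳ (suc s)))))
           (ι^-cancel (suc s) 0 (unit-≤P b<P)))) ⟩
    Sum P (λ _ → 1ℤ) * ι (suc s !)
      ≡⟨ cong (_* ι (suc s !)) (trans (Sum-const P 1ℤ) (*-identityʳ (+ P))) ⟩
    + P * ι (suc s !)
      ≈⟨ *ʳ (ι (suc s !)) P≈-1 ⟩
    - 1ℤ * ι (suc s !)
      ≡⟨ -1*i≡-i (ι (suc s !)) ⟩
    - ι (suc s !) ∎

  moment-above : ∀ s j → j ℕ.< k → moment s (suc (s ℕ.+ j)) ≈ 0ℤ
  moment-above s j j<k = begin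
    moment s (suc (s ℕ.+ j))
      ≡⟨ moment-factor s (s ℕ.+ j) ⟩
    Sum P (λ b → ι b ^ s * (+ b) ^ suc (s ℕ.+ j)) * ι (suc (s ℕ.+ j) !)
      ≈⟨ *ʳ (ι (suc (s ℕ.+ j) !)) (Sum-≈ P (λ b b<P → ≈-trans (≡⇒≈ (cong (λ e → ι (suc b) ^ s * (+ suc b) ^ e) (sym (ℕ.+-suc s j))))
           (ι^-cancel s (suc j) (unit-≤P b<P)))) ⟩
    Sum P (λ b → (+ b) ^ suc j) * ι (suc (s ℕ.+ j) !)
      ≈⟨ *ʳ (ι (suc (s ℕ.+ j) !)) (Sum-power j (ℕ.+-monoʳ-< 3 (ℕ.m<n⇒m<1+n (ℕ.m<n⇒m<1+n j<k)))) ⟩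
    0ℤ * ι (suc (s ℕ.+ j) !)
      ≡⟨ *-zeroˡ (ι (suc (s ℕ.+ j) !)) ⟩
    0ℤ ∎

  -- Faulhaber's formula expands the inner power sum in the b^j/j! with coefficients β(s + k + 1 -
  -- j). Summation over b leaves j = s + 1 alone, where the moment is -1/(s + 1)!, and so only β(k).
  -- The negative exponents j < s + 1 are left to the hypothesis `low`.
  double-sum : ∀ s → suc (suc (s ℕ.+ k)) ℕ.< p → suc s ℕ.< p → (∀ j → j ℕ.< suc s → moment (suc s) j ≈ 0ℤ) →
    + (suc s !) * Sum P (λ b → ι b ^ suc s * powerSum (s ℕ.+ k) b) ≈ - (+ ((s ℕ.+ k) !) * βₚ k)
  double-sum s m+2<p s<p low = begin
    F * S ≡⟨ *-identityʳ (F * S) ⟨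
    F * S * 1ℤ ≈⟨ *ˡ (F * S) (*-ι (!-unit m m<p)) ⟨
    F * S * (G * ι (m !)) ≡⟨ lemma₁ F S G (ι (m !)) ⟩
    F * G * (S * ι (m !)) ≈⟨ *ˡ (F * G) S-value ⟩
    F * G * (βₚ k * - ι (suc s !)) ≡⟨ lemma₂ F G (βₚ k) (ι (suc s !)) ⟩
    - (G * βₚ k) * (F * ι (suc s !)) ≈⟨ *ˡ (- (G * βₚ k)) (*-ι (!-unit (suc s) s<p)) ⟩
    - (G * βₚ k) * 1ℤ ≡⟨ *-identityʳ (- (G * βₚ k)) ⟩
    - (G * βₚ k)               ∎
    where
    m = s ℕ.+ k
    m<p = ℕ.<-trans (ℕ.n<1+n m) (ℕ.<-trans (ℕ.n<1+n (suc m)) m+2<p)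
    F = + (suc s !)
    G = + (m !)
    S = Sum P (λ b → ι b ^ suc s * powerSum m b)
    lemma₁ : ∀ f s g v → f * s * (g * v) ≡ f * g * (s * v)
    lemma₁ = solve-∀
    lemma₂ : ∀ f g b v → f * g * (b * - v) ≡ - (g * b) * (f * v)
    lemma₂ = solve-∀
    S-value : S * ι (m !) ≈ βₚ k * - ι (suc s !)
    S-value = begin
      S * ι (m !)
        ≡⟨ Sum-*ʳ P _ (ι (m !)) ⟨
      Sum P (λ b → ι b ^ suc s * powerSum m b * ι (m !))
        ≈⟨ Sum-≈ P (λ b _ → ≈-trans (≡⇒≈ (*-assoc (ι (suc b) ^ suc s) (powerSum m (suc b)) (ι (m !))))
             (*ˡ (ι (suc b) ^ suc s) (faulhaber-≈ m (suc b) m+2<p))) ⟩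
      Sum P (λ b → ι b ^ suc s * conv βₚ (expₚ b) (suc m))
        ≡⟨ conv-Sum P βₚ (λ b → ι b ^ suc s) expₚ (suc m) ⟩
      conv βₚ (moment (suc s)) (suc s ℕ.+ k)
        ≈⟨ conv-spike βₚ (moment (suc s)) (suc s) k low (moment-above (suc s)) ⟩
      βₚ k * moment (suc s) (suc s)
        ≈⟨ *ˡ (βₚ k) (moment-self s) ⟩
      βₚ k * - ι (suc s !) ∎

  H₂ H₄ : ℕ → ℤ
  H₂ b = Sum b q
  H₄ b = Sum b (λ a → q a * q a)

  private
    q-power : ∀ {a} → Unit (+ a) → q a ≈ (+ a) ^ (2 ℕ.+ k)
    q-power {a} u = ≈-trans (≡⇒≈ (cong (ι a *_) (sym (*-identityʳ (ι a))))) (ι-^ 2 (2 ℕ.+ k) u refl)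

    q²-power : ∀ {a} → Unit (+ a) → q a * q a ≈ (+ a) ^ k
    q²-power {a} u = ≈-trans (≡⇒≈ (lemma (ι a))) (ι-^ 4 k u refl)
      where
      lemma : ∀ v → v * v * (v * v) ≡ v * (v * (v * (v * 1ℤ)))
      lemma = solve-∀

    2+k+2<p : suc (suc (2 ℕ.+ k)) ℕ.< p
    2+k+2<p = ℕ.≤-refl

    k+2<p : suc (suc k) ℕ.< p
    k+2<p = ℕ.m≤n+m (3 ℕ.+ k) 2

  H₂-power : ∀ b → b ℕ.≤ P → H₂ b ≈ Sum b (λ a → (+ a) ^ (2 ℕ.+ k))
  H₂-power b b≤P = Sum-≈ b (λ a a<b → q-power (unit-≤P (ℕ.<-≤-trans a<b b≤P)))

  H₄-power : ∀ b → b ℕ.≤ P → H₄ b ≈ Sum b (λ a → (+ a) ^ k)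
  H₄-power b b≤P = Sum-≈ b (λ a a<b → q²-power (unit-≤P (ℕ.<-≤-trans a<b b≤P)))

  H₂-P : H₂ P ≈ 0ℤ
  H₂-P = ≈-trans (H₂-power P ℕ.≤-refl) (Sum-power′ (2 ℕ.+ k) (s≤s z≤n) 2+k+2<p)

  H₄-P : H₄ P ≈ 0ℤ
  H₄-P = ≈-trans (H₄-power P ℕ.≤-refl) (Sum-power′ k 0<k k+2<p)

  double-sum-1 : Sum P (λ b → ι b * H₄ (pred b)) ≈ - bernoulliₚ
  double-sum-1 = begin
    Sum P (λ b → ι b * H₄ (pred b))
      ≈⟨ Sum-≈ P (λ b b<P → *-cong (≡⇒≈ (sym (*-identityʳ (ι (suc b)))))
           (≈-trans (H₄-power b (ℕ.<⇒≤ b<P)) (≡⇒≈ (sym (powerSum-Sum′ k b 0<k))))) ⟩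
    Sum P (λ b → ι b ^ 1 * powerSum k b)
      ≡⟨ *-identityˡ _ ⟨
    1ℤ * Sum P (λ b → ι b ^ 1 * powerSum k b)
      ≈⟨ double-sum 0 k+2<p (s≤s (s≤s z≤n)) low ⟩
    - bernoulliₚ ∎
    where
    low : ∀ j → j ℕ.< 1 → moment 1 j ≈ 0ℤ
    low zero    _ = moment-0 1
    low (suc j) (s≤s ())

  -- The general formula gives -(p - 3)! β(k)/3!, and (p - 3)(p - 4)/6 ≡ 2. The lower moments are,
  -- up to factorials, the sums of 1/b² and of 1/b over b < p, which vanish.
  double-sum-3 : Sum P (λ b → ι b * q b * H₂ (pred b)) ≈ - (+ 2 * bernoulliₚ)
  double-sum-3 = cancel {+ 6} (unit-* (unit-< {1} (s≤s (s≤s (s≤s z≤n)))) (unit-< {2} (s≤s (s≤s (s≤s (s≤s z≤n)))))) (begin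
    + 6 * Sum P (λ b → ι b * q b * H₂ (pred b))
      ≈⟨ *ˡ (+ 6) (Sum-≈ P (λ b b<P → *-cong (≡⇒≈ (lemma₁ (ι (suc b))))
           (≈-trans (H₂-power b (ℕ.<⇒≤ b<P)) (≡⇒≈ (sym (powerSum-Sum′ (2 ℕ.+ k) b (s≤s z≤n))))))) ⟩
    + 6 * Sum P (λ b → ι b ^ 3 * powerSum (2 ℕ.+ k) b)
      ≈⟨ double-sum 2 2+k+2<p (s≤s (s≤s (s≤s (s≤s z≤n)))) low ⟩
    - (+ ((2 ℕ.+ k) !) * βₚ k)
      ≡⟨ cong (λ x → - (x * βₚ k)) (trans (pos-* (2 ℕ.+ k) (suc k !)) (cong (+ (2 ℕ.+ k) *_) (pos-* (suc k) (k !)))) ⟩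
    - (+ (2 ℕ.+ k) * (+ (1 ℕ.+ k) * + (k !)) * βₚ k)
      ≈⟨ neg-cong (*ʳ (βₚ k) (*-cong (shift 2 3 (ℕ.+-comm (2 ℕ.+ k) 3)) (*ʳ (+ (k !)) (shift 1 4 (ℕ.+-comm (1 ℕ.+ k) 4))))) ⟩
    - ((0ℤ - + 3) * ((0ℤ - + 4) * + (k !)) * βₚ k)
      ≡⟨ lemma₂ (+ (k !)) (βₚ k) ⟩
    + 6 * - (+ 2 * bernoulliₚ) ∎)
    where
    lemma₁ : ∀ v → v * (v * v) ≡ v * (v * (v * 1ℤ))
    lemma₁ = solve-∀
    lemma₂ : ∀ f b → - ((0ℤ - + 3) * ((0ℤ - + 4) * f) * b) ≡ + 6 * - (+ 2 * (f * b))
    lemma₂ = solve-∀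
    lemma₃ : ∀ x c → x ≡ (x + c) - c
    lemma₃ = solve-∀
    shift : ∀ a b → (a ℕ.+ k) ℕ.+ b ≡ p → + (a ℕ.+ k) ≈ 0ℤ - + b
    shift a b eq = ≈-trans (≡⇒≈ (trans (lemma₃ (+ (a ℕ.+ k)) (+ b)) (cong (_- + b) (trans (sym (pos-+ (a ℕ.+ k) b)) (cong +_ eq))))) (+ʳ (- + b) p≈0)
    low : ∀ j → j ℕ.< 3 → moment 3 j ≈ 0ℤ
    low 0 _ = moment-0 3
    low 1 _ = begin
      moment 3 1 ≡⟨ moment-factor 3 0 ⟩
      Sum P (λ b → ι b ^ 3 * (+ b) ^ 1) * ι 1 ≈⟨ *ʳ (ι 1) (Sum-≈ P (λ b b<P → ≈-trans (≡⇒≈ (lemma (ι (suc b)) (+ suc b)))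
                                                                  (≈-trans (*ʳ (q (suc b)) (*-ι (unit-≤P b<P))) (≡⇒≈ (*-identityˡ (q (suc b))))))) ⟩
      H₂ P * ι 1 ≈⟨ *ʳ (ι 1) H₂-P ⟩
      0ℤ * ι 1 ≡⟨ *-zeroˡ (ι 1) ⟩
      0ℤ                                                     ∎
      where
      lemma : ∀ v a → v * (v * (v * 1ℤ)) * (a * 1ℤ) ≡ a * v * (v * v)
      lemma = solve-∀
    low 2 _ = begin
      moment 3 2 ≡⟨ moment-factor 3 1 ⟩
      Sum P (λ b → ι b ^ 3 * (+ b) ^ 2) * ι 2 ≈⟨ *ʳ (ι 2) (Sum-≈ P (λ b b<P → ≈-trans (≡⇒≈ (lemma (ι (suc b)) (+ suc b)))
                                                                  (*-cong (*-cong (*-ι (unit-≤P b<P)) (*-ι (unit-≤P b<P))) (≈-refl {ι (suc b)})))) ⟩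
      Sum P (λ b → 1ℤ * 1ℤ * ι b) * ι 2 ≡⟨ cong (_* ι 2) (Sum-cong P (λ b _ → *-identityˡ (ι (suc b)))) ⟩
      Sum P ι * ι 2 ≈⟨ *ʳ (ι 2) Sum-ι ⟩
      0ℤ * ι 2 ≡⟨ *-zeroˡ (ι 2) ⟩
      0ℤ                                                     ∎
      where
      lemma : ∀ v a → v * (v * (v * 1ℤ)) * (a * (a * 1ℤ)) ≡ a * v * (a * v) * v
      lemma = solve-∀
    low (suc (suc (suc j))) (s≤s (s≤s (s≤s ())))

  -- By the symmetry of f the last a terms have the same sum as the first a, and all terms together
  -- add up to zero.
  Sum-reflect-tail : ∀ f → (∀ a → a ℕ.< P → f (p ℕ.∸ suc a) ≈ f (suc a)) → Sum P f ≈ 0ℤ →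
                     ∀ a → a ℕ.≤ P → Sum (P ℕ.∸ a) f ≈ - Sum a f
  Sum-reflect-tail f even total a a≤P = begin
    Sum (P ℕ.∸ a) f ≡⟨ lemma (Sum (P ℕ.∸ a) f) (Sum a f) ⟩
    Sum (P ℕ.∸ a) f + Sum a f - Sum a f ≈⟨ +ʳ (- Sum a f) (+ˡ (Sum (P ℕ.∸ a) f) upper) ⟩
    Sum (P ℕ.∸ a) f + Sum a (λ i → f ((P ℕ.∸ a) ℕ.+ i)) - Sum a f
      ≡⟨ cong (_- Sum a f) (trans (sym (Sum-++ (P ℕ.∸ a) a f)) (cong (λ s → Sum s f) (ℕ.m∸n+n≡m a≤P))) ⟩
    Sum P f - Sum a f ≈⟨ +ʳ (- Sum a f) total ⟩
    0ℤ - Sum a f ≡⟨ +-identityˡ (- Sum a f) ⟩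
    - Sum a f                          ∎
    where
    lemma : ∀ x y → x ≡ x + y - y
    lemma = solve-∀
    index : ∀ i → i ℕ.< a → (P ℕ.∸ a) ℕ.+ (suc a ℕ.∸ suc i) ≡ p ℕ.∸ suc i
    index i i<a = trans (sym (ℕ.+-∸-assoc (P ℕ.∸ a) (ℕ.<⇒≤ i<a)))
      (trans (cong (ℕ._∸ i) (ℕ.m∸n+n≡m a≤P)) (cong (ℕ._∸ suc i) suc-P))
    upper : Sum a f ≈ Sum a (λ i → f ((P ℕ.∸ a) ℕ.+ i))
    upper = ≈-trans (≈-sym (Sum-≈ a (λ i i<a → ≈-trans (≡⇒≈ (cong f (index i i<a))) (even i (ℕ.<-≤-trans i<a a≤P)))))
      (≡⇒≈ (sym (Sum-reverse a (λ i → f ((P ℕ.∸ a) ℕ.+ i)))))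

  q-reflect : ∀ a → a ℕ.< P → q (p ℕ.∸ suc a) ≈ q (suc a)
  q-reflect a a<P = ≈-trans (*-cong (ι-reflect a<P) (ι-reflect a<P)) (≡⇒≈ (lemma (ι (suc a))))
    where
    lemma : ∀ v → - v * - v ≡ v * v
    lemma = solve-∀

  H₂-reflect : ∀ a → a ℕ.≤ P → H₂ (P ℕ.∸ a) ≈ - H₂ a
  H₂-reflect = Sum-reflect-tail q q-reflect H₂-P

  H₄-reflect : ∀ a → a ℕ.≤ P → H₄ (P ℕ.∸ a) ≈ - H₄ a
  H₄-reflect = Sum-reflect-tail (λ a → q a * q a) (λ a a<P → *-cong (q-reflect a a<P) (q-reflect a a<P)) H₄-P

  N≤P : N ℕ.≤ P
  N≤P = subst (N ℕ.≤_) (sym P≡2N) (ℕ.m≤m+n N N)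

  P∸N : P ℕ.∸ N ≡ N
  P∸N = trans (cong (ℕ._∸ N) P≡2N) (ℕ.m+n∸n≡m N N)

  -- N equals P - N, so by reflection the sum is its own negative.
  H₂-N : H₂ N ≈ 0ℤ
  H₂-N = odd⇒≈0 (≈-trans (≡⇒≈ (cong H₂ (sym P∸N))) (H₂-reflect N N≤P))

  H₄-N : H₄ N ≈ 0ℤ
  H₄-N = odd⇒≈0 (≈-trans (≡⇒≈ (cong H₄ (sym P∸N))) (H₄-reflect N N≤P))

  pred-reflect : ∀ a → pred (p ℕ.∸ suc a) ≡ P ℕ.∸ suc a
  pred-reflect a = trans (cong (λ s → pred (s ℕ.∸ suc a)) (sym suc-P)) (ℕ.pred[m∸n]≡m∸[1+n] P a)

  p∸suc : ∀ a → p ℕ.∸ suc a ≡ P ℕ.∸ a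
  p∸suc a = cong (ℕ._∸ suc a) (sym suc-P)

  -- (H₂² - H₄)/2 is the elementary symmetric sum of degree two, so this is 2/(a b² c²) summed over
  -- c < b < a.
  triple : ℕ → ℤ
  triple a = ι a * (H₂ (pred a) * H₂ (pred a) - H₄ (pred a))

  -- Σ H₂(a−1) H₂(a) / a vanishes because its summand is odd under a ↦ p − a.
  Sum-triple : Sum P triple ≈ + 3 * bernoulliₚ
  Sum-triple = begin
    Sum P triple
      ≡⟨ Sum-cong P (λ b _ → lemma₁ (ι (suc b)) (H₂ b) (H₄ b) (q (suc b))) ⟩
    Sum P (λ a → middle a - ι a * q a * H₂ (pred a) - ι a * H₄ (pred a))
      ≡⟨ trans (Sum-sub P _ _) (cong (_- Sum P (λ a → ι a * H₄ (pred a))) (Sum-sub P middle _)) ⟩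
    Sum P middle - Sum P (λ a → ι a * q a * H₂ (pred a)) - Sum P (λ a → ι a * H₄ (pred a))
      ≈⟨ sub-cong (sub-cong (Sum-odd middle middle-odd) double-sum-3) double-sum-1 ⟩
    0ℤ - - (+ 2 * bernoulliₚ) - - bernoulliₚ
      ≡⟨ lemma₂ bernoulliₚ ⟩
    + 3 * bernoulliₚ ∎
    where
    middle : ℕ → ℤ
    middle a = ι a * (H₂ (pred a) * H₂ a)
    lemma₁ : ∀ v h h₄ q → v * (h * h - h₄) ≡ v * (h * (h + q)) - v * q * h - v * h₄
    lemma₁ = solve-∀
    lemma₂ : ∀ b → 0ℤ - - (+ 2 * b) - - b ≡ + 3 * b
    lemma₂ = solve-∀
    lemma₃ : ∀ v x y → - v * (- x * - y) ≡ - (v * (y * x))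
    lemma₃ = solve-∀
    middle-odd : ∀ a → a ℕ.< P → middle (p ℕ.∸ suc a) ≈ - middle (suc a)
    middle-odd a a<P = ≈-trans (*-cong (ι-reflect a<P) (*-cong
        (≈-trans (≡⇒≈ (cong H₂ (pred-reflect a))) (H₂-reflect (suc a) a<P))
        (≈-trans (≡⇒≈ (cong H₂ (p∸suc a))) (H₂-reflect a (ℕ.<⇒≤ a<P)))))
      (≡⇒≈ (lemma₃ (ι (suc a)) (H₂ (suc a)) (H₂ a)))

  h₁≡H₂ : ∀ b → h₁ b ≡ H₂ b
  h₁≡H₂ b = Sum-cong b (λ a _ → *-identityˡ (q (suc a)))

  2h₂ : ∀ b → + 2 * h₂ b ≡ H₂ b * H₂ b + H₄ b
  2h₂ zero    = refl
  2h₂ (suc b) = trans (lemma₁ (h₂ b) (h₁ (suc b)) (q (suc b))) (trans (cong₂ (λ x y → x + + 2 * (y * q (suc b))) (2h₂ b) (h₁≡H₂ (suc b)))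
    (lemma₂ (H₂ b) (H₄ b) (q (suc b))))
    where
    lemma₁ : ∀ h₂ h₁ q → + 2 * (h₂ + h₁ * q) ≡ + 2 * h₂ + + 2 * (h₁ * q)
    lemma₁ = solve-∀
    lemma₂ : ∀ h h₄ q → h * h + h₄ + + 2 * ((h + q) * q) ≡ (h + q) * (h + q) + (h₄ + q * q)
    lemma₂ = solve-∀

  private
    -- `Λ` with index r sums 1/a times r! e_r over a ≤ j, where e_r is the elementary symmetric sum
    -- of degree r of the 1/m² with m < a.
    Λ₀ Λ₁ Λ₂ : ℕ → ℤ
    Λ₀ = star pos
    Λ₁ j = Sum j (λ m → + m * q m * H₂ (pred m))
    Λ₂ j = Sum j (λ m → + m * q m * (H₂ (pred m) * H₂ (pred m) - H₄ (pred m)))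

    star-Λ : ∀ j → star Λ₀ j ≡ H₂ j * Λ₀ j - Λ₁ j
    star-Λ zero    = refl
    star-Λ (suc j) = trans (cong (_+ Λ₀ (suc j) * q (suc j)) (star-Λ j)) (lemma (H₂ j) (Λ₀ j) (Λ₁ j) (+ suc j) (q (suc j)))
      where
      lemma : ∀ h l₀ l₁ m q → h * l₀ - l₁ + (l₀ + m * q) * q ≡ (h + q) * (l₀ + m * q) - (l₁ + m * q * h)
      lemma = solve-∀

    -- For fixed a the 1/(b² c²) with a ≤ b ≤ c ≤ j sum to h₂ of the range from a to j. The
    -- generating product ∏ 1/(1 - x/m²) of that range is the one up to j times ∏ (1 - x/m²) over m
    -- < a, so the sum is h₂(j) - h₁(j) e₁ + e₂.
    2Z₂-Λ : ∀ j → + 2 * Z₂ j ≡ (H₂ j * H₂ j + H₄ j) * Λ₀ j - + 2 * H₂ j * Λ₁ j + Λ₂ j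
    2Z₂-Λ zero    = refl
    2Z₂-Λ (suc j) = trans (lemma₁ (Z₂ j) (star Λ₀ (suc j)) (q (suc j))) (trans
      (cong₂ (λ x y → x + + 2 * (y * q (suc j))) (2Z₂-Λ j) (star-Λ (suc j)))
      (lemma₂ (H₂ j) (H₄ j) (Λ₀ j) (Λ₁ j) (Λ₂ j) (+ suc j) (q (suc j))))
      where
      lemma₁ : ∀ z s q → + 2 * (z + s * q) ≡ + 2 * z + + 2 * (s * q)
      lemma₁ = solve-∀
      lemma₂ : ∀ h h₄ l₀ l₁ l₂ m q →
        (h * h + h₄) * l₀ - + 2 * h * l₁ + l₂ + + 2 * (((h + q) * (l₀ + m * q) - (l₁ + m * q * h)) * q)
        ≡ ((h + q) * (h + q) + (h₄ + q * q)) * (l₀ + m * q) - + 2 * (h + q) * (l₁ + m * q * h) + (l₂ + m * q * (h * h - h₄))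
      lemma₂ = solve-∀

  2Z₂-N : + 2 * Z₂ N ≈ Sum N triple
  2Z₂-N = begin
    + 2 * Z₂ N
      ≡⟨ 2Z₂-Λ N ⟩
    (H₂ N * H₂ N + H₄ N) * Λ₀ N - + 2 * H₂ N * Λ₁ N + Λ₂ N
      ≈⟨ +-cong (sub-cong (*ʳ (Λ₀ N) (+-cong (*-cong H₂-N H₂-N) H₄-N)) (*ʳ (Λ₁ N) (*ˡ (+ 2) H₂-N)))
           (Sum-≈ N (λ m m<N → *ʳ (H₂ m * H₂ m - H₄ m) (ι² (unit-≤N m<N)))) ⟩
    (0ℤ * 0ℤ + 0ℤ) * Λ₀ N - + 2 * 0ℤ * Λ₁ N + Sum N triple
      ≡⟨ lemma (Λ₀ N) (Λ₁ N) (Sum N triple) ⟩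
    Sum N triple ∎
    where
    lemma : ∀ x y z → (0ℤ * 0ℤ + 0ℤ) * x - + 2 * 0ℤ * y + z ≡ z
    lemma = solve-∀

  -- w of the overview.
  single : ℤ
  single = Sum N (λ l → h₂ l * ι l)

  -- The range a ≤ N of `triple` gives 2Z, as h₁ and h₂ vanish at N. For a = p - i with i ≤ N, the
  -- values of H₂ and H₄ at P - i are -H₂(i) and -H₄(i), so H₂² - H₄ becomes H₂² + H₄ = 2h₂(i) while
  -- 1/a becomes -1/i: the upper range contributes -2w.
  Z₂-single : + 2 * Z₂ N - + 2 * single ≈ + 3 * bernoulliₚ
  Z₂-single = begin
    + 2 * Z₂ N - + 2 * single
      ≈⟨ +ʳ (- (+ 2 * single)) 2Z₂-N ⟩
    Sum N triple - + 2 * single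
      ≈⟨ +ˡ (Sum N triple) (≈-sym upper) ⟩
    Sum N triple + Sum N (λ i → triple (N ℕ.+ i))
      ≡⟨ trans (sym (Sum-++ N N triple)) (cong (λ s → Sum s triple) (sym P≡2N)) ⟩
    Sum P triple
      ≈⟨ Sum-triple ⟩
    + 3 * bernoulliₚ ∎
    where
    index : ∀ i → i ℕ.< N → N ℕ.+ (suc N ℕ.∸ suc i) ≡ p ℕ.∸ suc i
    index i i<N = trans (sym (ℕ.+-∸-assoc N (ℕ.<⇒≤ i<N))) (cong (ℕ._∸ suc i) (sym p≡1+2N))
    lemma₁ : ∀ v x y → - v * (- x * - x - - y) ≡ - (v * (x * x + y))
    lemma₁ = solve-∀
    lemma₂ : ∀ v x → - (v * (+ 2 * x)) ≡ - (+ 2) * (x * v)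
    lemma₂ = solve-∀
    term : ∀ i → i ℕ.< N → triple (N ℕ.+ (suc N ℕ.∸ suc i)) ≈ - (+ 2) * (h₂ (suc i) * ι (suc i))
    term i i<N = begin
      triple (N ℕ.+ (suc N ℕ.∸ suc i))
        ≡⟨ cong triple (index i i<N) ⟩
      triple (p ℕ.∸ suc i)
        ≡⟨ cong (λ m → ι (p ℕ.∸ suc i) * (H₂ m * H₂ m - H₄ m)) (pred-reflect i) ⟩
      ι (p ℕ.∸ suc i) * (H₂ (P ℕ.∸ suc i) * H₂ (P ℕ.∸ suc i) - H₄ (P ℕ.∸ suc i))
        ≈⟨ *-cong (ι-reflect i<P) (sub-cong (*-cong (H₂-reflect (suc i) i<P) (H₂-reflect (suc i) i<P)) (H₄-reflect (suc i) i<P)) ⟩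
      - ι (suc i) * (- H₂ (suc i) * - H₂ (suc i) - - H₄ (suc i))
        ≡⟨ lemma₁ (ι (suc i)) (H₂ (suc i)) (H₄ (suc i)) ⟩
      - (ι (suc i) * (H₂ (suc i) * H₂ (suc i) + H₄ (suc i)))
        ≡⟨ cong (λ x → - (ι (suc i) * x)) (2h₂ (suc i)) ⟨
      - (ι (suc i) * (+ 2 * h₂ (suc i)))
        ≡⟨ lemma₂ (ι (suc i)) (h₂ (suc i)) ⟩
      - (+ 2) * (h₂ (suc i) * ι (suc i)) ∎
      where i<P = ℕ.<-≤-trans i<N N≤P
    upper : Sum N (λ i → triple (N ℕ.+ i)) ≈ - (+ 2 * single)
    upper = begin
      Sum N (λ i → triple (N ℕ.+ i)) ≡⟨ Sum-reverse N (λ i → triple (N ℕ.+ i)) ⟩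
      Sum N (λ i → triple (N ℕ.+ (suc N ℕ.∸ i))) ≈⟨ Sum-≈ N term ⟩
      Sum N (λ i → - (+ 2) * (h₂ i * ι i)) ≡⟨ Sum-*ˡ N (- (+ 2)) _ ⟩
      - (+ 2) * single ≡⟨ neg-distribˡ-* (+ 2) single ⟨
      - (+ 2 * single)                                ∎

  h₁-N : h₁ N ≈ 0ℤ
  h₁-N = ≈-trans (≡⇒≈ (h₁≡H₂ N)) H₂-N

  h₂-N : h₂ N ≈ 0ℤ
  h₂-N = cancel (unit-< {1} (s≤s (s≤s (s≤s z≤n)))) (begin
    + 2 * h₂ N ≡⟨ 2h₂ N ⟩
    H₂ N * H₂ N + H₄ N ≈⟨ +-cong (*-cong H₂-N H₂-N) H₄-N ⟩
    + 2 * 0ℤ                ∎)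

-- The sums D(a) and a character of period 6.

module PeriodicCharacter (n : ℕ) (prime : Prime (5 ℕ.+ (n ℕ.+ n))) where

  open import Data.Integer.Base using (_+_; _-_; _*_; -_)
  open import Data.Integer.Properties hiding (module ≤-Reasoning; ≤-refl)
  open import Data.Nat.Divisibility using (divides)
  open IntegerSums
  open Binomials
  open PrimeField n prime
  open CentralSums n prime
  open BernoulliMod n prime using (ι-reflect)
  open import Relation.Binary.Reasoning.Setoid ≈-setoid

  -- D(a) of the overview, the sum of (a/l) C(2l, l + a) over l ≤ N. Odd differences make every
  -- summand an integer.
  odd-sum : ℕ → ℤ
  odd-sum a = Sum N (λ l → odd-difference (pred l) a)

  -- E of the overview.
  weighted-single : ℤ
  weighted-single = Sum N (λ l → h₂ l * (central l 0 * ι l))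

  -- `central-h₂` expands C(2l, l) h₂(l). After the sums are interchanged, C(2l, l + a)/l is 1/a
  -- times an odd difference, and the inner sum over l is `odd-sum a`.
  weighted-single-odd-sum : weighted-single ≈ Sum N (λ a → + 2 * (- alt a * odd-sum a) * (q a * q a * ι a))
  weighted-single-odd-sum = begin
    weighted-single
      ≈⟨ Sum-≈ N (λ i i<N → ≈-trans (≡⇒≈ (lemma₁ (h₂ (suc i)) (central (suc i) 0) (ι (suc i))))
           (*ˡ (ι (suc i)) (≈-sym (central-h₂ (suc i) i<N)))) ⟩
    Sum N (λ l → ι l * weighted w l)
      ≡⟨ Sum-cong N (λ i _ → sym (Sum-*ˡ N (ι (suc i)) _)) ⟩
    Sum N (λ l → Sum N (λ a → ι l * (w a * central l a)))
      ≡⟨ Sum-swap N N _ ⟩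
    Sum N (λ a → Sum N (λ l → ι l * (w a * central l a)))
      ≈⟨ Sum-≈ N (λ b b<N → Sum-≈ N (λ i i<N → ≈-trans (≡⇒≈ (lemma₂ (ι (suc i)) (w (suc b)) (central (suc i) (suc b))))
           (≈-trans (*ˡ (w (suc b)) (swap i<N b<N)) (≡⇒≈ (sym (*-assoc (w (suc b)) (ι (suc b)) (odd-difference i (suc b)))))))) ⟩
    Sum N (λ a → Sum N (λ l → w a * ι a * odd-difference (pred l) a))
      ≡⟨ Sum-cong N (λ b _ → trans (Sum-*ˡ N (w (suc b) * ι (suc b)) _) (lemma₃ (alt (suc b)) (q (suc b)) (ι (suc b)) (odd-sum (suc b)))) ⟩
    Sum N (λ a → + 2 * (- alt a * odd-sum a) * (q a * q a * ι a)) ∎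
    where
    w : ℕ → ℤ
    w = (λ a → + 2 * - alt a) ·q ·q
    lemma₁ : ∀ h c v → h * (c * v) ≡ v * (c * h)
    lemma₁ = solve-∀
    lemma₂ : ∀ v w c → v * (w * c) ≡ w * (v * c)
    lemma₂ = solve-∀
    lemma₃ : ∀ s q v d → + 2 * - s * q * q * v * d ≡ + 2 * (- s * d) * (q * q * v)
    lemma₃ = solve-∀
    lemma₄ : ∀ j a v c → j * a * (v * c) ≡ j * v * (a * c)
    lemma₄ = solve-∀
    lemma₅ : ∀ j a v d → a * v * (j * d) ≡ j * a * (v * d)
    lemma₅ = solve-∀
    swap : ∀ {i b} → i ℕ.< N → b ℕ.< N → ι (suc i) * central (suc i) (suc b) ≈ ι (suc b) * odd-difference i (suc b)
    swap {i} {b} i<N b<N = cancel (unit-* (unit-≤N i<N) (unit-≤N b<N)) (begin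
      + suc i * + suc b * (ι (suc i) * central (suc i) (suc b))
        ≡⟨ lemma₄ (+ suc i) (+ suc b) (ι (suc i)) (central (suc i) (suc b)) ⟩
      + suc i * ι (suc i) * (+ suc b * central (suc i) (suc b))
        ≈⟨ *-cong (≈-trans (*-ι (unit-≤N i<N)) (≈-sym (*-ι (unit-≤N b<N)))) (≡⇒≈ (central-odd-difference i (suc b))) ⟩
      + suc b * ι (suc b) * (+ suc i * odd-difference i (suc b))
        ≡⟨ lemma₅ (+ suc i) (+ suc b) (ι (suc b)) (odd-difference i (suc b)) ⟩
      + suc i * + suc b * (ι (suc b) * odd-difference i (suc b)) ∎)

  -- Pascal's rule used twice takes row 2i + 1 to row 2i + 3 with the coefficients 1, 2, 1;
  -- subtracting the middle entry once leaves 1, 1, 1.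
  odd-difference-step : ∀ i b → odd-difference (suc i) (suc b) - odd-difference i (suc b)
    ≡ odd-difference i (suc (suc b)) + odd-difference i (suc b) + odd-difference i b
  odd-difference-step i b = trans (cong₂ (λ x y → x - y - odd-difference i (suc b)) (third (i ℕ.+ b) (ℕ.+-suc i b)) (third (suc (i ℕ.+ b)) (cong suc (ℕ.+-suc i b))))
    (trans (cong (λ m → B (i ℕ.+ b) + + 2 * B (suc (i ℕ.+ b)) + B (suc (suc (i ℕ.+ b)))
        - (B (suc (i ℕ.+ b)) + + 2 * B (suc (suc (i ℕ.+ b))) + B (suc (suc (suc (i ℕ.+ b))))) - (B m - B (suc m))) (ℕ.+-suc i b))
    (trans (lemma₂ (B (i ℕ.+ b)) (B (suc (i ℕ.+ b))) (B (suc (suc (i ℕ.+ b)))) (B (suc (suc (suc (i ℕ.+ b))))))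
    (cong₂ (λ m m′ → B m - B (suc m) + (B m′ - B (suc m′)) + (B (i ℕ.+ b) - B (suc (i ℕ.+ b))))
      (sym (trans (ℕ.+-suc i (suc b)) (cong suc (ℕ.+-suc i b)))) (sym (ℕ.+-suc i b)))))
    where
    B : ℕ → ℤ
    B = binom (suc (i ℕ.+ i))
    lemma₁ : ∀ x y z → x + y + (y + z) ≡ x + + 2 * y + z
    lemma₁ = solve-∀
    lemma₂ : ∀ x y z t → x + + 2 * y + z - (y + + 2 * z + t) - (y - z) ≡ z - t + (y - z) + (x - y)
    lemma₂ = solve-∀
    third : ∀ m {m′} → m′ ≡ suc m → binom (suc (suc i ℕ.+ suc i)) (suc m′) ≡ B m + + 2 * B (suc m) + B (suc (suc m))
    third m refl = trans (cong (λ s → binom (suc s) (suc (suc m))) (double-suc i)) (trans (binom-pascal (suc (suc (i ℕ.+ i))) (suc m))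
      (trans (cong₂ _+_ (binom-pascal (suc (i ℕ.+ i)) m) (binom-pascal (suc (i ℕ.+ i)) (suc m)))
      (lemma₁ (B m) (B (suc m)) (B (suc (suc m))))))

  Sum-telescope′ : ∀ m (f : ℕ → ℤ) → Sum m (λ i → f i - f (pred i)) ≡ f m - f 0
  Sum-telescope′ m f = trans (Sum-cong m (λ i _ → lemma (f (suc i)) (f i))) (trans (Sum-neg m (λ i → f (pred i) - f i)) (trans (cong -_ (Sum-telescope m f)) (lemma′ (f 0) (f m))))
    where
    lemma : ∀ x y → x - y ≡ - (y - x)
    lemma = solve-∀
    lemma′ : ∀ x y → - (x - y) ≡ y - x
    lemma′ = solve-∀

  -- Summing the previous identity over i telescopes from row 1 to row 2N + 1 = p, whose interior
  -- entries are multiples of p.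
  odd-sum-step : ∀ b → odd-sum (suc (suc b)) + odd-sum (suc b) + odd-sum b ≡ odd-difference N (suc b) - odd-difference 0 (suc b)
  odd-sum-step b = trans (sym (trans (Sum-+ N _ _) (cong (_+ odd-sum b) (Sum-+ N _ _))))
    (trans (Sum-cong N {g = λ l → odd-difference l (suc b) - odd-difference (pred l) (suc b)} (λ i _ → sym (odd-difference-step i b)))
    (Sum-telescope′ N (λ l → odd-difference l (suc b))))

  odd-sum-zero : ∀ a → N ℕ.< a → odd-sum a ≡ 0ℤ
  odd-sum-zero a N<a = trans (Sum-cong N {g = λ _ → 0ℤ} (λ i i<N → cong₂ _-_
      (binom-zero (bound i i<N)) (binom-zero (ℕ.m<n⇒m<1+n (bound i i<N))))) (Sum-zero N)
    where
    bound : ∀ i → i ℕ.< N → suc (i ℕ.+ i) ℕ.< i ℕ.+ a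
    bound i i<N = ℕ.≤-trans (ℕ.≤-reflexive (sym (trans (ℕ.+-suc i (suc i)) (cong suc (ℕ.+-suc i i)))))
      (ℕ.+-monoʳ-≤ i (ℕ.≤-trans (s≤s i<N) N<a))

  binom-p : ∀ {j} → 0 ℕ.< j → j ℕ.< p → binom (suc (N ℕ.+ N)) j ≈ 0ℤ
  binom-p {suc j} _ j<p = cancel (unit-< j<p) (begin
    + suc j * binom (suc (N ℕ.+ N)) (suc j) ≡⟨ binom-absorb (N ℕ.+ N) j ⟩
    + suc (N ℕ.+ N) * binom (N ℕ.+ N) j ≈⟨ *ʳ (binom (N ℕ.+ N) j) (≈-trans (≡⇒≈ (cong +_ (sym p≡1+2N))) p≈0) ⟩
    0ℤ ≡⟨ *-zeroʳ (+ suc j) ⟨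
    + suc j * 0ℤ                               ∎)

  odd-difference-0 : ∀ b → 0 ℕ.< b → odd-difference 0 (suc b) ≡ 0ℤ
  odd-difference-0 (suc b) _ = cong₂ _-_ (binom-zero {1} {suc (suc b)} (s≤s (s≤s z≤n))) (binom-zero {1} {suc (suc (suc b))} (s≤s (s≤s z≤n)))

  odd-sum-interior : ∀ b → 0 ℕ.< b → suc (suc b) ℕ.≤ N → odd-sum (suc (suc b)) + odd-sum (suc b) + odd-sum b ≈ 0ℤ
  odd-sum-interior b 0<b b+2≤N = ≈-trans (≡⇒≈ (odd-sum-step b)) (sub-cong
    (sub-cong (binom-p (subst (0 ℕ.<_) (sym (ℕ.+-suc N b)) (s≤s z≤n)) (ℕ.<-trans (ℕ.n<1+n _) N+b+2<p)) (binom-p (s≤s z≤n) N+b+2<p))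
    (≡⇒≈ (odd-difference-0 b 0<b)))
    where
    N+b+2<p : suc (N ℕ.+ suc b) ℕ.< p
    N+b+2<p = subst (suc (N ℕ.+ suc b) ℕ.<_) (sym p≡1+2N) (s≤s (subst (ℕ._≤ N ℕ.+ N) (ℕ.+-suc N (suc b)) (ℕ.+-monoʳ-≤ N b+2≤N)))

  1≤N : 1 ℕ.≤ N
  1≤N = subst (1 ℕ.≤_) (sym N≡2+n) (s≤s z≤n)

  -- In the recursion at b = N only D(N) survives on the left, and on the right only C(p, p) = 1.
  odd-sum-N : odd-sum N ≡ 1ℤ
  odd-sum-N = trans (lemma (odd-sum N)) (trans (cong₂ (λ x y → x + y + odd-sum N) (sym (odd-sum-zero (suc (suc N)) (ℕ.m<n⇒m<1+n ℕ.≤-refl))) (sym (odd-sum-zero (suc N) ℕ.≤-refl)))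
    (trans (odd-sum-step N) (cong₂ _-_ (cong₂ _-_ (trans (cong (binom (suc (N ℕ.+ N))) (ℕ.+-suc N N)) (cong +_ (nCn≡1 (suc (N ℕ.+ N)))))
      (binom-zero (s≤s (ℕ.≤-reflexive (sym (ℕ.+-suc N N)))))) (odd-difference-0 N 1≤N))))
    where
    lemma : ∀ x → x ≡ 0ℤ + 0ℤ + x
    lemma = solve-∀

  -- In the recursion at M = N - 1 the left side is 0 + 1 + D(M), and the right side is C(p, p - 1)
  -- - C(p, p) ≡ -1.
  odd-sum-pred-N : ∀ {M} → suc M ≡ N → 0 ℕ.< M → odd-sum M ≈ - + 2
  odd-sum-pred-N {M} M+1≡N 0<M = begin
    odd-sum M
      ≡⟨ lemma (odd-sum M) ⟩
    0ℤ + 1ℤ + odd-sum M - 1ℤ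
      ≡⟨ cong₂ (λ x y → x + y + odd-sum M - 1ℤ) (sym (odd-sum-zero (suc (suc M)) (subst (ℕ._< suc (suc M)) M+1≡N ℕ.≤-refl)))
           (sym (trans (cong odd-sum M+1≡N) odd-sum-N)) ⟩
    odd-sum (suc (suc M)) + odd-sum (suc M) + odd-sum M - 1ℤ
      ≡⟨ cong (_- 1ℤ) (odd-sum-step M) ⟩
    odd-difference N (suc M) - odd-difference 0 (suc M) - 1ℤ
      ≈⟨ +ʳ (- 1ℤ) (sub-cong (sub-cong
           (binom-p (ℕ.≤-trans 1≤N (ℕ.m≤m+n N (suc M))) (subst (N ℕ.+ suc M ℕ.<_) (sym p≡1+2N) (s≤s (ℕ.≤-reflexive (cong (N ℕ.+_) M+1≡N)))))
           (≡⇒≈ (trans (cong (λ m → binom (suc (N ℕ.+ N)) (suc (N ℕ.+ m))) M+1≡N) (cong +_ (nCn≡1 (suc (N ℕ.+ N)))))))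
           (≡⇒≈ (odd-difference-0 M 0<M))) ⟩
    - + 2 ∎
    where
    lemma : ∀ x → x ≡ 0ℤ + 1ℤ + x - 1ℤ
    lemma = solve-∀

  -- −1, −2, −1, 1, 2, 1, repeated with period 6.
  X : ℕ → ℤ
  X 0             = - 1ℤ
  X 1             = - + 2
  X (suc (suc m)) = X (suc m) - X m

  X-antiperiod : ∀ t m → X (t ℕ.* 3 ℕ.+ m) ≡ alt t * X m
  X-antiperiod zero    m = sym (*-identityˡ (X m))
  X-antiperiod (suc t) m = trans (lemma (X (suc (t ℕ.* 3 ℕ.+ m))) (X (t ℕ.* 3 ℕ.+ m)))
    (trans (cong -_ (X-antiperiod t m)) (neg-distribˡ-* (alt t) (X m)))
    where
    lemma : ∀ x y → x - y - x ≡ - y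
    lemma = solve-∀

  alt-+ : ∀ a b → alt (a ℕ.+ b) ≡ alt a * alt b
  alt-+ zero    b = sym (*-identityˡ (alt b))
  alt-+ (suc a) b = trans (cong -_ (alt-+ a b)) (neg-distribˡ-* (alt a) (alt b))

  alt-double : ∀ a → alt (a ℕ.+ a) ≡ 1ℤ
  alt-double zero    = refl
  alt-double (suc a) = trans (cong alt (double-suc a)) (trans (neg-involutive (alt (a ℕ.+ a))) (alt-double a))

  X-period : ∀ t m → X (6 ℕ.* t ℕ.+ m) ≡ X m
  X-period t m = trans (cong (λ s → X (s ℕ.+ m)) (ℕ-lemma t)) (trans (X-antiperiod (t ℕ.+ t) m)
    (trans (cong (_* X m) (alt-double t)) (*-identityˡ (X m))))
    where
    ℕ-lemma : ∀ t → 6 ℕ.* t ≡ (t ℕ.+ t) ℕ.* 3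
    ℕ-lemma = ℕ-solve-∀

  X-odd : ∀ m m′ v → m ℕ.+ m′ ≡ 5 ℕ.+ 6 ℕ.* v → X m′ ≡ - X m
  X-odd zero          m′ v refl = trans (cong X (ℕ.+-comm 5 (6 ℕ.* v))) (X-period v 5)
  X-odd (suc zero)    m′ v eq   = trans (cong X (trans (ℕ.suc-injective eq) (ℕ.+-comm 4 (6 ℕ.* v)))) (X-period v 4)
  X-odd (suc (suc m)) m′ v eq   = trans (lemma₁ (X m′) (X (suc m′)))
    (trans (cong₂ (λ x y → - x - - y)
      (X-odd m (suc (suc m′)) v (trans (trans (ℕ.+-suc m (suc m′)) (cong suc (ℕ.+-suc m m′))) eq))
      (X-odd (suc m) (suc m′) v (trans (cong suc (ℕ.+-suc m m′)) eq)))
    (lemma₂ (X m) (X (suc m))))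
    where
    lemma₁ : ∀ x y → x ≡ - (y - x) - - y
    lemma₁ = solve-∀
    lemma₂ : ∀ x y → - - x - - - y ≡ - (y - x)
    lemma₂ = solve-∀

  -- multiplier is the residue of 5p modulo 6.
  record Residue : Set where
    field
      multiplier cofactor : ℕ
      multiplier-p : multiplier ℕ.* p ≡ 5 ℕ.+ 6 ℕ.* cofactor
      X-step   : ∀ m → X (multiplier ℕ.+ (multiplier ℕ.+ m)) ≡ X (multiplier ℕ.+ m) - X m
      X-N      : X (multiplier ℕ.* N) ≡ - alt N
      X-pred-N : X (multiplier ℕ.* pred N) ≡ - (+ 2 * alt N)

  -- Here p = 6s + 5. N = 3s + 2 has the parity of s, so the s sign changes of `X` amount to (-1)^N,
  -- and X(2) = -1 and X(1) = -2 agree with D(N) = 1 and D(N - 1) ≡ -2.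
  residue₅ : ∀ s → n ≡ s ℕ.* 3 → Residue
  residue₅ s n≡3s = record
    { multiplier = 1
    ; cofactor = s
    ; multiplier-p = trans (cong (λ n → 1 ℕ.* (5 ℕ.+ (n ℕ.+ n))) n≡3s) (ℕ-lemma s)
    ; X-step = λ m → refl
    ; X-N = trans (cong X (trans (ℕ.*-identityˡ N) N≡)) (trans (X-antiperiod s 2) (trans (cong (_* - 1ℤ) altN) (lemma₁ (alt N))))
    ; X-pred-N = trans (cong X (trans (ℕ.*-identityˡ (pred N)) (trans (cong pred N≡) (cong pred (ℕ.+-comm (s ℕ.* 3) 2)))))
        (trans (cong X (ℕ.+-comm 1 (s ℕ.* 3))) (trans (X-antiperiod s 1) (trans (cong (_* - + 2) altN) (lemma₂ (alt N)))))
    }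
    where
    ℕ-lemma : ∀ s → 1 ℕ.* (5 ℕ.+ (s ℕ.* 3 ℕ.+ s ℕ.* 3)) ≡ 5 ℕ.+ 6 ℕ.* s
    ℕ-lemma = ℕ-solve-∀
    ℕ-lemma₂ : ∀ s → s ℕ.* 3 ℕ.+ 2 ≡ s ℕ.+ ((1 ℕ.+ s) ℕ.+ (1 ℕ.+ s))
    ℕ-lemma₂ = ℕ-solve-∀
    lemma₁ : ∀ x → x * - 1ℤ ≡ - x
    lemma₁ = solve-∀
    lemma₂ : ∀ x → x * - + 2 ≡ - (+ 2 * x)
    lemma₂ = solve-∀
    N≡ : N ≡ s ℕ.* 3 ℕ.+ 2
    N≡ = trans N≡2+n (trans (cong (2 ℕ.+_) n≡3s) (ℕ.+-comm 2 (s ℕ.* 3)))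
    altN : alt s ≡ alt N
    altN = sym (trans (cong alt (trans N≡ (ℕ-lemma₂ s))) (trans (alt-+ s ((1 ℕ.+ s) ℕ.+ (1 ℕ.+ s)))
      (trans (cong (alt s *_) (alt-double (1 ℕ.+ s))) (*-identityʳ (alt s)))))

  -- Here p = 6s + 7, so the multiplier is 5 ≡ -1 modulo 6 and runs through `X` backwards; the
  -- recurrence X(m + 2) - X(m + 1) + X(m) = 0 is invariant under this reversal.
  residue₁ : ∀ s → n ≡ 1 ℕ.+ s ℕ.* 3 → Residue
  residue₁ s n≡1+3s = record
    { multiplier = 5
    ; cofactor = 5 ℕ.+ 5 ℕ.* s
    ; multiplier-p = trans (cong (λ n → 5 ℕ.* (5 ℕ.+ (n ℕ.+ n))) n≡1+3s) (ℕ-lemma₁ s)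
    ; X-step = lemma₀
    ; X-N = trans (cong X (trans (cong (5 ℕ.*_) N≡) (ℕ-lemma₂ s))) (trans (X-antiperiod (5 ℕ.* (1 ℕ.+ s)) 0) (trans (cong (_* - 1ℤ)
        (trans (cong alt (ℕ-lemma₄ s)) (altN ((1 ℕ.+ s) ℕ.+ (1 ℕ.+ s))))) (lemma₁ (alt N))))
    ; X-pred-N = trans (cong X (trans (cong (λ N → 5 ℕ.* pred N) N≡) (ℕ-lemma₃ s))) (trans (X-antiperiod (3 ℕ.+ 5 ℕ.* s) 1) (trans (cong (_* - + 2)
        (trans (cong alt (ℕ-lemma₅ s)) (altN (1 ℕ.+ (s ℕ.+ s))))) (lemma₂ (alt N))))
    }
    where
    ℕ-lemma₁ : ∀ s → 5 ℕ.* (5 ℕ.+ (1 ℕ.+ s ℕ.* 3 ℕ.+ (1 ℕ.+ s ℕ.* 3))) ≡ 5 ℕ.+ 6 ℕ.* (5 ℕ.+ 5 ℕ.* s)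
    ℕ-lemma₁ = ℕ-solve-∀
    ℕ-lemma₂ : ∀ s → 5 ℕ.* (3 ℕ.+ s ℕ.* 3) ≡ (5 ℕ.* (1 ℕ.+ s)) ℕ.* 3 ℕ.+ 0
    ℕ-lemma₂ = ℕ-solve-∀
    ℕ-lemma₃ : ∀ s → 5 ℕ.* (2 ℕ.+ s ℕ.* 3) ≡ (3 ℕ.+ 5 ℕ.* s) ℕ.* 3 ℕ.+ 1
    ℕ-lemma₃ = ℕ-solve-∀
    ℕ-lemma₄ : ∀ s → 5 ℕ.* (1 ℕ.+ s) ≡ (1 ℕ.+ s) ℕ.+ (((1 ℕ.+ s) ℕ.+ (1 ℕ.+ s)) ℕ.+ ((1 ℕ.+ s) ℕ.+ (1 ℕ.+ s)))
    ℕ-lemma₄ = ℕ-solve-∀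
    ℕ-lemma₅ : ∀ s → 3 ℕ.+ 5 ℕ.* s ≡ (1 ℕ.+ s) ℕ.+ ((1 ℕ.+ (s ℕ.+ s)) ℕ.+ (1 ℕ.+ (s ℕ.+ s)))
    ℕ-lemma₅ = ℕ-solve-∀
    ℕ-lemma₆ : ∀ s → 3 ℕ.+ s ℕ.* 3 ≡ (1 ℕ.+ s) ℕ.+ ((1 ℕ.+ s) ℕ.+ (1 ℕ.+ s))
    ℕ-lemma₆ = ℕ-solve-∀
    lemma₃ : ∀ x y → x ≡ y - (y - x)
    lemma₃ = solve-∀
    lemma₀ : ∀ m → X (10 ℕ.+ m) ≡ X (5 ℕ.+ m) - X m
    lemma₀ m = trans (X-period 1 (4 ℕ.+ m)) (trans (lemma₃ (X (4 ℕ.+ m)) (X (5 ℕ.+ m))) (cong (λ x → X (5 ℕ.+ m) - x) (X-period 1 m)))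
    lemma₁ : ∀ x → x * - 1ℤ ≡ - x
    lemma₁ = solve-∀
    lemma₂ : ∀ x → x * - + 2 ≡ - (+ 2 * x)
    lemma₂ = solve-∀
    N≡ : N ≡ 3 ℕ.+ s ℕ.* 3
    N≡ = trans N≡2+n (cong (2 ℕ.+_) n≡1+3s)
    drop-even : ∀ a b → alt (a ℕ.+ (b ℕ.+ b)) ≡ alt a
    drop-even a b = trans (alt-+ a (b ℕ.+ b)) (trans (cong (alt a *_) (alt-double b)) (*-identityʳ (alt a)))
    altN : ∀ b → alt ((1 ℕ.+ s) ℕ.+ (b ℕ.+ b)) ≡ alt N
    altN b = trans (drop-even (1 ℕ.+ s) b) (sym (trans (cong alt (trans N≡ (ℕ-lemma₆ s))) (drop-even (1 ℕ.+ s) (1 ℕ.+ s))))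

  residue : Residue
  residue = by-cases (n ℕ./ 3) (n ℕ.% 3) (m%n<n n 3) (m≡m%n+[m/n]*n n 3)
    where
    ℕ-lemma : ∀ s → 5 ℕ.+ (2 ℕ.+ s ℕ.* 3 ℕ.+ (2 ℕ.+ s ℕ.* 3)) ≡ (3 ℕ.+ (s ℕ.+ s)) ℕ.* 3
    ℕ-lemma = ℕ-solve-∀
    by-cases : ∀ s r → r ℕ.< 3 → n ≡ r ℕ.+ s ℕ.* 3 → Residue
    by-cases s 0 _ eq = residue₅ s eq
    by-cases s 1 _ eq = residue₁ s eq
    -- n = 3s + 2 would make p = 3(2s + 3), which is not prime.
    by-cases s 2 _ eq with prime⇒irreducible prime {3} (divides (3 ℕ.+ (s ℕ.+ s)) (trans (cong (λ n → 5 ℕ.+ (n ℕ.+ n)) eq) (ℕ-lemma s)))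
    ... | inj₁ ()
    ... | inj₂ ()
    by-cases s (suc (suc (suc r))) (s≤s (s≤s (s≤s ()))) eq

  open Residue residue public

  -- It continues -(-1)^a D(a) modulo p from 0 < a ≤ N to all a, in such a way that a ↦ p - a
  -- changes the sign.
  χ : ℕ → ℤ
  χ a = X (multiplier ℕ.* a)

  χ-step : ∀ a → χ (suc (suc a)) ≡ χ (suc a) - χ a
  χ-step a = trans (cong X (trans (ℕ.*-suc multiplier (suc a)) (cong (multiplier ℕ.+_) (ℕ.*-suc multiplier a))))
    (trans (X-step (multiplier ℕ.* a)) (cong (λ m → X m - χ a) (sym (ℕ.*-suc multiplier a))))

  χ-odd : ∀ {a} → a ℕ.≤ p → χ (p ℕ.∸ a) ≡ - χ a
  χ-odd {a} a≤p = X-odd (multiplier ℕ.* a) (multiplier ℕ.* (p ℕ.∸ a)) cofactor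
    (trans (sym (ℕ.*-distribˡ-+ multiplier a (p ℕ.∸ a))) (trans (cong (multiplier ℕ.*_) (ℕ.m+[n∸m]≡n a≤p)) multiplier-p))

  -- Modulo 6 the multiplier is -1/p, so a ≡ -f p gives multiplier · a ≡ f. In the application a and
  -- f are the remainder and the quotient of 6c by p.
  χ-quotient : ∀ a f c → a ℕ.+ f ℕ.* p ≡ 6 ℕ.* c → χ a ≡ X f
  χ-quotient a f c eq = trans (sym (X-period ((1 ℕ.+ cofactor) ℕ.* f) (multiplier ℕ.* a)))
    (trans (cong X ℕ-eq) (X-period (multiplier ℕ.* c) f))
    where
    ℕ-lemma₁ : ∀ v f ma → 6 ℕ.* ((1 ℕ.+ v) ℕ.* f) ℕ.+ ma ≡ ma ℕ.+ f ℕ.* (5 ℕ.+ 6 ℕ.* v) ℕ.+ f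
    ℕ-lemma₁ = ℕ-solve-∀
    ℕ-lemma₂ : ∀ m f a p → m ℕ.* a ℕ.+ f ℕ.* (m ℕ.* p) ℕ.+ f ≡ m ℕ.* (a ℕ.+ f ℕ.* p) ℕ.+ f
    ℕ-lemma₂ = ℕ-solve-∀
    ℕ-lemma₃ : ∀ m f c → m ℕ.* (6 ℕ.* c) ℕ.+ f ≡ 6 ℕ.* (m ℕ.* c) ℕ.+ f
    ℕ-lemma₃ = ℕ-solve-∀
    ℕ-eq : 6 ℕ.* ((1 ℕ.+ cofactor) ℕ.* f) ℕ.+ multiplier ℕ.* a ≡ 6 ℕ.* (multiplier ℕ.* c) ℕ.+ f
    ℕ-eq = trans (ℕ-lemma₁ cofactor f (multiplier ℕ.* a))
      (trans (cong (λ m → multiplier ℕ.* a ℕ.+ f ℕ.* m ℕ.+ f) (sym multiplier-p))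
      (trans (ℕ-lemma₂ multiplier f a p) (trans (cong (λ m → multiplier ℕ.* m ℕ.+ f) eq) (ℕ-lemma₃ multiplier f c))))

  -- Induction on d = N - b, downwards from N because D is known at N and N - 1. The alternating
  -- sign turns D(b + 2) + D(b + 1) + D(b) ≡ 0 into the recurrence of χ.
  odd-sum-χ : ∀ d b → 0 ℕ.< b → b ℕ.+ d ≡ N → - alt b * odd-sum b ≈ χ b
  odd-sum-χ zero b 0<b eq = ≈-trans (≡⇒≈ (cong (λ b → - alt b * odd-sum b) b≡N))
    (≡⇒≈ (trans (cong (- alt N *_) odd-sum-N) (trans (*-identityʳ (- alt N)) (trans (sym X-N) (cong χ (sym b≡N))))))
    where b≡N = trans (sym (ℕ.+-identityʳ b)) eq
  odd-sum-χ (suc zero) b 0<b eq = begin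
    - alt b * odd-sum b ≈⟨ *ˡ (- alt b) (odd-sum-pred-N b+1≡N 0<b) ⟩
    - alt b * - + 2 ≡⟨ lemma (alt b) ⟩
    - (+ 2 * - alt b) ≡⟨ cong (λ s → - (+ 2 * alt s)) b+1≡N ⟩
    - (+ 2 * alt N) ≡⟨ X-pred-N ⟨
    χ (pred N) ≡⟨ cong (λ s → χ (pred s)) b+1≡N ⟨
    χ b                        ∎
    where
    b+1≡N = trans (ℕ.+-comm 1 b) eq
    lemma : ∀ s → - s * - + 2 ≡ - (+ 2 * - s)
    lemma = solve-∀
  odd-sum-χ (suc (suc d)) b 0<b eq = begin
    - alt b * odd-sum b
      ≡⟨ lemma₁ (alt b) (odd-sum b) (odd-sum (suc b)) (odd-sum (suc (suc b))) ⟩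
    - - alt b * odd-sum (suc b) - - - - alt b * odd-sum (suc (suc b)) - alt b * (odd-sum (suc (suc b)) + odd-sum (suc b) + odd-sum b)
      ≈⟨ sub-cong (sub-cong (odd-sum-χ (suc d) (suc b) (s≤s z≤n) eq₁) (odd-sum-χ d (suc (suc b)) (s≤s z≤n) eq₂))
           (*ˡ (alt b) (odd-sum-interior b 0<b (subst (suc (suc b) ℕ.≤_) eq₂ (ℕ.m≤m+n (suc (suc b)) d)))) ⟩
    χ (suc b) - χ (suc (suc b)) - alt b * 0ℤ
      ≡⟨ cong (λ x → χ (suc b) - x - alt b * 0ℤ) (χ-step b) ⟩
    χ (suc b) - (χ (suc b) - χ b) - alt b * 0ℤ
      ≡⟨ lemma₂ (χ (suc b)) (χ b) (alt b) ⟩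
    χ b ∎
    where
    eq₁ : suc b ℕ.+ suc d ≡ N
    eq₁ = trans (sym (ℕ.+-suc b (suc d))) eq
    eq₂ : suc (suc b) ℕ.+ d ≡ N
    eq₂ = trans (sym (cong suc (ℕ.+-suc b d))) eq₁
    lemma₁ : ∀ s x y z → - s * x ≡ - - s * y - - - - s * z - s * (z + y + x)
    lemma₁ = solve-∀
    lemma₂ : ∀ x y s → x - (x - y) - s * 0ℤ ≡ y
    lemma₂ = solve-∀

  fifth : ℕ → ℤ
  fifth a = q a * q a * ι a

  -- χ(a) and 1/a⁵ are both odd under a ↦ p - a, so their product is even and twice the sum up to N
  -- is the sum over all a < p.
  weighted-single-χ : weighted-single ≈ Sum P (λ a → χ a * fifth a)
  weighted-single-χ = begin
    weighted-single
      ≈⟨ weighted-single-odd-sum ⟩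
    Sum N (λ a → + 2 * (- alt a * odd-sum a) * fifth a)
      ≈⟨ Sum-≈ N (λ b b<N → ≈-trans (*ʳ (fifth (suc b)) (*ˡ (+ 2) (odd-sum-χ (N ℕ.∸ suc b) (suc b) (s≤s z≤n) (ℕ.m+[n∸m]≡n b<N))))
           (≈-trans (≡⇒≈ (lemma₁ (χ (suc b)) (fifth (suc b)))) (+ˡ (G (suc b)) (≈-sym (upper b b<N))))) ⟩
    Sum N (λ a → G a + G (N ℕ.+ (suc N ℕ.∸ a)))
      ≡⟨ trans (Sum-+ N G _) (cong (_+_ (Sum N G)) (sym (Sum-reverse N (λ i → G (N ℕ.+ i))))) ⟩
    Sum N G + Sum N (λ i → G (N ℕ.+ i))
      ≡⟨ trans (sym (Sum-++ N N G)) (cong (λ s → Sum s G) (sym P≡2N)) ⟩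
    Sum P G ∎
    where
    G : ℕ → ℤ
    G a = χ a * fifth a
    lemma₁ : ∀ x y → + 2 * x * y ≡ x * y + x * y
    lemma₁ = solve-∀
    lemma₂ : ∀ x v → - x * (- v * - v * (- v * - v) * - v) ≡ x * (v * v * (v * v) * v)
    lemma₂ = solve-∀
    upper : ∀ b → b ℕ.< N → G (N ℕ.+ (suc N ℕ.∸ suc b)) ≈ G (suc b)
    upper b b<N = begin
      G (N ℕ.+ (suc N ℕ.∸ suc b)) ≡⟨ cong G (trans (sym (ℕ.+-∸-assoc N (ℕ.<⇒≤ b<N))) (cong (ℕ._∸ suc b) (sym p≡1+2N))) ⟩
      χ (p ℕ.∸ suc b) * fifth (p ℕ.∸ suc b)
        ≈⟨ *-cong (≡⇒≈ (χ-odd (ℕ.<⇒≤ (ℕ.≤-<-trans b<N N<p)))) (*-cong (*-cong (*-cong v v) (*-cong v v)) v) ⟩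
      - χ (suc b) * (- ι (suc b) * - ι (suc b) * (- ι (suc b) * - ι (suc b)) * - ι (suc b))
        ≡⟨ lemma₂ (χ (suc b)) (ι (suc b)) ⟩
      G (suc b)                         ∎
      where
      v : ι (p ℕ.∸ suc b) ≈ - ι (suc b)
      v = ι-reflect (ℕ.<-≤-trans b<N (subst (N ℕ.≤_) (sym P≡2N) (ℕ.m≤m+n N N)))

-- Voronoi's congruence and the value of E.

module Voronoi (n : ℕ) (prime : Prime (5 ℕ.+ (n ℕ.+ n))) (0<n : 0 ℕ.< n) where

  open import Data.Integer.Base using (_+_; _-_; _*_; -_; _^_)
  open import Data.Integer.Properties hiding (module ≤-Reasoning; ≤-refl)
  open IntegerSums
  open Binomials
  open PrimeField n prime
  open import Data.Fin.Base using (Fin; zero; suc; toℕ; fromℕ<)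
  open import Data.Fin.Permutation using (Permutation′; permutation)
  open import Data.Fin.Properties using (toℕ-injective; toℕ<n; toℕ-fromℕ<)
  open import Data.Integer.Divisibility.Signed as ℤ using (∣⇒∣ᵤ)
  open import Data.Nat.Divisibility using (_∣_; >⇒∤)
  open import Algebra.Properties.CommutativeMonoid.Sum +-0-commutativeMonoid using (sum; sum-permute; sum-cong-≗)
  open import Defs
  open CentralSums n prime
  open Residues n prime
  open PowerSeries n prime
  open BernoulliMod n prime
  open HarmonicSums n prime 0<n using (Sum-power′; powerSum-Sum′)
  open PeriodicCharacter n prime
  open import Relation.Binary.Reasoning.Setoid ≈-setoid

  module C₂ = Congruence (+ p * + p)

  -- p - 6, the exponent in Voronoi's congruence for B_(p - 5); for a unit a, a^K ≡ 1/a⁵.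
  K : ℕ
  K = pred k

  k≡1+K : k ≡ suc K
  k≡1+K = sym (ℕ.suc-pred k {{ℕ.>-nonZero (ℕ.≤-trans 0<n (ℕ.m≤m+n n n))}})

  0<k : 0 ℕ.< k
  0<k = ℕ.≤-trans 0<n (ℕ.m≤m+n n n)

  0<K : 0 ℕ.< K
  0<K = ℕ.pred-mono-≤ (ℕ.+-mono-≤ 0<n 0<n)

  abstract
    remainder quotient : ℕ → ℕ → ℕ
    remainder d c = (d ℕ.* c) ℕ.% p
    quotient d c = (d ℕ.* c) ℕ./ p

    remainder-quotient : ∀ d c → remainder d c ℕ.+ quotient d c ℕ.* p ≡ d ℕ.* c
    remainder-quotient d c = sym (m≡m%n+[m/n]*n (d ℕ.* c) p)

    remainder<p : ∀ d c → remainder d c ℕ.< p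
    remainder<p d c = m%n<n (d ℕ.* c) p

    quotient-factor : ∀ d e .{{_ : NonZero e}} c → quotient (d ℕ.* e) c ℕ./ e ≡ quotient d c
    quotient-factor d e c = trans (m/n/o≡m/[n*o] (d ℕ.* e ℕ.* c) p e {{_}} {{_}} {{ℕ.m*n≢0 p e}})
      (trans (cong (λ m → (m ℕ./ (p ℕ.* e)) {{ℕ.m*n≢0 p e}}) (lemma d e c)) (m*n/o*n≡m/o (d ℕ.* c) e p {{_}} {{ℕ.m*n≢0 p e}}))
      where
      lemma : ∀ d e c → d ℕ.* e ℕ.* c ≡ d ℕ.* c ℕ.* e
      lemma = ℕ-solve-∀

    quotient< : ∀ d {c} → 0 ℕ.< d → c ℕ.< p → quotient d c ℕ.< d
    quotient< d@(suc _) 0<d c<p = m<n*o⇒m/o<n (ℕ.*-monoʳ-< d c<p)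

  remainder-≈ : ∀ d c → + remainder d c ≈ + d * + c
  remainder-≈ d c = begin
    + remainder d c
      ≡⟨ lemma (+ remainder d c) (+ p * + quotient d c) ⟩
    + remainder d c + + p * + quotient d c - + p * + quotient d c
      ≡⟨ cong (λ x → + remainder d c + x - + p * + quotient d c) (trans (sym (pos-* p (quotient d c))) (cong +_ (ℕ.*-comm p (quotient d c)))) ⟩
    + remainder d c + + (quotient d c ℕ.* p) - + p * + quotient d c
      ≡⟨ cong (_- + p * + quotient d c) (trans (sym (pos-+ (remainder d c) _)) (trans (cong +_ (remainder-quotient d c)) (pos-* d c))) ⟩
    + d * + c - + p * + quotient d c
      ≈⟨ +ˡ (+ d * + c) (neg-cong (multiple (+ quotient d c))) ⟩
    + d * + c - 0ℤ
      ≡⟨ +-identityʳ (+ d * + c) ⟩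
    + d * + c ∎
    where
    lemma : ∀ x y → x ≡ x + y - y
    lemma = solve-∀

  private
    ≈⇒≤ : ∀ {a b} → a ℕ.< p → + a ≈ + b → a ℕ.≤ b
    ≈⇒≤ {a} {b} a<p (congruent t eq) with ℕ.≤-total a b
    ... | inj₁ a≤b = a≤b
    ... | inj₂ b≤a = ℕ.m∸n≡0⇒m≤n (zero-multiple (a ℕ.∸ b) (ℕ.≤-<-trans (ℕ.m∸n≤m a b) a<p)
        (∣⇒∣ᵤ {+ p} {+ (a ℕ.∸ b)} (ℤ.divides t difference)))
      where
      zero-multiple : ∀ m → m ℕ.< p → p ∣ m → m ≡ 0
      zero-multiple zero    _   _   = refl
      zero-multiple (suc m) m<p p∣m = contradiction p∣m (>⇒∤ m<p)
      lemma : ∀ b p t → b + p * t - b ≡ t * p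
      lemma = solve-∀
      difference : + (a ℕ.∸ b) ≡ t * + p
      difference = trans (sym (⊖-≥ b≤a)) (trans (sym (m-n≡m⊖n a b)) (trans (cong (_- + b) eq) (lemma (+ b) (+ p) t)))

    ≈⇒≡ : ∀ {a b} → a ℕ.< p → b ℕ.< p → + a ≈ + b → a ≡ b
    ≈⇒≡ a<p b<p a≈b = ℕ.≤-antisym (≈⇒≤ a<p a≈b) (≈⇒≤ b<p (≈-sym a≈b))

    remainder-inverse : ∀ d e {c} → + d * + e ≈ 1ℤ → c ℕ.< p → remainder d (remainder e c) ≡ c
    remainder-inverse d e {c} de≈1 c<p = ≈⇒≡ (remainder<p d (remainder e c)) c<p (begin
      + remainder d (remainder e c) ≈⟨ remainder-≈ d (remainder e c) ⟩
      + d * + remainder e c ≈⟨ *ˡ (+ d) (remainder-≈ e c) ⟩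
      + d * (+ e * + c) ≡⟨ *-assoc (+ d) (+ e) (+ c) ⟨
      + d * + e * + c ≈⟨ *ʳ (+ c) de≈1 ⟩
      1ℤ * + c ≡⟨ *-identityˡ (+ c) ⟩
      + c                             ∎)

    remainder-permutation : ∀ d e → + d * + e ≈ 1ℤ → Permutation′ p
    remainder-permutation d e de≈1 = permutation (map d) (map e)
      (inverse d e de≈1) (inverse e d (≈-trans (≡⇒≈ (*-comm (+ e) (+ d))) de≈1))
      where
      map : ℕ → Fin p → Fin p
      map d i = fromℕ< (remainder<p d (toℕ i))
      inverse : ∀ d e → + d * + e ≈ 1ℤ → ∀ i → map d (map e i) ≡ i
      inverse d e eq i = toℕ-injective (trans (toℕ-fromℕ< _) (trans (cong (remainder d) (toℕ-fromℕ< _)) (remainder-inverse d e eq (toℕ<n i))))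

    sum-Fin : ∀ m (f : ℕ → ℤ) → sum {m} (λ i → f (suc (toℕ i))) ≡ Sum m f
    sum-Fin zero    f = refl
    sum-Fin (suc m) f = trans (cong (_+_ (f 1)) (sum-Fin m (λ i → f (suc i)))) (sym (Sum-head m f))

  -- Multiplication by the unit d permutes all p residues, its inverse being multiplication by d^(p
  -- - 2). The residue 0 is fixed and is cancelled from both sides.
  Sum-remainder : ∀ d → Unit (+ d) → ∀ f → Sum P (λ c → f (remainder d c)) ≡ Sum P f
  Sum-remainder d u f = ∙-cancelˡ (f 0) (Sum P (λ c → f (remainder d c))) (Sum P f) (trans (cong (_+ Sum P (λ c → f (remainder d c))) (cong f (sym remainder-0)))
    (trans (sym (split (λ c → f (remainder d c)))) (trans (sym permuted) (split f))))
    where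
    open import Algebra.Properties.AbelianGroup +-0-abelianGroup using (∙-cancelˡ)
    e : ℕ
    e = d ℕ.^ (3 ℕ.+ k)
    de≈1 : + d * + e ≈ 1ℤ
    de≈1 = ≈-trans (≡⇒≈ (cong (+ d *_) (trans (pos-^ d (3 ℕ.+ k)) (sym (ι-power d))))) (*-ι u)
    split : ∀ g → sum {p} (λ i → g (toℕ i)) ≡ g 0 + Sum P g
    split g = cong (_+_ (g 0)) (trans (sum-Fin (4 ℕ.+ k) g) (cong (λ m → Sum m g) (sym P≡4+k)))
    permuted : sum {p} (λ i → f (toℕ i)) ≡ sum {p} (λ i → f (remainder d (toℕ i)))
    permuted = trans (sum-permute {p} {p} (λ i → f (toℕ i)) (remainder-permutation d e de≈1))
      (sum-cong-≗ {p} (λ i → cong f (toℕ-fromℕ< (remainder<p d (toℕ i)))))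
    remainder-0 : remainder d 0 ≡ 0
    remainder-0 = ≈⇒≡ (remainder<p d 0) (s≤s z≤n) (≈-trans (remainder-≈ d 0) (≡⇒≈ (*-zeroʳ (+ d))))

  p²-power : ∀ x y m → (x - + p * y) ^ suc m C₂.≈ x ^ suc m - + suc m * + p * y * x ^ m
  p²-power x y zero = C₂.≡⇒≈ (lemma x (+ p) y)
    where
    lemma : ∀ x p y → (x - p * y) * 1ℤ ≡ x * 1ℤ - 1ℤ * p * y * 1ℤ
    lemma = solve-∀
  p²-power x y (suc m) = step (p²-power x y m)
    where
    lemma : ∀ x p y s X t → (x - p * y) * (x * X - s * p * y * X + p * p * t)
      ≡ x * (x * X) - (s + 1ℤ) * p * y * (x * X) + p * p * (s * y * y * X + (x - p * y) * t)
    lemma = solve-∀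
    step : (x - + p * y) ^ suc m C₂.≈ x ^ suc m - + suc m * + p * y * x ^ m →
           (x - + p * y) ^ suc (suc m) C₂.≈ x ^ suc (suc m) - + suc (suc m) * + p * y * x ^ suc m
    step (C₂.congruent t eq) = C₂.congruent _ (trans (cong ((x - + p * y) *_) eq)
      (trans (lemma x (+ p) y (+ suc m) (x ^ m) t)
      (cong (λ s → x * (x * x ^ m) - s * + p * y * (x * x ^ m) + + p * + p * (+ suc m * y * y * x ^ m + (x - + p * y) * t)) (sym (pos-suc (suc m))))))

  ^-distribʳ : ∀ x y m → (x * y) ^ m ≡ x ^ m * y ^ m
  ^-distribʳ x y zero    = refl
  ^-distribʳ x y (suc m) = trans (cong ((x * y) *_) (^-distribʳ x y m)) (lemma x y (x ^ m) (y ^ m))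
    where
    lemma : ∀ x y u v → (x * y) * (u * v) ≡ (x * u) * (y * v)
    lemma = solve-∀

  -- Q is the integer (1^k + ⋯ + (p−1)^k) / p; its residue needs the power sum modulo p².
  record PowerQuotient : Set where
    field
      Q : ℤ
      power-sum : Sum P (λ c → (+ c) ^ k) ≡ + p * Q
      Q≈bernoulli : Q ≈ bernoulliₚ

  -- Every coefficient of e^(px) - 1 has a factor p, so Faulhaber's formula can be divided by p
  -- before it is reduced. What remains is the product of β with `reduced`, the series (e^(px) -
  -- 1)/(px), of which only the constant term 1 survives modulo p; hence Q ≡ k! β(k).
  power-quotient : PowerQuotient
  power-quotient = from (powerSum-p k k+2<p)
    where
    open +-*-Solver using (solve; con; _:+_; _:*_; _:-_; :-_; _:=_)
    k+2<p : suc (suc k) ℕ.< p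
    k+2<p = ℕ.m≤n+m (3 ℕ.+ k) 2
    reduced : Series
    reduced j = ⟦ (+ p) ^ j ⟧ ℚ.* 1/! (suc j)
    reduced-exp : ∀ j → exp-1 p (suc j) ≡ (⟦ + p ⟧ · reduced) j
    reduced-exp j = trans (cong (ℚ._* 1/! (suc j)) (⟦⟧-* (+ p) ((+ p) ^ j))) (ℚ.*-assoc ⟦ + p ⟧ ⟦ (+ p) ^ j ⟧ (1/! (suc j)))
    ·-right : ∀ c f g m → (f ⊛ (c · g)) m ≡ c ℚ.* (f ⊛ g) m
    ·-right c f g m = trans (⊛-comm f (c · g) m) (trans (⊛-scale c g f m) (cong (c ℚ.*_) (⊛-comm g f m)))
    rational : ⟦ powerSum k p ⟧ ℚ.* 1/! k ≡ ⟦ + p ⟧ ℚ.* (β ⊛ reduced) k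
    rational = trans (sym (faulhaber k p)) (trans (⊛-last β (exp-1 p) k) (trans (cong ((β ⊛ tail (exp-1 p)) k ℚ.+_) (ℚ.*-zeroʳ (β (suc k))))
      (trans (ℚ.+-identityʳ ((β ⊛ tail (exp-1 p)) k)) (trans (⊛-congˡ β {tail (exp-1 p)} {⟦ + p ⟧ · reduced} k reduced-exp) (·-right ⟦ + p ⟧ β reduced k)))))
    reducedₚ : ℕ → ℤ
    reducedₚ j = (+ p) ^ j * ι (suc j !)
    reduced-∼ : (β ⊛ reduced) k ∼ βₚ k
    reduced-∼ = ∼-≈ (⊛-∼ {β} {reduced} k (λ i i≤k → ∼-res (β-integral i (ℕ.≤-<-trans (s≤s i≤k) k+1<p)))
        (λ i i≤k → ∼-* (∼-⟦⟧ ((+ p) ^ i)) (1/!-∼ (suc i) (ℕ.≤-<-trans (s≤s i≤k) k+1<p))))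
      (≈-trans (conv-spike βₚ reducedₚ 0 k (λ _ ()) (λ j _ → high j))
      (≈-trans (*ˡ (βₚ k) (≈-trans (≡⇒≈ (*-identityˡ (ι 1))) (≈-sym (ι-unique unit-1 ≈-refl)))) (≡⇒≈ (*-identityʳ (βₚ k)))))
      where
      high : ∀ j → reducedₚ (suc j) ≈ 0ℤ
      high j = ≈-trans (≡⇒≈ (*-assoc (+ p) ((+ p) ^ j) (ι (suc (suc j) !)))) (multiple ((+ p) ^ j * ι (suc (suc j) !)))
    from : powerSum k p ≈ 0ℤ → PowerQuotient
    from (congruent Q eq) = record
      { Q = Q
      ; power-sum = trans (sym (powerSum-Sum′ k P 0<k)) (trans (cong (powerSum k) suc-P) eq′)
      ; Q≈bernoulli = ∼-unique (subst (_∼ Q) value (∼-⟦⟧ Q)) (∼-* (∼-⟦⟧ (+ (k !))) reduced-∼)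
      }
      where
      eq′ : powerSum k p ≡ + p * Q
      eq′ = trans eq (+-identityˡ (+ p * Q))
      value : ⟦ Q ⟧ ≡ ⟦ + (k !) ⟧ ℚ.* (β ⊛ reduced) k
      value = *-cancelˡ p (trans (sym (⟦⟧-* (+ p) Q)) (trans (cong ⟦_⟧ (sym eq′))
        (trans (sym (trans (cong (⟦ powerSum k p ⟧ ℚ.*_) (!-1/! k)) (ℚ.*-identityʳ ⟦ powerSum k p ⟧)))
        (trans (solve 3 (λ s f v → s :* (f :* v) := f :* (s :* v)) refl ⟦ powerSum k p ⟧ ⟦ + (k !) ⟧ (1/! k))
        (trans (cong (⟦ + (k !) ⟧ ℚ.*_) rational)
        (solve 3 (λ f p x → f :* (p :* x) := p :* (f :* x)) refl ⟦ + (k !) ⟧ ⟦ + p ⟧ ((β ⊛ reduced) k)))))))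

  open PowerQuotient power-quotient public

  quotient-sum : ℕ → ℤ
  quotient-sum d = Sum P (λ c → (+ c) ^ K * + quotient d c)

  -- From d c = r + p f, with r the remainder and f the quotient, r^k ≡ (d c)^k - k p f (d c)^(k -
  -- 1) modulo p². The remainders permute the residues, so both k-th power sums are p Q, and one
  -- factor p can be divided out.
  voronoi : ∀ d → Unit (+ d) → ((+ d) ^ k - 1ℤ) * Q ≈ + k * (+ d) ^ K * quotient-sum d
  voronoi d u = from (C₂.≈-trans (C₂.≡⇒≈ total) (C₂.≈-trans (C₂.Sum-≈ P term) (C₂.≡⇒≈ expand)))
    where
    D = + d
    S = Sum P (λ c → (+ c) ^ k)
    total : S ≡ Sum P (λ c → (+ remainder d c) ^ k)
    total = sym (Sum-remainder d u (λ c → (+ c) ^ k))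
    remainder-eq : ∀ c → + remainder d c ≡ D * + c - + p * + quotient d c
    remainder-eq c = trans (lemma (+ remainder d c) (+ quotient d c * + p)) (cong₂ _-_
      (trans (cong (_+_ (+ remainder d c)) (sym (pos-* (quotient d c) p))) (trans (sym (pos-+ (remainder d c) _)) (trans (cong +_ (remainder-quotient d c)) (pos-* d c))))
      (*-comm (+ quotient d c) (+ p)))
      where
      lemma : ∀ x y → x ≡ x + y - y
      lemma = solve-∀
    term : ∀ b → b ℕ.< P → (+ remainder d (suc b)) ^ k C₂.≈ D ^ k * (+ suc b) ^ k - + p * (+ k * D ^ K) * ((+ suc b) ^ K * + quotient d (suc b))
    term b _ = C₂.≈-trans (C₂.≡⇒≈ (trans (cong (_^ k) (remainder-eq c)) (cong ((D * + c - + p * + quotient d c) ^_) k≡1+K)))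
      (C₂.≈-trans (p²-power (D * + c) (+ quotient d c) K)
      (C₂.≡⇒≈ (cong₂ _-_ (trans (cong ((D * + c) ^_) (sym k≡1+K)) (^-distribʳ D (+ c) k))
        (trans (cong₂ (λ s x → s * + p * + quotient d c * x) (cong +_ (sym k≡1+K)) (^-distribʳ D (+ c) K))
               (lemma (+ k) (+ p) (+ quotient d c) (D ^ K) ((+ c) ^ K))))))
      where
      c = suc b
      lemma : ∀ k p f x y → k * p * f * (x * y) ≡ p * (k * x) * (y * f)
      lemma = solve-∀
    expand : Sum P (λ c → D ^ k * (+ c) ^ k - + p * (+ k * D ^ K) * ((+ c) ^ K * + quotient d c))
           ≡ D ^ k * S - + p * (+ k * D ^ K) * quotient-sum d
    expand = trans (Sum-sub P _ _) (cong₂ _-_ (Sum-*ˡ P (D ^ k) _) (Sum-*ˡ P (+ p * (+ k * D ^ K)) _))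
    lemma₁ : ∀ x p q y t → x * (p * q) - p * y + p * p * t ≡ p * (x * q - y + p * t)
    lemma₁ = solve-∀
    lemma₂ : ∀ x q y pt → (x - 1ℤ) * q ≡ y + pt * - 1ℤ + (x * q - y + pt - q)
    lemma₂ = solve-∀
    from : S C₂.≈ D ^ k * S - + p * (+ k * D ^ K) * quotient-sum d → (D ^ k - 1ℤ) * Q ≈ + k * D ^ K * quotient-sum d
    from (C₂.congruent t eq) = congruent (t * - 1ℤ) (trans (lemma₂ (D ^ k) Q Y (+ p * t))
      (trans (cong (_+_ (Y + + p * t * - 1ℤ)) (trans (cong (_- Q) (sym Q-eq)) (+-inverseʳ Q)))
      (trans (+-identityʳ _) (cong (_+_ Y) (*-assoc (+ p) t (- 1ℤ))))))
      where
      Y = + k * D ^ K * quotient-sum d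
      -- Every term of the congruence modulo p² carries a factor p; cancelling it turns the error p²
      -- t into p t.
      Q-eq : Q ≡ D ^ k * Q - Y + + p * t
      Q-eq = *-cancelˡ-≡ (+ p) Q _ (trans (sym power-sum) (trans eq
        (trans (cong₂ (λ s y → D ^ k * s - y + + p * + p * t) power-sum (*-assoc (+ p) (+ k * D ^ K) (quotient-sum d)))
        (lemma₁ (D ^ k) (+ p) Q Y t))))

  fifth-power : ∀ {a} → Unit (+ a) → fifth a ≈ (+ a) ^ K
  fifth-power {a} u = ≈-trans (≡⇒≈ (lemma (ι a))) (ι-^ 5 K u (cong (4 ℕ.+_) (sym k≡1+K)))
    where
    lemma : ∀ v → v * v * (v * v) * v ≡ v * (v * (v * (v * (v * 1ℤ))))
    lemma = solve-∀

  -- One period of `X` is -1 + f - (f mod 2) - (f mod 3). If f is the quotient of 6c by p, then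
  -- ⌊f/2⌋ and ⌊f/3⌋ are the quotients of 3c and 2c, so χ becomes a combination of three Voronoi
  -- sums.
  X-floor : ∀ f → f ℕ.< 6 → X f ≡ - 1ℤ - + f + + 2 * + (f ℕ./ 2) + + 3 * + (f ℕ./ 3)
  X-floor 0 _ = refl
  X-floor 1 _ = refl
  X-floor 2 _ = refl
  X-floor 3 _ = refl
  X-floor 4 _ = refl
  X-floor 5 _ = refl
  X-floor (suc (suc (suc (suc (suc (suc f)))))) (s≤s (s≤s (s≤s (s≤s (s≤s (s≤s ()))))))

  unit-2 : Unit (+ 2)
  unit-2 = unit-< {1} (s≤s (s≤s (s≤s z≤n)))

  unit-3 : Unit (+ 3)
  unit-3 = unit-< {2} (s≤s (s≤s (s≤s (s≤s z≤n))))

  unit-5 : Unit (+ 5)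
  unit-5 = unit-< {4} (ℕ.+-monoʳ-< 5 0<k)

  -- Substituting a ≡ 6c evaluates χ at the quotient of 6c by p, where `X-floor` applies. Its
  -- constant -1 contributes only -Σ c^K, which vanishes because 0 < K < p - 1.
  Sum-χ : Sum P (λ a → χ a * fifth a) ≈ (+ 6) ^ K * (- quotient-sum 6 + + 2 * quotient-sum 3 + + 3 * quotient-sum 2)
  Sum-χ = begin
    Sum P (λ a → χ a * fifth a)
      ≈⟨ Sum-≈ P (λ b b<P → *ˡ (χ (suc b)) (fifth-power (unit-≤P b<P))) ⟩
    Sum P (λ a → χ a * (+ a) ^ K)
      ≡⟨ Sum-remainder 6 (unit-* unit-2 unit-3) (λ a → χ a * (+ a) ^ K) ⟨
    Sum P (λ c → χ (remainder 6 c) * (+ remainder 6 c) ^ K)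
      ≈⟨ Sum-≈ P (λ b b<P → *-cong (≡⇒≈ (χ-value b b<P)) (≈-trans (^-cong K (remainder-≈ 6 (suc b))) (≡⇒≈ (^-distribʳ (+ 6) (+ suc b) K)))) ⟩
    Sum P (λ c → (- 1ℤ - + quotient 6 c + + 2 * + quotient 3 c + + 3 * + quotient 2 c) * ((+ 6) ^ K * (+ c) ^ K))
      ≡⟨ Sum-cong P (λ b _ → lemma₁ ((+ 6) ^ K) ((+ suc b) ^ K) (+ quotient 6 (suc b)) (+ quotient 3 (suc b)) (+ quotient 2 (suc b))) ⟩
    Sum P (λ c → (+ 6) ^ K * (- 1ℤ * (+ c) ^ K + - 1ℤ * G 6 c + + 2 * G 3 c + + 3 * G 2 c))
      ≡⟨ trans (Sum-*ˡ P ((+ 6) ^ K) _) (cong ((+ 6) ^ K *_) distribute) ⟩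
    (+ 6) ^ K * (- 1ℤ * Sum P (λ c → (+ c) ^ K) + - 1ℤ * quotient-sum 6 + + 2 * quotient-sum 3 + + 3 * quotient-sum 2)
      ≈⟨ *ˡ ((+ 6) ^ K) (+ʳ (+ 3 * quotient-sum 2) (+ʳ (+ 2 * quotient-sum 3) (+ʳ (- 1ℤ * quotient-sum 6) (*ˡ (- 1ℤ) (Sum-power′ K 0<K K+2<p))))) ⟩
    (+ 6) ^ K * (- 1ℤ * 0ℤ + - 1ℤ * quotient-sum 6 + + 2 * quotient-sum 3 + + 3 * quotient-sum 2)
      ≡⟨ lemma₂ ((+ 6) ^ K) (quotient-sum 6) (quotient-sum 3) (quotient-sum 2) ⟩
    (+ 6) ^ K * (- quotient-sum 6 + + 2 * quotient-sum 3 + + 3 * quotient-sum 2) ∎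
    where
    G : ℕ → ℕ → ℤ
    G d c = (+ c) ^ K * + quotient d c
    lemma₁ : ∀ s x f g h → (- 1ℤ - f + + 2 * g + + 3 * h) * (s * x) ≡ s * (- 1ℤ * x + - 1ℤ * (x * f) + + 2 * (x * g) + + 3 * (x * h))
    lemma₁ = solve-∀
    lemma₂ : ∀ s x y z → s * (- 1ℤ * 0ℤ + - 1ℤ * x + + 2 * y + + 3 * z) ≡ s * (- x + + 2 * y + + 3 * z)
    lemma₂ = solve-∀
    K+2<p : suc (suc K) ℕ.< p
    K+2<p = subst (λ m → suc m ℕ.< p) k≡1+K k+1<p
    c<p : ∀ b → b ℕ.< P → suc b ℕ.< p
    c<p b b<P = subst (suc b ℕ.<_) suc-P (s≤s b<P)
    χ-value : ∀ b → b ℕ.< P → χ (remainder 6 (suc b)) ≡ - 1ℤ - + quotient 6 (suc b) + + 2 * + quotient 3 (suc b) + + 3 * + quotient 2 (suc b)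
    χ-value b b<P = trans (χ-quotient (remainder 6 (suc b)) (quotient 6 (suc b)) (suc b) (remainder-quotient 6 (suc b)))
      (trans (X-floor (quotient 6 (suc b)) (quotient< 6 (s≤s z≤n) (c<p b b<P)))
      (cong₂ (λ g h → - 1ℤ - + quotient 6 (suc b) + + 2 * + g + + 3 * + h) (quotient-factor 3 2 (suc b)) (quotient-factor 2 3 (suc b))))
    distribute : Sum P (λ c → - 1ℤ * (+ c) ^ K + - 1ℤ * G 6 c + + 2 * G 3 c + + 3 * G 2 c)
      ≡ - 1ℤ * Sum P (λ c → (+ c) ^ K) + - 1ℤ * quotient-sum 6 + + 2 * quotient-sum 3 + + 3 * quotient-sum 2
    distribute = trans (Sum-+ P _ _) (cong₂ _+_ (trans (Sum-+ P _ _) (cong₂ _+_ (trans (Sum-+ P _ _)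
      (cong₂ _+_ (Sum-*ˡ P (- 1ℤ) _) (Sum-*ˡ P (- 1ℤ) _))) (Sum-*ˡ P (+ 2) _))) (Sum-*ˡ P (+ 3) _))

  unit-240 : Unit (+ 240)
  unit-240 = unit-* {+ 16} {+ 15} (unit-* {+ 4} {+ 4} (unit-* {+ 2} {+ 2} unit-2 unit-2) (unit-* {+ 2} {+ 2} unit-2 unit-2)) (unit-* {+ 3} {+ 5} unit-3 unit-5)

  private
    fourth-inverse : ∀ a → Unit (+ a) → (+ a) ^ 4 * (+ a) ^ k ≈ 1ℤ
    fourth-inverse a u = ≈-trans (≡⇒≈ (sym (^-distribˡ-+-* (+ a) 4 k))) (little-fermat u)

    k≈-5 : + k ≈ - + 5
    k≈-5 = ≈-trans (≡⇒≈ (lemma (+ k))) (+ʳ (- + 5) (≈-trans (≡⇒≈ (sym (pos-+ 5 k))) p≈0))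
      where
      lemma : ∀ x → x ≡ + 5 + x + - + 5
      lemma = solve-∀

    -- x and y are the inverses of a and b. Multiplying by a b turns x - 1 and y - 1 into 1 - a and
    -- 1 - b, after which the common factor c of the constants cancels.
    collect : ∀ {a b κ c d₁ d₂ x y E B} → a * b * κ ≡ c * d₁ → (1ℤ - a) * (1ℤ - b) ≡ c * d₂ → Unit c →
      a * x ≈ 1ℤ → b * y ≈ 1ℤ → κ * E ≈ (x - 1ℤ) * (y - 1ℤ) * B → d₁ * E ≈ d₂ * B
    collect {a} {b} {κ} {c} {d₁} {d₂} {x} {y} {E} {B} eq₁ eq₂ u ax≈1 by≈1 κE = cancel u (begin
      c * (d₁ * E) ≡⟨ trans (sym (*-assoc c d₁ E)) (cong (_* E) (sym eq₁)) ⟩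
      a * b * κ * E ≡⟨ *-assoc (a * b) κ E ⟩
      a * b * (κ * E) ≈⟨ *ˡ (a * b) κE ⟩
      a * b * ((x - 1ℤ) * (y - 1ℤ) * B) ≡⟨ lemma a b x y B ⟩
      (a * x - a) * (b * y - b) * B ≈⟨ *ʳ B (*-cong (+ʳ (- a) ax≈1) (+ʳ (- b) by≈1)) ⟩
      (1ℤ - a) * (1ℤ - b) * B ≡⟨ trans (cong (_* B) eq₂) (*-assoc c d₂ B) ⟩
      c * (d₂ * B)                                   ∎)
      where
      lemma : ∀ a b x y B → a * b * ((x - 1ℤ) * (y - 1ℤ) * B) ≡ (a * x - a) * (b * y - b) * B
      lemma = solve-∀

  -- With u = 2^k and v = 3^k, Voronoi's congruence supplies uv - 1, v - 1 and u - 1. The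
  -- coefficients 2 and 3 of `X-floor` complete 2^K and 3^K to u and v, and -(uv - 1) + u(v - 1) +
  -- v(u - 1) = (u - 1)(v - 1).
  k-weighted-single : + k * weighted-single ≈ ((+ 2) ^ k - 1ℤ) * ((+ 3) ^ k - 1ℤ) * bernoulliₚ
  k-weighted-single = begin
    + k * weighted-single
      ≈⟨ *ˡ (+ k) (≈-trans weighted-single-χ Sum-χ) ⟩
    + k * ((+ 6) ^ K * (- ν₆ + + 2 * ν₃ + + 3 * ν₂))
      ≡⟨ cong (λ s → + k * (s * (- ν₆ + + 2 * ν₃ + + 3 * ν₂))) s≡ ⟩
    + k * (x * y * (- ν₆ + + 2 * ν₃ + + 3 * ν₂))
      ≡⟨ lemma₁ (+ k) x y ν₂ ν₃ ν₆ ⟩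
    - (+ k * (x * y) * ν₆) + + 2 * x * (+ k * y * ν₃) + + 3 * y * (+ k * x * ν₂)
      ≈⟨ +-cong (+-cong (neg-cong (≈-trans (≡⇒≈ (cong (λ s → + k * s * ν₆) (sym s≡))) (≈-sym (voronoi 6 (unit-* unit-2 unit-3)))))
           (*ˡ (+ 2 * x) (≈-sym (voronoi 3 unit-3)))) (*ˡ (+ 3 * y) (≈-sym (voronoi 2 unit-2))) ⟩
    - (((+ 6) ^ k - 1ℤ) * Q) + + 2 * x * ((X₃ - 1ℤ) * Q) + + 3 * y * ((X₂ - 1ℤ) * Q)
      ≡⟨ cong (λ u → - ((u - 1ℤ) * Q) + + 2 * x * ((X₃ - 1ℤ) * Q) + + 3 * y * ((X₂ - 1ℤ) * Q)) (^-distribʳ (+ 2) (+ 3) k) ⟩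
    - ((X₂ * X₃ - 1ℤ) * Q) + + 2 * x * ((X₃ - 1ℤ) * Q) + + 3 * y * ((X₂ - 1ℤ) * Q)
      ≡⟨ cong₂ (λ u v → - ((X₂ * X₃ - 1ℤ) * Q) + u * ((X₃ - 1ℤ) * Q) + v * ((X₂ - 1ℤ) * Q)) (sym (power-k (+ 2))) (sym (power-k (+ 3))) ⟩
    - ((X₂ * X₃ - 1ℤ) * Q) + X₂ * ((X₃ - 1ℤ) * Q) + X₃ * ((X₂ - 1ℤ) * Q)
      ≡⟨ lemma₂ X₂ X₃ Q ⟩
    (X₂ - 1ℤ) * (X₃ - 1ℤ) * Q
      ≈⟨ *ˡ ((X₂ - 1ℤ) * (X₃ - 1ℤ)) Q≈bernoulli ⟩
    (X₂ - 1ℤ) * (X₃ - 1ℤ) * bernoulliₚ ∎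
    where
    x = (+ 2) ^ K
    y = (+ 3) ^ K
    X₂ = (+ 2) ^ k
    X₃ = (+ 3) ^ k
    ν₂ = quotient-sum 2
    ν₃ = quotient-sum 3
    ν₆ = quotient-sum 6
    s≡ : (+ 6) ^ K ≡ x * y
    s≡ = ^-distribʳ (+ 2) (+ 3) K
    power-k : ∀ a → a ^ k ≡ a * a ^ K
    power-k a = cong (a ^_) k≡1+K
    lemma₁ : ∀ k x y a b c → k * (x * y * (- c + + 2 * b + + 3 * a))
      ≡ - (k * (x * y) * c) + + 2 * x * (k * y * b) + + 3 * y * (k * x * a)
    lemma₁ = solve-∀
    lemma₂ : ∀ u v q → - ((u * v - 1ℤ) * q) + u * ((v - 1ℤ) * q) + v * ((u - 1ℤ) * q) ≡ (u - 1ℤ) * (v - 1ℤ) * q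
    lemma₂ = solve-∀

  -- 2^k and 3^k are the inverses of 16 and 81, and k ≡ -5. The constants are 16 · 81 · (-5) = 240 ·
  -- (-27) and (1 - 16)(1 - 81) = 240 · 5.
  weighted-single-value : - + 27 * weighted-single ≈ + 5 * bernoulliₚ
  weighted-single-value = collect {+ 16} {+ 81} { - + 5} {+ 240} { - + 27} {+ 5} {(+ 2) ^ k} {(+ 3) ^ k} {weighted-single} {bernoulliₚ} refl refl unit-240
    (fourth-inverse 2 unit-2) (fourth-inverse 3 unit-3) (≈-trans (*ʳ weighted-single (≈-sym k≈-5)) k-weighted-single)

-- The binomials C(2p - 2j, p - j).

module DualBinomials (n : ℕ) (prime : Prime (5 ℕ.+ (n ℕ.+ n))) where

  open import Data.Integer.Base using (_+_; _-_; _*_; -_)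
  open import Data.Integer.Properties hiding (module ≤-Reasoning; ≤-refl)
  open IntegerSums
  open Binomials
  open PrimeField n prime
  open import Data.Integer.Divisibility.Signed as ℤ using (∣⇒∣ᵤ)
  open import Data.Nat.Divisibility using (_∣_; divides)
  open CentralSums n prime
  open import Relation.Binary.Reasoning.Setoid ≈-setoid

  -- A case of Lucas's theorem: from i to i + 1 the coefficient is multiplied by (p + i + 1)/(i + 1)
  -- ≡ 1.
  binom-p+i : ∀ i → i ℕ.< p → binom (p ℕ.+ i) p ≈ 1ℤ
  binom-p+i zero    _   = ≡⇒≈ (trans (cong (λ m → binom m p) (ℕ.+-identityʳ p)) (cong +_ (nCn≡1 p)))
  binom-p+i (suc i) i<p = cancel (unit-< i<p) (begin
    + suc i * binom (p ℕ.+ suc i) p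
      ≡⟨ cong (λ m → + suc i * binom m p) (ℕ.+-suc p i) ⟩
    + suc i * binom (suc (p ℕ.+ i)) p
      ≡⟨ cong (_* binom (suc (p ℕ.+ i)) p) index ⟩
    (+ suc (p ℕ.+ i) - + p) * binom (suc (p ℕ.+ i)) p
      ≡⟨ binom-upper (p ℕ.+ i) p ⟩
    + suc (p ℕ.+ i) * binom (p ℕ.+ i) p
      ≈⟨ *-cong residue-index (binom-p+i i (ℕ.<-trans (ℕ.n<1+n i) i<p)) ⟩
    + suc i * 1ℤ ∎)
    where
    lemma : ∀ s p → s ≡ p + s - p
    lemma = solve-∀
    split : + suc (p ℕ.+ i) ≡ + p + + suc i
    split = trans (cong +_ (sym (ℕ.+-suc p i))) (pos-+ p (suc i))
    index : + suc i ≡ + suc (p ℕ.+ i) - + p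
    index = trans (lemma (+ suc i) (+ p)) (cong (_- + p) (sym split))
    residue-index : + suc (p ℕ.+ i) ≈ + suc i
    residue-index = ≈-trans (≡⇒≈ split) (≈-trans (+ʳ (+ suc i) p≈0) (≡⇒≈ (+-identityˡ (+ suc i))))

  central-p : central (suc P) 0 ≈ + 2
  central-p = ≈-trans (≡⇒≈ (sym (half-double P))) (*ˡ (+ 2) (≈-trans (≡⇒≈ (cong₂ binom
    (cong (ℕ._+ P) suc-P) (trans (ℕ.+-comm P 1) suc-P))) (binom-p+i P (subst (P ℕ.<_) suc-P ℕ.≤-refl))))

  central-step′ : ∀ i → + suc i * central (suc i) 0 ≡ + 2 * + suc (i ℕ.+ i) * central i 0
  central-step′ i = *-cancelˡ-≡ (+ suc i) _ _ (trans (lemma₁ (+ suc i) (central (suc i) 0)) (trans (central-step i 0)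
    (trans (cong (λ s → s * + suc (i ℕ.+ i) * central i 0) (trans (cong +_ (sym (double-suc i))) (pos-+ (suc i) (suc i))))
    (lemma₂ (+ suc i) (+ suc (i ℕ.+ i)) (central i 0)))))
    where
    lemma₁ : ∀ j c → j * (j * c) ≡ (j * j - 0ℤ) * c
    lemma₁ = solve-∀
    lemma₂ : ∀ j d c → (j + j) * d * c ≡ j * (+ 2 * d * c)
    lemma₂ = solve-∀

  ≈0⇒∣ : ∀ {a} → + a ≈ 0ℤ → p ∣ a
  ≈0⇒∣ {a} (congruent t eq) = ∣⇒∣ᵤ {+ p} {+ a} (ℤ.divides t (trans eq (trans (+-identityˡ (+ p * t)) (*-comm (+ p) t))))

  -- For m = p − j.
  record Dual (j m : ℕ) : Set where
    field
      u : ℕ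
      central-u : (m ℕ.+ m) C (m ℕ.+ 0) ≡ u ℕ.* p
      u-central : + u * (+ j * central j 0) ≈ - + 2

  private
    dual-from : ∀ j m → central m 0 ≈ 0ℤ → (∀ u → central m 0 ≡ + u * + p → + u * (+ j * central j 0) ≈ - + 2) → Dual j m
    dual-from j m c≈0 value with ≈0⇒∣ c≈0
    ... | divides u eq = record { u = u ; central-u = eq ; u-central = value u (trans (cong +_ eq) (pos-* u p)) }

    odd-≈ : ∀ i s → i ℕ.+ s ≡ p → + suc (i ℕ.+ i) ≈ 1ℤ - (+ s + + s)
    odd-≈ i s eq = begin
      + suc (i ℕ.+ i) ≡⟨ trans (pos-suc (i ℕ.+ i)) (cong (_+ 1ℤ) (pos-+ i i)) ⟩
      + i + + i + 1ℤ ≡⟨ lemma (+ i) (+ s) ⟩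
      + 2 * (+ i + + s) + (1ℤ - (+ s + + s)) ≈⟨ +ʳ (1ℤ - (+ s + + s)) (*ˡ (+ 2) (≈-trans (≡⇒≈ (trans (sym (pos-+ i s)) (cong +_ eq))) p≈0)) ⟩
      + 2 * 0ℤ + (1ℤ - (+ s + + s)) ≡⟨ +-identityˡ (1ℤ - (+ s + + s)) ⟩
      1ℤ - (+ s + + s)                        ∎
      where
      lemma : ∀ i s → i + i + 1ℤ ≡ + 2 * (i + s) + (1ℤ - (s + s))
      lemma = solve-∀

    unit-2 : Unit (+ 2)
    unit-2 = unit-< {1} (s≤s (s≤s (s≤s z≤n)))

  -- The recursion (m + 1) C(2m + 2, m + 1) = 2(2m + 1) C(2m, m) starts at m + 1 = p, which brings
  -- in the factor p, and C(2p, p) ≡ 2 gives u ≡ -1 for j = 1. Going down, 2(2m + 1) is a unit, so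
  -- the factor p persists. Divided by p, the recursion changes u by (m + 1)/(2(2m + 1)) ≡ j/(2(2j +
  -- 1)), while j C(2j, j) changes by the inverse; their product is constant.
  dual : ∀ i m → i ℕ.< N → m ℕ.+ suc i ≡ p → Dual (suc i) m
  dual zero m _ m+1≡p = subst (Dual 1) P≡m (dual-from 1 P central-P value)
    where
    P≡m : P ≡ m
    P≡m = ℕ.suc-injective (trans suc-P (trans (sym m+1≡p) (ℕ.+-comm m 1)))
    P+1≡p : P ℕ.+ 1 ≡ p
    P+1≡p = trans (ℕ.+-comm P 1) suc-P
    central-P : central P 0 ≈ 0ℤ
    central-P = cancel {+ 2 * + suc (P ℕ.+ P)} (unit-* unit-2 (unit-≈ { - 1ℤ} (≈-sym (odd-≈ P 1 P+1≡p)) (unit-neg {1ℤ} unit-1))) (begin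
      + 2 * + suc (P ℕ.+ P) * central P 0 ≡⟨ central-step′ P ⟨
      + suc P * central (suc P) 0 ≈⟨ *ʳ (central (suc P) 0) (≈-trans (≡⇒≈ (cong +_ suc-P)) p≈0) ⟩
      0ℤ * central (suc P) 0 ≡⟨ trans (*-zeroˡ (central (suc P) 0)) (sym (*-zeroʳ (+ 2 * + suc (P ℕ.+ P)))) ⟩
      + 2 * + suc (P ℕ.+ P) * 0ℤ            ∎)
    value : ∀ u → central P 0 ≡ + u * + p → + u * (1ℤ * + 2) ≈ - + 2
    value u eq = begin
      + u * (1ℤ * + 2) ≡⟨ lemma₂ (+ u) ⟩
      - (+ 2 * (1ℤ - (1ℤ + 1ℤ)) * + u) ≈⟨ neg-cong (*ʳ (+ u) (*ˡ (+ 2) (≈-sym (odd-≈ P 1 P+1≡p)))) ⟩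
      - (+ 2 * + suc (P ℕ.+ P) * + u) ≡⟨ cong -_ u-eq ⟨
      - central (suc P) 0 ≈⟨ neg-cong central-p ⟩
      - + 2                                   ∎
      where
      lemma₁ : ∀ d u p → + 2 * d * (u * p) ≡ p * (+ 2 * d * u)
      lemma₁ = solve-∀
      lemma₂ : ∀ u → u * (1ℤ * + 2) ≡ - (+ 2 * (1ℤ - (1ℤ + 1ℤ)) * u)
      lemma₂ = solve-∀
      u-eq : central (suc P) 0 ≡ + 2 * + suc (P ℕ.+ P) * + u
      u-eq = *-cancelˡ-≡ (+ p) _ _ (trans (cong (λ s → + s * central (suc P) 0) (sym suc-P)) (trans (central-step′ P)
        (trans (cong (+ 2 * + suc (P ℕ.+ P) *_) eq) (lemma₁ (+ suc (P ℕ.+ P)) (+ u) (+ p)))))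
  dual (suc i) m i+1<N eq = dual-from (suc (suc i)) m central-m value
    where
    module D = Dual (dual i (suc m) (ℕ.<-trans (ℕ.n<1+n i) i+1<N) (trans (sym (ℕ.+-suc m (suc i))) eq))
    c-suc : central (suc m) 0 ≡ + D.u * + p
    c-suc = trans (cong +_ D.central-u) (pos-* D.u p)
    d = + suc (m ℕ.+ m)
    j = suc i
    odd-eq : + suc (j ℕ.+ j) ≡ + j + + j + 1ℤ
    odd-eq = trans (pos-suc (j ℕ.+ j)) (cong (_+ 1ℤ) (pos-+ j j))
    d≈ : d ≈ - + suc (j ℕ.+ j)
    d≈ = ≈-trans (odd-≈ m (suc j) eq) (≡⇒≈ (trans (cong (λ s → 1ℤ - (s + s)) (pos-suc j)) (trans (lemma (+ j)) (cong -_ (sym odd-eq)))))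
      where
      lemma : ∀ j → 1ℤ - ((j + 1ℤ) + (j + 1ℤ)) ≡ - (j + j + 1ℤ)
      lemma = solve-∀
    m+1≈ : + suc m ≈ - + j
    m+1≈ = begin
      + suc m ≡⟨ lemma (+ suc m) (+ j) ⟩
      + suc m + + j - + j ≈⟨ +ʳ (- + j) (≈-trans (≡⇒≈ (trans (sym (pos-+ (suc m) j)) (cong +_ (trans (sym (ℕ.+-suc m j)) eq)))) p≈0) ⟩
      0ℤ - + j ≡⟨ +-identityˡ (- + j) ⟩
      - + j                ∎
      where
      lemma : ∀ x y → x ≡ x + y - y
      lemma = solve-∀
    central-m : central m 0 ≈ 0ℤ
    central-m = cancel {+ 2 * d} (unit-* unit-2 (unit-≈ (≈-sym d≈) (unit-neg (unit-odd i+1<N)))) (begin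
      + 2 * d * central m 0 ≡⟨ central-step′ m ⟨
      + suc m * central (suc m) 0 ≡⟨ cong (+ suc m *_) (trans c-suc (*-comm (+ D.u) (+ p))) ⟩
      + suc m * (+ p * + D.u) ≈⟨ *ˡ (+ suc m) (multiple (+ D.u)) ⟩
      + suc m * 0ℤ ≡⟨ trans (*-zeroʳ (+ suc m)) (sym (*-zeroʳ (+ 2 * d))) ⟩
      + 2 * d * 0ℤ                     ∎)
    value : ∀ u → central m 0 ≡ + u * + p → + u * (+ suc j * central (suc j) 0) ≈ - + 2
    value u eq′ = begin
      + u * (+ suc j * central (suc j) 0) ≡⟨ cong (+ u *_) (central-step′ j) ⟩
      + u * (+ 2 * + suc (j ℕ.+ j) * central j 0) ≡⟨ lemma₂ (+ u) (+ suc (j ℕ.+ j)) (central j 0) ⟩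
      - (+ 2 * - + suc (j ℕ.+ j) * + u * central j 0) ≈⟨ neg-cong (*ʳ (central j 0) (*ʳ (+ u) (*ˡ (+ 2) (≈-sym d≈)))) ⟩
      - (+ 2 * d * + u * central j 0) ≡⟨ cong (λ x → - (x * central j 0)) u-eq ⟨
      - (+ suc m * + D.u * central j 0) ≈⟨ neg-cong (*ʳ (central j 0) (*ʳ (+ D.u) m+1≈)) ⟩
      - (- + j * + D.u * central j 0) ≡⟨ lemma₃ (+ j) (+ D.u) (central j 0) ⟩
      + D.u * (+ j * central j 0) ≈⟨ D.u-central ⟩
      - + 2                                                   ∎
      where
      lemma₁ : ∀ d u p → + 2 * d * (u * p) ≡ p * (+ 2 * d * u)
      lemma₁ = solve-∀
      lemma₂ : ∀ u d c → u * (+ 2 * d * c) ≡ - (+ 2 * - d * u * c)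
      lemma₂ = solve-∀
      lemma₃ : ∀ j u c → - (- j * u * c) ≡ u * (j * c)
      lemma₃ = solve-∀
      lemma₄ : ∀ p s u → p * (s * u) ≡ s * (u * p)
      lemma₄ = solve-∀
      u-eq : + suc m * + D.u ≡ + 2 * d * + u
      u-eq = *-cancelˡ-≡ (+ p) _ _ (trans (lemma₄ (+ p) (+ suc m) (+ D.u)) (trans (cong (+ suc m *_) (sym c-suc))
        (trans (central-step′ m) (trans (cong (+ 2 * d *_) eq′) (lemma₁ d (+ u) (+ p))))))

-- Reduction of the two rational sums modulo p.

module Evaluate (n : ℕ) (prime : Prime (5 ℕ.+ (n ℕ.+ n))) where

  open import Data.Fin.Base using (Fin; toℕ)
  open import Data.Fin.Properties using (toℕ<n)
  open import Data.Integer.Base using (_+_; _-_; _*_; -_; _^_)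
  open import Data.Integer.Properties hiding (module ≤-Reasoning; ≤-refl)
  open import Data.Nat.Divisibility using (divides)
  open import Defs
  open IntegerSums
  open Binomials
  open PrimeField n prime
  open CentralSums n prime
  open Residues n prime
  open DualBinomials n prime
  open import Relation.Binary.Reasoning.Setoid ≈-setoid

  ι-1 : ∀ {a x} → Unit (+ a) → + a * x ≈ 1ℤ → 1ℤ * ι a ≈ x
  ι-1 {a} u ax≈1 = ≈-trans (≡⇒≈ (*-identityˡ (ι a))) (≈-sym (ι-unique u ax≈1))

  square-ι : ∀ {a} → Unit (+ a) → + (a ℕ.^ 2) * q a ≈ 1ℤ
  square-ι {a} u = ≈-trans (≡⇒≈ (cong (_* q a) (trans (pos-^ a 2) (lemma (+ a))))) (square-q u)
    where
    lemma : ∀ a → a * (a * 1ℤ) ≡ a * a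
    lemma = solve-∀

  H⁽²⁾-∼ : ∀ j → j ℕ.≤ N → H⁽²⁾ j ∼ h₁ j
  H⁽²⁾-∼ j j≤N = ∼-sum j term
    where
    term : ∀ (i : Fin j) → (+ 1 ℚ./ (suc (toℕ i) ℕ.^ 2)) {{ℕ.m^n≢0 (suc (toℕ i)) 2}} ∼ 1ℤ * q (suc (toℕ i))
    term i = ∼-≈ (∼-/ 1ℤ (suc (toℕ i) ℕ.^ 2) {{ℕ.m^n≢0 (suc (toℕ i)) 2}} (unit-^ 2 u))
      (≈-trans (ι-1 (unit-^ 2 u) (square-ι u)) (≡⇒≈ (sym (*-identityˡ (q (suc (toℕ i)))))))
      where u = unit-≤N (ℕ.<-≤-trans (toℕ<n i) j≤N)

  factor : ℕ → ℤ
  factor j = q j + h₁ j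

  factor-∼ : ∀ i → i ℕ.< N → (+ 1 ℚ./ (suc i ℕ.^ 2)) {{ℕ.m^n≢0 (suc i) 2}} ℚ.+ H⁽²⁾ suc i ∼ factor (suc i)
  factor-∼ i i<N = ∼-+ (∼-≈ (∼-/ 1ℤ (suc i ℕ.^ 2) {{ℕ.m^n≢0 (suc i) 2}} (unit-^ 2 (unit-≤N i<N))) (ι-1 (unit-^ 2 (unit-≤N i<N)) (square-ι (unit-≤N i<N))))
    (H⁽²⁾-∼ (suc i) i<N)

  summand₁ : ℕ → ℤ
  summand₁ j = central j 0 * (ι j * q j) * factor j

  cube-ι : ∀ {a} → Unit (+ a) → + (a ℕ.^ 3) * (ι a * q a) ≈ 1ℤ
  cube-ι {a} u = begin
    + (a ℕ.^ 3) * (ι a * q a) ≡⟨ cong (_* (ι a * q a)) (pos-^ a 3) ⟩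
    (+ a) ^ 3 * (ι a * q a) ≡⟨ lemma (+ a) (ι a) (q a) ⟩
    + a * ι a * (+ a * + a * q a) ≈⟨ *-cong (*-ι u) (square-q u) ⟩
    1ℤ                              ∎
    where
    lemma : ∀ a v q → a * (a * (a * 1ℤ)) * (v * q) ≡ a * v * (a * a * q)
    lemma = solve-∀

  term₁-∼ : ∀ i → i ℕ.< N →
    (+ ((2 ℕ.* suc i) C suc i) ℚ./ (suc i ℕ.^ 3)) {{ℕ.m^n≢0 (suc i) 3}}
      ℚ.* ((+ 1 ℚ./ (suc i ℕ.^ 2)) {{ℕ.m^n≢0 (suc i) 2}} ℚ.+ H⁽²⁾ suc i) ∼ summand₁ (suc i)
  term₁-∼ i i<N = ∼-* (∼-≈ (∼-/ (+ ((2 ℕ.* suc i) C suc i)) (suc i ℕ.^ 3) {{ℕ.m^n≢0 (suc i) 3}} (unit-^ 3 u))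
    (*-cong (≡⇒≈ (cong₂ binom (cong (suc i ℕ.+_) (ℕ.+-identityʳ (suc i))) (sym (ℕ.+-identityʳ (suc i)))))
      (≈-sym (ι-unique (unit-^ 3 u) (cube-ι u))))) (factor-∼ i i<N)
    where u = unit-≤N i<N

  private
    p∸-+ : ∀ i → i ℕ.< N → (p ℕ.∸ suc i) ℕ.+ suc i ≡ p
    p∸-+ i i<N = ℕ.m∸n+n≡m (ℕ.<⇒≤ (ℕ.≤-<-trans i<N N<p))

    2p∸2j : ∀ i → i ℕ.< N → (2 ℕ.* p ℕ.∸ 2 ℕ.* suc i) C (p ℕ.∸ suc i) ≡ ((p ℕ.∸ suc i) ℕ.+ (p ℕ.∸ suc i)) C ((p ℕ.∸ suc i) ℕ.+ 0)
    2p∸2j i i<N = cong₂ _C_ (trans (sym (ℕ.*-distribˡ-∸ 2 p (suc i))) (cong ((p ℕ.∸ suc i) ℕ.+_) (ℕ.+-identityʳ (p ℕ.∸ suc i)))) (sym (ℕ.+-identityʳ (p ℕ.∸ suc i)))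

  -- The denominator is m = j⁴ u p with u from `Dual`, so x = 1/(j⁴ u), and u j C(2j, j) ≡ -2
  -- replaces 1/u by -j C(2j, j)/2.
  reciprocal-∼ : ∀ i → i ℕ.< N → ∀ m → m ≡ suc i ℕ.^ 4 ℕ.* ((2 ℕ.* p ℕ.∸ 2 ℕ.* suc i) C (p ℕ.∸ suc i)) → ∀ {x} →
    ⟦ + m ⟧ ℚ.* x ≡ ⟦ + p ⟧ → x ∼ - ι 2 * (central (suc i) 0 * (ι (suc i) * q (suc i)))
  reciprocal-∼ i i<N m m≡ {x} mx≡p = ∼-≈ (∼-inverse w {{ℕ.≢-nonZero w≢0}} w-unit 1ℤ wx≡1) (ι-1 w-unit value)
    where
    j = suc i
    open Dual (dual i (p ℕ.∸ suc i) i<N (p∸-+ i i<N))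
    w : ℕ
    w = j ℕ.^ 4 ℕ.* u
    j-unit = unit-≤N i<N
    c = central j 0
    2-unit : Unit (+ 2)
    2-unit = unit-< {1} (s≤s (s≤s (s≤s z≤n)))
    m≡pw : + m ≡ + p * + w
    m≡pw = trans (cong +_ (trans m≡ (trans (cong (j ℕ.^ 4 ℕ.*_) (trans (2p∸2j i i<N) central-u)) (lemma (j ℕ.^ 4) u p)))) (pos-* p w)
      where
      lemma : ∀ x u p → x ℕ.* (u ℕ.* p) ≡ p ℕ.* (x ℕ.* u)
      lemma = ℕ-solve-∀
    wx≡1 : ⟦ + w ⟧ ℚ.* x ≡ ⟦ 1ℤ ⟧
    wx≡1 = *-cancelˡ p (trans (sym (ℚ.*-assoc ⟦ + p ⟧ ⟦ + w ⟧ x)) (trans (cong (ℚ._* x) (trans (sym (⟦⟧-* (+ p) (+ w))) (cong ⟦_⟧ (sym m≡pw))))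
      (trans mx≡p (sym (trans (cong (⟦ + p ⟧ ℚ.*_) (⟦⟧-def 1ℤ)) (ℚ.*-identityʳ ⟦ + p ⟧))))))
    value : + w * (- ι 2 * (c * (ι j * q j))) ≈ 1ℤ
    value = begin
      + w * (- ι 2 * (c * (ι j * q j)))
        ≡⟨ cong (_* (- ι 2 * (c * (ι j * q j)))) (trans (pos-* (j ℕ.^ 4) u) (cong (_* + u) (pos-^ j 4))) ⟩
      (+ j) ^ 4 * + u * (- ι 2 * (c * (ι j * q j)))
        ≡⟨ lemma₁ (+ j) (+ u) (ι 2) c (ι j) (q j) ⟩
      + u * (+ j * c) * - ι 2 * (+ j * ι j * (+ j * + j * q j))
        ≈⟨ *-cong (*ʳ (- ι 2) u-central) (*-cong (*-ι j-unit) (square-q j-unit)) ⟩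
      - + 2 * - ι 2 * (1ℤ * 1ℤ)
        ≡⟨ lemma₂ (ι 2) ⟩
      + 2 * ι 2
        ≈⟨ *-ι 2-unit ⟩
      1ℤ ∎
      where
      lemma₁ : ∀ j u t c v q → j * (j * (j * (j * 1ℤ))) * u * (- t * (c * (v * q))) ≡ u * (j * c) * - t * (j * v * (j * j * q))
      lemma₁ = solve-∀
      lemma₂ : ∀ t → - + 2 * - t * (1ℤ * 1ℤ) ≡ + 2 * t
      lemma₂ = solve-∀
    -- `value` exhibits an inverse of w modulo p, so p divides neither w nor u.
    w-unit : Unit (+ w)
    w-unit = unit-factor (unit-≈ (≈-sym value) unit-1)
    w≢0 : w ≢ 0
    w≢0 w≡0 = Unit.p∤ w-unit (divides 0 w≡0)

  term₂-∼ : ∀ i → i ℕ.< N →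
    (+ p ℚ./ (suc i ℕ.^ 4 ℕ.* ((2 ℕ.* p ℕ.∸ 2 ℕ.* suc i) C (p ℕ.∸ suc i))))
        {{ℕ.m*n≢0 (suc i ℕ.^ 4) _ {{ℕ.m^n≢0 (suc i) 4}} {{central-nonZero p (suc i)}}}}
      ℚ.* ((+ 1 ℚ./ (suc i ℕ.^ 2)) {{ℕ.m^n≢0 (suc i) 2}} ℚ.+ H⁽²⁾ suc i) ∼ - ι 2 * summand₁ (suc i)
  term₂-∼ i i<N = ∼-≈ (∼-* (reciprocal-∼ i i<N m refl (/-* (+ p) m {{m≢0}})) (factor-∼ i i<N))
    (≡⇒≈ (*-assoc (- ι 2) _ (factor (suc i))))
    where
    m : ℕ
    m = suc i ℕ.^ 4 ℕ.* ((2 ℕ.* p ℕ.∸ 2 ℕ.* suc i) C (p ℕ.∸ suc i))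
    m≢0 : NonZero m
    m≢0 = ℕ.m*n≢0 (suc i ℕ.^ 4) _ {{ℕ.m^n≢0 (suc i) 4}} {{central-nonZero p (suc i)}}

  -- The upper limit is a variable because the theorem obtains it by dividing p - 1 by 2, while `N`
  -- is n + 2.
  S₁ S₂ : ℕ → ℚ.ℚ
  S₁ M = ∑₁ M λ j →
    (+ ((2 ℕ.* j) C j) ℚ./ (j ℕ.^ 3)) {{ℕ.m^n≢0 j 3}} ℚ.* ((+ 1 ℚ./ (j ℕ.^ 2)) {{ℕ.m^n≢0 j 2}} ℚ.+ H⁽²⁾ j)
  S₂ M = ∑₁ M λ j →
    (+ p ℚ./ (j ℕ.^ 4 ℕ.* ((2 ℕ.* p ℕ.∸ 2 ℕ.* j) C (p ℕ.∸ j))))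
        {{ℕ.m*n≢0 (j ℕ.^ 4) _ {{ℕ.m^n≢0 j 4}} {{central-nonZero p j}}}}
      ℚ.* ((+ 1 ℚ./ (j ℕ.^ 2)) {{ℕ.m^n≢0 j 2}} ℚ.+ H⁽²⁾ j)

  total : ℤ
  total = Sum N summand₁

  S₁-∼ : ∀ {M} → M ≡ N → S₁ M ∼ total
  S₁-∼ {M} eq = subst (λ m → S₁ M ∼ Sum m summand₁) eq (∼-sum M (λ i → term₁-∼ (toℕ i) (subst (toℕ i ℕ.<_) eq (toℕ<n i))))

  S₂-∼ : ∀ {M} → M ≡ N → ℚ.- (+ 2 ℚ./ 1) ℚ.* S₂ M ∼ total
  S₂-∼ {M} eq = ∼-≈ (∼-* (∼-neg (subst (_∼ + 2) (⟦⟧-def (+ 2)) (∼-⟦⟧ (+ 2)))) sum₂) (begin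
    - + 2 * Sum N (λ j → - ι 2 * summand₁ j) ≡⟨ cong (- + 2 *_) (Sum-*ˡ N (- ι 2) summand₁) ⟩
    - + 2 * (- ι 2 * total) ≡⟨ lemma (ι 2) total ⟩
    + 2 * ι 2 * total ≈⟨ *ʳ total (*-ι (unit-< {1} (s≤s (s≤s (s≤s z≤n))))) ⟩
    1ℤ * total ≡⟨ *-identityˡ total ⟩
    total                                       ∎)
    where
    lemma : ∀ t x → - + 2 * (- t * x) ≡ + 2 * t * x
    lemma = solve-∀
    sum₂ : S₂ M ∼ Sum N (λ j → - ι 2 * summand₁ j)
    sum₂ = subst (λ m → S₂ M ∼ Sum m (λ j → - ι 2 * summand₁ j)) eq (∼-sum M (λ i → term₂-∼ (toℕ i) (subst (toℕ i ℕ.<_) eq (toℕ<n i))))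

-- The value of the first sum in terms of the Bernoulli number.

module Value (n : ℕ) (prime : Prime (5 ℕ.+ (n ℕ.+ n))) (0<n : 0 ℕ.< n) where

  open import Data.Integer.Base using (_+_; _-_; _*_; -_)
  open import Data.Integer.Properties hiding (module ≤-Reasoning; ≤-refl)
  open import Defs
  open IntegerSums
  open Binomials using (central)
  open PrimeField n prime
  open CentralSums n prime
  open Boundary n prime
  open Residues n prime
  open BernoulliMod n prime
  open HarmonicSums n prime 0<n
  open PeriodicCharacter n prime using (weighted-single)
  open Voronoi n prime 0<n
  open Evaluate n prime
  open import Relation.Binary.Reasoning.Setoid ≈-setoid

  -- At j = N the factors h₁ and h₂ vanish, so of the three boundary terms only the one with weight
  -- 1/m⁵ remains, and it is A.
  4-total : + 4 * (total + weighted-single) ≈ + 4 * alternating-fifth + (weighted-single - + 2 * single)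
  4-total = begin
    + 4 * (total + weighted-single)
      ≡⟨ trans (cong (+ 4 *_) (sym (Sum-+ N summand₁ _))) (sym (Sum-*ˡ N (+ 4) _)) ⟩
    Sum N (λ l → + 4 * (summand₁ l + h₂ l * (central l 0 * ι l)))
      ≡⟨ Sum-cong N (λ i _ → lemma₁ (central (suc i) 0) (ι (suc i)) (q (suc i)) (h₁ (suc i)) (h₂ (suc i))) ⟩
    Sum N (λ l → + 4 * (central l 0 * ι l) * full l)
      ≈⟨ telescoped N ℕ.≤-refl ⟩
    + 4 * (h₂ N * b₁ + h₁ N * b₂ + b₃) + Sum N (λ l → h₂ l * (central l 0 * ι l - + 2 * ι l))
      ≈⟨ +-cong (*ˡ (+ 4) (+-cong (+-cong (*ʳ b₁ h₂-N) (*ʳ b₂ h₁-N)) (boundary-N (pos ·q ·q ·q)))) (≡⇒≈ split) ⟩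
    + 4 * (0ℤ * b₁ + 0ℤ * b₂ + alternating-fifth) + (weighted-single - + 2 * single)
      ≡⟨ cong (λ x → + 4 * x + (weighted-single - + 2 * single)) (lemma₂ b₁ b₂ alternating-fifth) ⟩
    + 4 * alternating-fifth + (weighted-single - + 2 * single) ∎
    where
    b₁ = boundary (pos ·q) N
    b₂ = boundary (pos ·q ·q) N
    b₃ = boundary (pos ·q ·q ·q) N
    lemma₁ : ∀ c v q h₁ h₂ → + 4 * (c * (v * q) * (q + h₁) + h₂ * (c * v)) ≡ + 4 * (c * v) * (h₂ + h₁ * q + q * q)
    lemma₁ = solve-∀
    lemma₂ : ∀ x y a → 0ℤ * x + 0ℤ * y + a ≡ a
    lemma₂ = solve-∀
    lemma₃ : ∀ h x v → h * (x - + 2 * v) ≡ h * x - + 2 * (h * v)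
    lemma₃ = solve-∀
    split : Sum N (λ l → h₂ l * (central l 0 * ι l - + 2 * ι l)) ≡ weighted-single - + 2 * single
    split = trans (Sum-cong N (λ i _ → lemma₃ (h₂ (suc i)) (central (suc i) 0 * ι (suc i)) (ι (suc i))))
      (trans (Sum-sub N _ _) (cong (_-_ weighted-single) (Sum-*ˡ N (+ 2) _)))

  4-total′ : + 4 * total ≈ + 3 * bernoulliₚ - + 3 * weighted-single
  4-total′ = begin
    + 4 * total
      ≡⟨ lemma₁ total E ⟩
    + 4 * (total + E) - + 4 * E
      ≈⟨ +ʳ (- (+ 4 * E)) 4-total ⟩
    + 4 * alternating-fifth + (E - + 2 * single) - + 4 * E
      ≡⟨ lemma₂ alternating-fifth single E ⟩
    + 2 * (+ 2 * alternating-fifth) - + 2 * single - + 3 * E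
      ≈⟨ +ʳ (- (+ 3 * E)) (+ʳ (- (+ 2 * single)) (*ˡ (+ 2) (≈-sym Z₂-N))) ⟩
    + 2 * Z₂ N - + 2 * single - + 3 * E
      ≈⟨ +ʳ (- (+ 3 * E)) Z₂-single ⟩
    + 3 * bernoulliₚ - + 3 * E ∎
    where
    E = weighted-single
    lemma₁ : ∀ t e → + 4 * t ≡ + 4 * (t + e) - + 4 * e
    lemma₁ = solve-∀
    lemma₂ : ∀ a w e → + 4 * a + (e - + 2 * w) - + 4 * e ≡ + 2 * (+ 2 * a) - + 2 * w - + 3 * e
    lemma₂ = solve-∀

  9-total : + 9 * total ≈ + 8 * bernoulliₚ
  9-total = cancel {+ 4} {+ 9 * total} {+ 8 * bernoulliₚ} (unit-* {+ 2} {+ 2} unit-2 unit-2) (begin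
    + 4 * (+ 9 * total)
      ≡⟨ lemma₁ total ⟩
    + 9 * (+ 4 * total)
      ≈⟨ *ˡ (+ 9) 4-total′ ⟩
    + 9 * (+ 3 * bernoulliₚ - + 3 * weighted-single)
      ≡⟨ lemma₂ bernoulliₚ weighted-single ⟩
    + 27 * bernoulliₚ + - + 27 * weighted-single
      ≈⟨ +ˡ (+ 27 * bernoulliₚ) weighted-single-value ⟩
    + 27 * bernoulliₚ + + 5 * bernoulliₚ
      ≡⟨ lemma₃ bernoulliₚ ⟩
    + 4 * (+ 8 * bernoulliₚ) ∎)
    where
    lemma₁ : ∀ t → + 4 * (+ 9 * t) ≡ + 9 * (+ 4 * t)
    lemma₁ = solve-∀
    lemma₂ : ∀ b e → + 9 * (+ 3 * b - + 3 * e) ≡ + 27 * b + - + 27 * e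
    lemma₂ = solve-∀
    lemma₃ : ∀ b → + 27 * b + + 5 * b ≡ + 4 * (+ 8 * b)
    lemma₃ = solve-∀

  unit-9 : Unit (+ 9)
  unit-9 = unit-* {+ 3} {+ 3} unit-3 unit-3

  value-∼ : (+ 8 ℚ./ 9) ℚ.* bernoulli k ∼ + 8 * ι 9 * bernoulliₚ
  value-∼ = ∼-* (∼-/ (+ 8) 9 unit-9) bernoulli-∼

  total-value : total ≈ + 8 * ι 9 * bernoulliₚ
  total-value = cancel {+ 9} {total} {+ 8 * ι 9 * bernoulliₚ} unit-9 (begin
    + 9 * total ≈⟨ 9-total ⟩
    + 8 * bernoulliₚ ≡⟨ *-identityˡ (+ 8 * bernoulliₚ) ⟨
    1ℤ * (+ 8 * bernoulliₚ) ≈⟨ *ʳ (+ 8 * bernoulliₚ) (≈-sym (*-ι unit-9)) ⟩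
    + 9 * ι 9 * (+ 8 * bernoulliₚ) ≡⟨ lemma (ι 9) bernoulliₚ ⟩
    + 9 * (+ 8 * ι 9 * bernoulliₚ)     ∎)
    where
    lemma : ∀ v b → + 9 * v * (+ 8 * b) ≡ + 9 * (+ 8 * v * b)
    lemma = solve-∀

-- The theorem for p = 5 and for p > 5.

open import Defs
open import Data.Integer.Base using (+_)
open import Data.Nat.Base as ℕ using (ℕ; _∸_; _<_; _^_)
open import Data.Nat.Combinatorics using (_C_)
open import Data.Nat.Primality using (Prime)
open import Data.Nat.Properties using (m*n≢0; m^n≢0)
open import Data.Product using (_×_)
open import Data.Rational using (ℚ; _/_; _+_; _*_; -_)
open import Data.Nat.Coprimality using (coprime?)
open import Data.Nat.Divisibility using (divides)

prime-form : ∀ p → Prime p → 3 < p → ∃[ n ] p ≡ 5 ℕ.+ (n ℕ.+ n)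
prime-form p pr 3<p = by-cases (p ℕ./ 2) (p ℕ.% 2) (m%n<n p 2) (m≡m%n+[m/n]*n p 2) 3<p
  where
  lemma : ∀ n → 1 ℕ.+ (2 ℕ.+ n) ℕ.* 2 ≡ 5 ℕ.+ (n ℕ.+ n)
  lemma = ℕ-solve-∀
  by-cases : ∀ s r → r < 2 → p ≡ r ℕ.+ s ℕ.* 2 → 3 < p → ∃[ n ] p ≡ 5 ℕ.+ (n ℕ.+ n)
  by-cases s 0 _ eq 3<p with prime⇒irreducible pr {2} (divides s eq)
  by-cases s 0 _ eq (s≤s (s≤s ())) | inj₂ refl
  by-cases zero          1 _ refl (s≤s ())
  by-cases (suc zero)    1 _ refl (s≤s (s≤s (s≤s ())))
  by-cases (suc (suc n)) 1 _ eq   _ = n , trans eq (lemma n)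
  by-cases s (suc (suc r)) (s≤s (s≤s ())) eq _

half : ∀ n → (4 ℕ.+ (n ℕ.+ n)) ℕ./ 2 ≡ 2 ℕ.+ n
half n = trans (cong (ℕ._/ 2) (lemma n)) (m*n/n≡m (2 ℕ.+ n) 2)
  where
  lemma : ∀ n → 4 ℕ.+ (n ℕ.+ n) ≡ (2 ℕ.+ n) ℕ.* 2
  lemma = ℕ-solve-∀

Congruences : ℕ → Set
Congruences p =
  let
    N : ℕ
    N = (p ∸ 1) ℕ./ 2

    S₁ : ℚ
    S₁ = ∑₁ N λ j →
      (+ ((2 ℕ.* j) C j) / (j ^ 3)) {{m^n≢0 j 3}}
        * ((+ 1 / (j ^ 2)) {{m^n≢0 j 2}} + H⁽²⁾ j)

    S₂ : ℚ
    S₂ = ∑₁ N λ j →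
      (+ p / (j ^ 4 ℕ.* ((2 ℕ.* p ∸ 2 ℕ.* j) C (p ∸ j))))
          {{m*n≢0 (j ^ 4) _ {{m^n≢0 j 4}} {{central-nonZero p j}}}}
        * ((+ 1 / (j ^ 2)) {{m^n≢0 j 2}} + H⁽²⁾ j)
  in
  (S₁ ≡ - (+ 2 / 1) * S₂ [mod p ])
    × (- (+ 2 / 1) * S₂ ≡ (+ 8 / 9) * bernoulli (p ∸ 5) [mod p ])

-- For p = 5 the power sum H₄(p − 1) is not divisible by p, so this case is computed.
congruences-5 : Congruences 5
congruences-5 =
  (+ 489 / 448 , refl , toWitness {a? = coprime? 448 5} _) ,
  (-[1+ 984 ] / 4032 , refl , toWitness {a? = coprime? 4032 5} _)

congruences->5 : ∀ m → Prime (5 ℕ.+ (suc m ℕ.+ suc m)) → Congruences (5 ℕ.+ (suc m ℕ.+ suc m))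
congruences->5 m pr = ∼⇒mod {a = total} {b = total} (S₁-∼ N≡) (S₂-∼ N≡) ≈-refl , ∼⇒mod {a = total} (S₂-∼ N≡) value-∼ total-value
  where
  open PrimeField (suc m) pr using (N; N≡2+n; ≈-refl)
  open Residues (suc m) pr using (∼⇒mod)
  open Evaluate (suc m) pr using (S₁-∼; S₂-∼; total)
  open Value (suc m) pr (s≤s z≤n) using (value-∼; total-value)
  N≡ : (4 ℕ.+ (suc m ℕ.+ suc m)) ℕ./ 2 ≡ N
  N≡ = trans (half (suc m)) (sym N≡2+n)

congruences : ∀ p → Prime p → ∃[ n ] p ≡ 5 ℕ.+ (n ℕ.+ n) → Congruences p
congruences p pr (zero  , refl) = congruences-5
congruences p pr (suc m , refl) = congruences->5 m pr

theorem2 : (p : ℕ) → Prime p → 3 < p →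
  let
    N : ℕ
    N = (p ∸ 1) ℕ./ 2

    S₁ : ℚ
    S₁ = ∑₁ N λ j →
      (+ ((2 ℕ.* j) C j) / (j ^ 3)) {{m^n≢0 j 3}}
        * ((+ 1 / (j ^ 2)) {{m^n≢0 j 2}} + H⁽²⁾ j)

    S₂ : ℚ
    S₂ = ∑₁ N λ j →
      (+ p / (j ^ 4 ℕ.* ((2 ℕ.* p ∸ 2 ℕ.* j) C (p ∸ j))))
          {{m*n≢0 (j ^ 4) _ {{m^n≢0 j 4}} {{central-nonZero p j}}}}
        * ((+ 1 / (j ^ 2)) {{m^n≢0 j 2}} + H⁽²⁾ j)
  in
  (S₁ ≡ - (+ 2 / 1) * S₂ [mod p ])
    × (- (+ 2 / 1) * S₂ ≡ (+ 8 / 9) * bernoulli (p ∸ 5) [mod p ])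
theorem2 p pr 3<p = congruences p pr (prime-form p pr 3<p)
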